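{- There exists a two-player protocol for Max-Card-$k$ (in the two-player model described in the context) with an approximation guarantee of $0.514$ whose communication complexity is $O(k)$ elements, and in which both Alice's and Bob's algorithms run in polynomial time.
   Context: Two-player model for Max-Card-$k$: global information is a positive integer $k$, a finite ground set $W$ and a partition $W=W_A\,\dot\cup\,W_B$; Alice privately receives $V_A\subseteq W_A$ and Bob $V_B\subseteq W_B$; $f:2^W\to\mathbb{R}_{\ge0}$ is non-negative, monotone and submodular, Alice can query $f$ (value oracle) on subsets of $W_A$ and Bob on any subset of $W$. Alice (possibly randomized) computes a message $m$ and sends it to Bob; Bob outputs $S\subseteq V_A\cup V_B$ with $|S|\le k$ based on the global information, $V_B$, $m$ and his oracle. Communication complexity in elements is the maximum number of elements of $W$ appearing in $m$. Approximation guarantee $\rho$ means $\mathbb{E}[f(S)]\ge\rho\max\{f(T):T\subseteq V_A\cup V_B,|T|\le k\}$ for every instance. Polynomial time is in the size of the input, counting each oracle query as one step. -}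

module Defs where

open import Algebra.Structures using (IsCommutativeRing)
open import Data.Bool using (Bool; true; false; if_then_else_; not)
open import Data.Fin using (Fin; toℕ; fromℕ<)
open import Data.Fin.Subset using (Subset; ⊤; ⁅_⁆; ∁; _∪_; _∩_; ⋃; ∣_∣; _⊆_)
open import Data.Fin.Subset.Properties using (_⊆?_)
open import Data.List using (List; []; _∷_; [_]; _++_; map; foldr; filter; length)
import Data.List.Extrema as Extrema
open import Data.Maybe using (Maybe; just; nothing)
open import Data.Nat as ℕ using (ℕ; zero; suc; _∸_; _^_; _<?_; _≡ᵇ_)
open import Data.Nat.GeneralisedArithmetic using (fold)
open import Data.Nat.Logarithm using (⌈log₂_⌉)
open import Data.Product using (Σ; ∃; ∃₂; _×_; _,_)
open import Data.Vec as Vec using (Vec; tabulate; toList)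
open import Level using (Level; _⊔_) renaming (suc to lsuc)
open import Relation.Binary.Bundles using (TotalOrder)
open import Relation.Binary.Structures using (IsDecTotalOrder)
open import Relation.Binary.PropositionalEquality using (_≡_; _≢_)
open import Relation.Nullary using (¬_; Dec; yes; no; does)
open import Relation.Nullary.Decidable using (_×-dec_)

-- The library has no real numbers.  Archimedean ordered fields are, up to
-- isomorphism, the subfields of ℝ, so a set function with values in one of them
-- is a real-valued set function, and ℝ itself (classically, where its order is
-- decidable) is an instance.
record RealField c ℓ₁ ℓ₂ : Set (lsuc (c ⊔ ℓ₁ ⊔ ℓ₂)) where
  infix  8 _⁻¹
  infixl 7 _*_
  infixl 6 _+_ _-_
  infix  4 _≈_ _≤_
  field
    Carrier           : Set c
    _≈_               : Carrier → Carrier → Set ℓ₁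
    _≤_               : Carrier → Carrier → Set ℓ₂
    _+_ _*_           : Carrier → Carrier → Carrier
    -_ _⁻¹            : Carrier → Carrier
    0# 1#             : Carrier
    isCommutativeRing : IsCommutativeRing _≈_ _+_ _*_ -_ 0# 1#
    isDecTotalOrder   : IsDecTotalOrder _≈_ _≤_
    0≉1               : ¬ (0# ≈ 1#)
    *-inverseʳ        : ∀ x → ¬ (x ≈ 0#) → x * x ⁻¹ ≈ 1#
    +-monoˡ-≤         : ∀ x {y z} → y ≤ z → y + x ≤ z + x
    *-nonNeg          : ∀ {x y} → 0# ≤ x → 0# ≤ y → 0# ≤ x * y

  fromℕ : ℕ → Carrier
  fromℕ n = fold 0# (1# +_) n

  field
    archimedean       : ∀ x → ∃ λ n → x ≤ fromℕ n

  open IsDecTotalOrder isDecTotalOrder public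
    using (_≟_; _≤?_; isTotalOrder)

  totalOrder : TotalOrder c ℓ₁ ℓ₂
  totalOrder = record { isTotalOrder = isTotalOrder }

  _-_ : Carrier → Carrier → Carrier
  x - y = x + (- y)

  max : Carrier → List Carrier → Carrier
  max = Extrema.max totalOrder

  sum : List Carrier → Carrier
  sum = foldr _+_ 0#

-- All bit vectors of length n.  Since Subset n is Vec Bool n, these are also all
-- subsets of an n-element set.
bitVectors : ∀ n → List (Vec Bool n)
bitVectors zero    = [ Vec.[] ]
bitVectors (suc n) =
  map (false Vec.∷_) (bitVectors n) ++ map (true Vec.∷_) (bitVectors n)

------------------------------------------------------------------------
-- Algorithms: while-programs over a random-access memory M of naturals and a
-- memory R of reals (a real RAM), both initially zero, with a read-only input
-- array, fair coins and a value oracle.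

data Instr : Set where
  const          : (x v : ℕ) → Instr            -- M[x] := v
  add sub        : (x y z : ℕ) → Instr          -- M[x] := M[y] + M[z],  M[y] ∸ M[z]
  read           : (x y : ℕ) → Instr            -- M[x] := input[M[y]]
  load           : (x y : ℕ) → Instr            -- M[x] := M[M[y]]
  store          : (x y : ℕ) → Instr            -- M[M[x]] := M[y]
  one            : (x : ℕ) → Instr              -- R[x] := 1
  radd rsub rmul rdiv : (x y z : ℕ) → Instr     -- R[x] := R[y] ∘ R[z]
  rload          : (x y : ℕ) → Instr            -- R[x] := R[M[y]]
  rstore         : (x y : ℕ) → Instr            -- R[M[x]] := R[y]
  leq            : (x y z : ℕ) → Instr          -- M[x] := 1 if R[y] ≤ R[z], else 0
  flip           : (x : ℕ) → Instr              -- M[x] := a fresh fair coin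
  query          : (x y : ℕ) → Instr            -- R[x] := f {i ∈ W : M[M[y] + i] ≠ 0}
  emit           : (x : ℕ) → Instr              -- output the element M[x] of W

infixr 5 _⨾_

data Program : Set where
  instr : Instr → Program
  _⨾_   : Program → Program → Program
  ifnz  : ℕ → Program → Program → Program
  while : ℕ → Program → Program                 -- while M[x] ≠ 0

infix 9 _[_≔_]

_[_≔_] : ∀ {a} {A : Set a} → (ℕ → A) → ℕ → A → (ℕ → A)
(m [ x ≔ v ]) y = if x ≡ᵇ y then v else m y

-- The i-th entry of a list, or 0 beyond its end.
_‼_ : List ℕ → ℕ → ℕ
[]       ‼ _     = 0
(v ∷ vs) ‼ zero  = v
(v ∷ vs) ‼ suc i = vs ‼ i

bit : Bool → ℕ
bit b = if b then 1 else 0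

bits : ∀ {n} → Subset n → List ℕ
bits s = toList (Vec.map bit s)

querySet : ∀ {n} → (ℕ → ℕ) → ℕ → Subset n
querySet M a = tabulate λ i → not (M (a ℕ.+ toℕ i) ≡ᵇ 0)

module Semantics {c ℓ₁ ℓ₂} (ℝ : RealField c ℓ₁ ℓ₂) where
  open RealField ℝ

  record State (n : ℕ) : Set c where
    constructor ⟨_,_,_,_⟩
    field
      M      : ℕ → ℕ
      R      : ℕ → Carrier
      coins  : List Bool
      output : List (Fin n)

  initial : ∀ {n} → List Bool → State n
  initial coins = ⟨ (λ _ → 0) , (λ _ → 0#) , coins , [] ⟩

  -- f is the oracle and D the set whose subsets may be queried.
  -- Forbidden queries, division by zero, flipping without a coin left and
  -- emitting a number that is not an element of W are failures.
  module _ {n : ℕ} (f : Subset n → Carrier) (D : Subset n) (input : List ℕ) where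

    step : Instr → State n → Maybe (State n)
    step (const x v) ⟨ M , R , cs , o ⟩ = just ⟨ M [ x ≔ v ] , R , cs , o ⟩
    step (add x y z) ⟨ M , R , cs , o ⟩ = just ⟨ M [ x ≔ M y ℕ.+ M z ] , R , cs , o ⟩
    step (sub x y z) ⟨ M , R , cs , o ⟩ = just ⟨ M [ x ≔ M y ∸ M z ] , R , cs , o ⟩
    step (read x y)  ⟨ M , R , cs , o ⟩ = just ⟨ M [ x ≔ input ‼ M y ] , R , cs , o ⟩
    step (load x y)  ⟨ M , R , cs , o ⟩ = just ⟨ M [ x ≔ M (M y) ] , R , cs , o ⟩
    step (store x y) ⟨ M , R , cs , o ⟩ = just ⟨ M [ M x ≔ M y ] , R , cs , o ⟩
    step (one x)     ⟨ M , R , cs , o ⟩ = just ⟨ M , R [ x ≔ 1# ] , cs , o ⟩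
    step (radd x y z) ⟨ M , R , cs , o ⟩ = just ⟨ M , R [ x ≔ R y + R z ] , cs , o ⟩
    step (rsub x y z) ⟨ M , R , cs , o ⟩ = just ⟨ M , R [ x ≔ R y - R z ] , cs , o ⟩
    step (rmul x y z) ⟨ M , R , cs , o ⟩ = just ⟨ M , R [ x ≔ R y * R z ] , cs , o ⟩
    step (rdiv x y z) ⟨ M , R , cs , o ⟩ with R z ≟ 0#
    ... | yes _ = nothing
    ... | no  _ = just ⟨ M , R [ x ≔ R y * R z ⁻¹ ] , cs , o ⟩
    step (rload x y)  ⟨ M , R , cs , o ⟩ = just ⟨ M , R [ x ≔ R (M y) ] , cs , o ⟩
    step (rstore x y) ⟨ M , R , cs , o ⟩ = just ⟨ M , R [ M x ≔ R y ] , cs , o ⟩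
    step (leq x y z)  ⟨ M , R , cs , o ⟩ =
      just ⟨ M [ x ≔ bit (does (R y ≤? R z)) ] , R , cs , o ⟩
    step (flip x) ⟨ M , R , []     , o ⟩ = nothing
    step (flip x) ⟨ M , R , b ∷ cs , o ⟩ = just ⟨ M [ x ≔ bit b ] , R , cs , o ⟩
    step (query x y) ⟨ M , R , cs , o ⟩ with querySet M (M y) ⊆? D
    ... | yes _ = just ⟨ M , R [ x ≔ f (querySet M (M y)) ] , cs , o ⟩
    ... | no  _ = nothing
    step (emit x) ⟨ M , R , cs , o ⟩ with M x <? n
    ... | yes x<n = just ⟨ M , R , cs , o ++ [ fromℕ< x<n ] ⟩
    ... | no  _   = nothing

    open State

    -- Run p s t s′: p started in s halts in s′ after t steps.
    data Run : Program → State n → ℕ → State n → Set c where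
      instr   : ∀ {i s s′} → step i s ≡ just s′ → Run (instr i) s 1 s′
      seq     : ∀ {p q s s′ s″ t u} →
                Run p s t s′ → Run q s′ u s″ → Run (p ⨾ q) s (t ℕ.+ u) s″
      if-then : ∀ {x p q s s′ t} → M s x ≢ 0 →
                Run p s t s′ → Run (ifnz x p q) s (suc t) s′
      if-else : ∀ {x p q s s′ t} → M s x ≡ 0 →
                Run q s t s′ → Run (ifnz x p q) s (suc t) s′
      stop    : ∀ {x p s} → M s x ≡ 0 → Run (while x p) s 1 s
      loop    : ∀ {x p s s′ s″ t u} → M s x ≢ 0 →
                Run p s t s′ → Run (while x p) s′ u s″ →
                Run (while x p) s (suc (t ℕ.+ u)) s″

    -- The program halts on the given coins after t steps, having
    -- emitted the given elements in order.
    Computes : Program → List Bool → ℕ → List (Fin n) → Set c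
    Computes p coins t out =
      Σ (State n) λ s → Run p (initial coins) t s × output s ≡ out

record Protocol : Set where
  field
    alice bob : Program

module TwoPlayer {c ℓ₁ ℓ₂} (ℝ : RealField c ℓ₁ ℓ₂) where
  open RealField ℝ
  open Semantics ℝ

  -- The ground set W is Fin n, and WB is the complement of WA.
  record Instance : Set (c ⊔ ℓ₂) where
    field
      n k        : ℕ
      k-positive : 1 ℕ.≤ k
      WA         : Subset n

    WB : Subset n
    WB = ∁ WA

    field
      VA VB      : Subset n
      VA⊆WA      : VA ⊆ WA
      VB⊆WB      : VB ⊆ WB
      f          : Subset n → Carrier
      nonNeg     : ∀ S → 0# ≤ f S
      monotone   : ∀ {S T} → S ⊆ T → f S ≤ f T
      submodular : ∀ S T → f (S ∪ T) + f (S ∩ T) ≤ f S + f T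

    Feasible : Subset n → Set
    Feasible S = S ⊆ VA ∪ VB × ∣ S ∣ ℕ.≤ k

    feasible? : ∀ S → Dec (Feasible S)
    feasible? S = (S ⊆? VA ∪ VB) ×-dec (∣ S ∣ ℕ.≤? k)

    -- Starting the maximum from 0 changes nothing: f is non-negative and ∅ is
    -- feasible.
    OPT : Carrier
    OPT = max 0# (map f (filter feasible? (bitVectors n)))

    -- W, k and the partition; k is written in binary.
    size : ℕ
    size = n ℕ.+ ⌈log₂ suc k ⌉

    aliceInput : List ℕ
    aliceInput = n ∷ k ∷ bits WA ++ bits VA

    bobInput : List (Fin n) → List ℕ
    bobInput m = n ∷ k ∷ bits WA ++ bits VB ++ length m ∷ map toℕ m

  open Instance

  -- A message is a sequence of elements of W and nothing else: with unrestricted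
  -- side information, elements could be sent for free under another encoding.
  Message : Instance → Set
  Message I = List (Fin (n I))

  module _ (P : Protocol) (I : Instance) where
    open Protocol P

    AliceSends : List Bool → ℕ → Message I → Set c
    AliceSends coins t m = Computes (f I) (WA I) (aliceInput I) alice coins t m

    BobOutputs : Message I → ℕ → Subset (n I) → Set c
    BobOutputs m t S =
      Σ (List (Fin (n I))) λ out →
        Computes (f I) ⊤ (bobInput I m) bob [] t out × S ≡ ⋃ (map ⁅_⁆ out)

    Outcome : List Bool → Subset (n I) → Set c
    Outcome coins S =
      Σ (Message I) λ m →
        (∃ λ t → AliceSends coins t m) × (∃ λ t → BobOutputs m t S)

  -- Expectation over ℓ independent fair coins.
  𝔼 : ∀ ℓ → (Vec Bool ℓ → Carrier) → Carrier
  𝔼 ℓ X = fromℕ (2 ^ ℓ) ⁻¹ * sum (map X (bitVectors ℓ))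

  -- ℓ is a number of coins that suffices for every run (flipping with no coin
  -- left is a failure); the distribution of S does not depend on its choice.
  ApproximationGuarantee : Carrier → Protocol → Set (c ⊔ ℓ₂)
  ApproximationGuarantee ρ P =
    ∀ (I : Instance) →
    ∃ λ ℓ → Σ (Vec Bool ℓ → Subset (n I)) λ S →
      (∀ r → Outcome P I (toList r) (S r) × Feasible I (S r)) ×
      ρ * OPT I ≤ 𝔼 ℓ (λ r → f I (S r))

  LinearCommunication : Protocol → Set (c ⊔ ℓ₂)
  LinearCommunication P =
    ∃ λ C → ∀ (I : Instance) coins t (m : Message I) →
      AliceSends P I coins t m → length m ℕ.≤ C ℕ.* k I

  poly : (C d : ℕ) → ℕ → ℕ
  poly C d x = C ℕ.* suc x ^ d

  -- A run of at most T steps flips at most T coins.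
  AlicePolynomialTime : Protocol → Set (c ⊔ ℓ₂)
  AlicePolynomialTime P =
    ∃₂ λ C d → ∀ (I : Instance) (r : Vec Bool (poly C d (size I))) →
    ∃₂ λ t m → AliceSends P I (toList r) t m × t ℕ.≤ poly C d (size I)

  BobPolynomialTime : Protocol → Set (c ⊔ ℓ₂)
  BobPolynomialTime P =
    ∃₂ λ C d → ∀ (I : Instance) (m : Message I) →
    ∃₂ λ t S → BobOutputs P I m t S × t ℕ.≤ poly C d (size I ℕ.+ length m)

{-# OPTIONS --safe #-}
module Submission where

open import Defs
open import Algebra.Bundles using (CommutativeRing)
import Algebra.Properties.CommutativeMonoid.Mult as Mult
import Algebra.Properties.CommutativeSemigroup as CommutativeSemigroup
open import Data.Bool using (Bool; true; false; if_then_else_; not; _∧_; _∨_) renaming (T to IsTrue)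
open import Data.Bool.Properties using (T-≡; T-∧)
open import Data.Empty using (⊥-elim)
open import Data.Fin as Fin using (Fin; zero; suc; toℕ; fromℕ<; #_)
open import Data.Fin.Properties using (toℕ<n; toℕ-injective; toℕ-fromℕ<)
open import Data.Fin.Subset using (Subset; ⊤; ⁅_⁆; _∪_; _∩_; _─_; ⋃; _∈_; _∉_; _⊆_; ∣_∣) renaming (⊥ to ∅; _-_ to _without_)
open import Data.Fin.Subset.Properties
open import Data.List using (List; []; _∷_; [_]; _++_; length; map)
import Data.List.Extrema as Extrema
open import Data.List.Properties using (++-identityʳ; length-++)
open import Data.List.Relation.Unary.All as All using (All; []; _∷_)
import Data.List.Relation.Unary.All.Properties as Allₚ
open import Data.Maybe using (Maybe; just; _>>=_; fromMaybe)
open import Data.Maybe.Properties using (just-injective)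
open import Data.Nat as ℕ using (ℕ; zero; suc; z≤n; s≤s; _∸_; _^_; _≡ᵇ_; _<?_; ⌊_/2⌋; ⌈_/2⌉)
import Data.Nat.Properties as ℕₚ
open import Data.Nat.Tactic.RingSolver using (solve-∀)
open import Data.Product using (Σ; ∃; _×_; _,_; proj₁; proj₂)
open import Data.Sum using (_⊎_; inj₁; inj₂; [_,_]′)
open import Data.Unit using (tt) renaming (⊤ to Unit)
open import Data.Vec as Vec using (Vec; []; _∷_; tabulate; lookup; toList; here; there)
open import Data.Vec.Properties using (lookup∘tabulate; tabulate∘lookup; tabulate-cong; lookup⇒[]=; []=⇒lookup)
open import Function using (_∘_; id)
open import Function.Bundles using (Equivalence)
open import Level using (Level; _⊔_)
open import Relation.Binary.Bundles using (Poset)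
open import Relation.Binary.PropositionalEquality as ≡ using (_≡_; _≢_; refl; cong; cong₂; sym; trans; subst)
import Relation.Binary.Reasoning.PartialOrder as PosetReasoning
open import Relation.Binary.Structures using (IsDecTotalOrder)
open import Relation.Nullary using (yes; no; does)

-- The protocol is deterministic.  With κ = min (k, n + 1), Alice sends the 2κ elements of a
-- greedy sequence in V_A; let G_j be its first j elements and F(j) = f(G_j).  For every s ≤ κ
-- Bob starts from G_s, adds κ - s elements of V_B and of the message greedily, and he keeps
-- the best set; let V be its value.
--
-- Let O = A ∪ B be optimal, A ⊆ V_A, B ⊆ V_B, a = |A| and b = κ - a ≥ |B|.  What A adds to G_j,
-- α_j, is non-increasing and at most a times the next increment of F.  Hence
-- (q - p) α_q ≤ a (F(q) - F(p)), while f(O) ≤ f(G_j ∪ B) + α_j by submodularity.  A greedy run of j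
-- steps towards a target of τ elements closes all but a fraction exp(-j/τ) of the gap.
-- Taking s = κ; s = a with targets B and B ∪ G_κ; and s = ⌈a/2⌉ with target B for 2b or 3b steps
-- and then B ∪ G_{2κ}, one gets linear inequalities between f(O), V and values of F, whose
-- coefficients depend on b/κ only.  On each of five ranges of b/κ a non-negative combination of
-- them gives 514 f(O) ≤ 1000 V.  It matters that the target B ∪ G_{2κ} is infeasible.

-- The starts s = κ and s = a with target B alone give exactly f(O)/2: b steps close 1 - 1/e of the
-- gap to f(G_a ∪ B) ≥ f(O) - α_a, and α_a ≤ F(a) ≤ F(κ) ≤ V. The tight case is F(a) = F(κ) = α_a =
-- f(O)/2, and all else serves to exclude it. There α_κ vanishes, so that G_κ ∪ B is worth f(O); but
-- the bound on α_κ carries the factor a/b, which is useless when b/κ is small. For small b the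
-- start near a/2 takes over. As α_a is at most 2F(a) minus about 2F(a/2), the tight case makes
-- F(a/2) small; since α at a/2 is at most about 2F(a/2), G_{a/2} ∪ B is still worth f(O)/2. A few
-- multiples of b steps collect most of that and leave nearly κ/2 steps. These need a better target.
-- From α_{2κ} ≤ F(2κ) - F(κ) and F(2κ) ≤ f(G_{2κ} ∪ B) it follows that 2 f(G_{2κ} ∪ B) ≥ f(O) +
-- F(κ). This target has about 3κ/2 elements too many, but the greedy bound depends only on the
-- ratio of steps to target elements, here nearly 1/3.

-- Ordered fields, natural multiples and certified linear inequalities.

module OrderedField {c ℓ₁ ℓ₂} (ℝ : RealField c ℓ₁ ℓ₂) where
  open RealField ℝ

  commutativeRing : CommutativeRing c ℓ₁
  commutativeRing = record { isCommutativeRing = isCommutativeRing }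

  open CommutativeRing commutativeRing public
    using ( +-cong; +-congˡ; +-congʳ; +-comm; +-assoc; +-identityˡ; +-identityʳ; -‿inverseʳ
          ; *-congˡ; *-congʳ; *-comm; *-assoc; *-identityˡ; *-identityʳ; zeroˡ; distribʳ
          ; +-commutativeMonoid)
    renaming (refl to ≈-refl; sym to ≈-sym; trans to ≈-trans)
  private module Multiple = Mult +-commutativeMonoid
  open CommutativeSemigroup (CommutativeRing.+-commutativeSemigroup commutativeRing) public using (interchange)

  poset : Poset c ℓ₁ ℓ₂
  poset = record { isPartialOrder = IsDecTotalOrder.isPartialOrder isDecTotalOrder }

  open IsDecTotalOrder isDecTotalOrder public
    using (total) renaming (refl to ≤-refl; reflexive to ≤-reflexive; trans to ≤-trans; antisym to ≤-antisym)

  open PosetReasoning poset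

  +-monoʳ-≤ : ∀ x {y z} → y ≤ z → x + y ≤ x + z
  +-monoʳ-≤ x {y} {z} y≤z = begin
    x + y ≈⟨ +-comm x y ⟩
    y + x ≤⟨ +-monoˡ-≤ x y≤z ⟩
    z + x ≈⟨ +-comm z x ⟩
    x + z ∎

  +-mono-≤ : ∀ {x y u v} → x ≤ y → u ≤ v → x + u ≤ y + v
  +-mono-≤ {y = y} {u} x≤y u≤v = ≤-trans (+-monoˡ-≤ u x≤y) (+-monoʳ-≤ y u≤v)

  x+y-y : ∀ x y → (x + y) - y ≈ x
  x+y-y x y = ≈-trans (+-assoc x y (- y)) (≈-trans (+-congˡ (-‿inverseʳ y)) (+-identityʳ x))

  x-y+y : ∀ x y → (x - y) + y ≈ x
  x-y+y x y = ≈-trans (+-assoc x (- y) y)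
    (≈-trans (+-congˡ (≈-trans (+-comm (- y) y) (-‿inverseʳ y))) (+-identityʳ x))

  +-cancelʳ-≤ : ∀ z {x y} → x + z ≤ y + z → x ≤ y
  +-cancelʳ-≤ z {x} {y} h = begin
    x           ≈⟨ x+y-y x z ⟨
    (x + z) - z ≤⟨ +-monoˡ-≤ (- z) h ⟩
    (y + z) - z ≈⟨ x+y-y y z ⟩
    y           ∎

  ≤⇒0≤- : ∀ {x y} → x ≤ y → 0# ≤ y - x
  ≤⇒0≤- {x} {y} x≤y = begin
    0#    ≈⟨ -‿inverseʳ x ⟨
    x - x ≤⟨ +-monoˡ-≤ (- x) x≤y ⟩
    y - x ∎

  x≤x+y : ∀ {x y} → 0# ≤ y → x ≤ x + y
  x≤x+y {x} {y} 0≤y = begin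
    x      ≈⟨ +-identityʳ x ⟨
    x + 0# ≤⟨ +-monoʳ-≤ x 0≤y ⟩
    x + y  ∎

  0≤+ : ∀ {x y} → 0# ≤ x → 0# ≤ y → 0# ≤ x + y
  0≤+ 0≤x 0≤y = ≤-trans 0≤x (x≤x+y 0≤y)

  infixr 8 _·_

  -- Kept abstract so that the type checker never unfolds large numerals.
  abstract
    _·_ : ℕ → Carrier → Carrier
    _·_ = Multiple._×_

    ·-zero : ∀ x → 0 · x ≈ 0#
    ·-zero x = ≈-refl

    ·-suc : ∀ m x → suc m · x ≈ x + m · x
    ·-suc m x = ≈-refl

    ·-congʳ : ∀ m {x y} → x ≈ y → m · x ≈ m · y
    ·-congʳ = Multiple.×-congʳ

    ·-+ : ∀ m n x → (m ℕ.+ n) · x ≈ m · x + n · x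
    ·-+ m n x = Multiple.×-homo-+ x m n

    ·-* : ∀ m n x → (m ℕ.* n) · x ≈ m · (n · x)
    ·-* m n x = ≈-sym (Multiple.×-assocˡ x m n)

    ·-distrib-+ : ∀ m x y → m · (x + y) ≈ m · x + m · y
    ·-distrib-+ m x y = Multiple.×-distrib-+ x y m

    ·-nonNeg : ∀ m {x} → 0# ≤ x → 0# ≤ m · x
    ·-nonNeg zero    0≤x = ≤-refl
    ·-nonNeg (suc m) 0≤x = 0≤+ 0≤x (·-nonNeg m 0≤x)

    ·-monoʳ-≤ : ∀ m {x y} → x ≤ y → m · x ≤ m · y
    ·-monoʳ-≤ zero    x≤y = ≤-refl
    ·-monoʳ-≤ (suc m) x≤y = +-mono-≤ x≤y (·-monoʳ-≤ m x≤y)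

    ·-cancel-≤ : ∀ m {x y} → suc m · x ≤ suc m · y → x ≤ y
    ·-cancel-≤ m {x} {y} h with total x y
    ... | inj₁ x≤y = x≤y
    ... | inj₂ y≤x = +-cancelʳ-≤ (m · x) (≤-trans h (+-monoʳ-≤ y (·-monoʳ-≤ m y≤x)))

    fromℕ-* : ∀ m x → fromℕ m * x ≈ m · x
    fromℕ-* zero    x = zeroˡ x
    fromℕ-* (suc m) x = ≈-trans (distribʳ x 1# (fromℕ m)) (+-cong (*-identityˡ x) (fromℕ-* m x))

  ·-comm : ∀ m n x → m · (n · x) ≈ n · (m · x)
  ·-comm m n x = ≈-trans (≈-sym (·-* m n x))
    (≡.subst (λ k → k · x ≈ n · (m · x)) (ℕₚ.*-comm n m) (·-* n m x))

  ·-monoˡ-≤ : ∀ {m n x} → 0# ≤ x → m ℕ.≤ n → m · x ≤ n · x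
  ·-monoˡ-≤ {m} {n} {x} 0≤x m≤n = begin
    m · x                   ≤⟨ x≤x+y (·-nonNeg (n ℕ.∸ m) 0≤x) ⟩
    m · x + (n ℕ.∸ m) · x   ≈⟨ ·-+ m (n ℕ.∸ m) x ⟨
    (m ℕ.+ (n ℕ.∸ m)) · x   ≡⟨ ≡.cong (_· x) (ℕₚ.m+[n∸m]≡n m≤n) ⟩
    n · x                   ∎

  ·-cancel-pos : ∀ m {x y} → 1 ℕ.≤ m → m · x ≤ m · y → x ≤ y
  ·-cancel-pos (suc m) _ = ·-cancel-≤ m

  -- Linear inequalities with natural coefficients between non-negative unknowns.

  infixl 6 _⊕_
  infixr 7 _⊛_

  data Lin (m : ℕ) : Set where
    var : Fin m → Lin m
    _⊕_ : Lin m → Lin m → Lin m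
    _⊛_ : ℕ → Lin m → Lin m

  ⟦_⟧ : ∀ {m} → Lin m → Vec Carrier m → Carrier
  ⟦ var i ⟧ ρ = Vec.lookup ρ i
  ⟦ l ⊕ r ⟧ ρ = ⟦ l ⟧ ρ + ⟦ r ⟧ ρ
  ⟦ k ⊛ l ⟧ ρ = k · ⟦ l ⟧ ρ

  unit : ∀ {m} → Fin m → Vec ℕ m
  unit zero    = 1 ∷ Vec.replicate _ 0
  unit (suc i) = 0 ∷ unit i

  coeffs : ∀ {m} → Lin m → Vec ℕ m
  coeffs (var i) = unit i
  coeffs (l ⊕ r) = Vec.zipWith ℕ._+_ (coeffs l) (coeffs r)
  coeffs (k ⊛ l) = Vec.map (k ℕ.*_) (coeffs l)

  value : ∀ {m} → Vec ℕ m → Vec Carrier m → Carrier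
  value []       []      = 0#
  value (k ∷ ks) (x ∷ ρ) = k · x + value ks ρ

  value-zero : ∀ {m} (ρ : Vec Carrier m) → value (Vec.replicate m 0) ρ ≈ 0#
  value-zero []      = ≈-refl
  value-zero (x ∷ ρ) = ≈-trans (+-cong (·-zero x) (value-zero ρ)) (+-identityˡ 0#)

  value-unit : ∀ {m} i (ρ : Vec Carrier m) → value (unit i) ρ ≈ Vec.lookup ρ i
  value-unit zero    (x ∷ ρ) = ≈-trans
    (+-cong (≈-trans (·-suc 0 x) (≈-trans (+-congˡ (·-zero x)) (+-identityʳ x))) (value-zero ρ)) (+-identityʳ x)
  value-unit (suc i) (x ∷ ρ) = ≈-trans (+-cong (·-zero x) (value-unit i ρ)) (+-identityˡ _)

  value-+ : ∀ {m} (k l : Vec ℕ m) ρ → value (Vec.zipWith ℕ._+_ k l) ρ ≈ value k ρ + value l ρ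
  value-+ []      []      []      = ≈-sym (+-identityˡ 0#)
  value-+ (k ∷ ks) (l ∷ ls) (x ∷ ρ) =
    ≈-trans (+-cong (·-+ k l x) (value-+ ks ls ρ)) (interchange _ _ _ _)

  value-* : ∀ {m} k (l : Vec ℕ m) ρ → value (Vec.map (k ℕ.*_) l) ρ ≈ k · value l ρ
  value-* k []       []      = ≈-sym (·0 k)
    where
    ·0 : ∀ k → k · 0# ≈ 0#
    ·0 zero    = ·-zero 0#
    ·0 (suc k) = ≈-trans (·-suc k 0#) (≈-trans (+-identityˡ _) (·0 k))
  value-* k (l ∷ ls) (x ∷ ρ) =
    ≈-trans (+-cong (·-* k l x) (value-* k ls ρ)) (≈-sym (·-distrib-+ k _ _))

  value-coeffs : ∀ {m} (l : Lin m) ρ → value (coeffs l) ρ ≈ ⟦ l ⟧ ρ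
  value-coeffs (var i) ρ = value-unit i ρ
  value-coeffs (l ⊕ r) ρ =
    ≈-trans (value-+ (coeffs l) (coeffs r) ρ) (+-cong (value-coeffs l ρ) (value-coeffs r ρ))
  value-coeffs (k ⊛ l) ρ = ≈-trans (value-* k (coeffs l) ρ) (·-congʳ k (value-coeffs l ρ))

  infix 4 _≤ᵛ_

  _≤ᵛ_ : ∀ {m} → Vec ℕ m → Vec ℕ m → Bool
  []       ≤ᵛ []       = true
  (k ∷ ks) ≤ᵛ (l ∷ ls) = (k ℕ.≤ᵇ l) ∧ (ks ≤ᵛ ls)

  NonNegative : ∀ {m} → Vec Carrier m → Set ℓ₂
  NonNegative []      = 0# ≤ 0#
  NonNegative (x ∷ ρ) = 0# ≤ x × NonNegative ρ

  value-mono : ∀ {m} (k l : Vec ℕ m) ρ → NonNegative ρ → IsTrue (k ≤ᵛ l) → value k ρ ≤ value l ρ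
  value-mono []       []       []      _          _  = ≤-refl
  value-mono (k ∷ ks) (l ∷ ls) (x ∷ ρ) (0≤x , 0≤ρ) ok =
    let k≤l , ks≤ls = Equivalence.to T-∧ ok in
    +-mono-≤ (·-monoˡ-≤ 0≤x (ℕₚ.≤ᵇ⇒≤ k l k≤l)) (value-mono ks ls ρ 0≤ρ ks≤ls)

  infix 5 _≼_

  record Inequality (m : ℕ) : Set where
    constructor _≼_
    field lhs rhs : Lin m

  open Inequality

  Holds : ∀ {m} → Vec Carrier m → ℕ × Inequality m → Set ℓ₂
  Holds ρ (_ , l ≼ r) = ⟦ l ⟧ ρ ≤ ⟦ r ⟧ ρ

  -- Coefficients are natural numbers, so hypotheses are never subtracted: their right sides are
  -- added to the left of the goal and their left sides to its right.
  combine : ∀ {m} → (Inequality m → Lin m) → Lin m → List (ℕ × Inequality m) → Lin m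
  combine side l []             = l
  combine side l ((k , i) ∷ is) = k ⊛ side i ⊕ combine side l is

  combine-≤ : ∀ {m} (ρ : Vec Carrier m) {l r} is → All (Holds ρ) is →
              ⟦ combine rhs l is ⟧ ρ ≤ ⟦ combine lhs r is ⟧ ρ → ⟦ l ⟧ ρ ≤ ⟦ r ⟧ ρ
  combine-≤ ρ []             []         h = h
  combine-≤ ρ {l} {r} ((k , i) ∷ is) (h₁ ∷ hs) h = combine-≤ ρ {l} {r} is hs
    (+-cancelʳ-≤ (k · ⟦ lhs i ⟧ ρ) (begin
      ⟦ combine rhs l is ⟧ ρ + k · ⟦ lhs i ⟧ ρ ≤⟨ +-monoʳ-≤ _ (·-monoʳ-≤ k h₁) ⟩
      ⟦ combine rhs l is ⟧ ρ + k · ⟦ rhs i ⟧ ρ ≈⟨ +-comm _ _ ⟩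
      k · ⟦ rhs i ⟧ ρ + ⟦ combine rhs l is ⟧ ρ ≤⟨ h ⟩
      k · ⟦ lhs i ⟧ ρ + ⟦ combine lhs r is ⟧ ρ ≈⟨ +-comm _ _ ⟩
      ⟦ combine lhs r is ⟧ ρ + k · ⟦ lhs i ⟧ ρ ∎))

  -- Farkas: the goal, scaled by suc d, follows from the given multiples of the
  -- hypotheses by comparing coefficients.
  farkas : ∀ {m} (ρ : Vec Carrier m) → NonNegative ρ → (is : List (ℕ × Inequality m)) →
           (d : ℕ) (goal : Inequality m) →
           {IsTrue (coeffs (combine rhs (suc d ⊛ lhs goal) is) ≤ᵛ coeffs (combine lhs (suc d ⊛ rhs goal) is))} →
           All (Holds ρ) is → ⟦ lhs goal ⟧ ρ ≤ ⟦ rhs goal ⟧ ρ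
  farkas ρ 0≤ρ is d goal {ok} hs = ·-cancel-≤ d (combine-≤ ρ {suc d ⊛ lhs goal} {suc d ⊛ rhs goal} is hs (begin
    ⟦ left ⟧ ρ           ≈⟨ value-coeffs left ρ ⟨
    value (coeffs left) ρ  ≤⟨ value-mono (coeffs left) (coeffs right) ρ 0≤ρ ok ⟩
    value (coeffs right) ρ ≈⟨ value-coeffs right ρ ⟩
    ⟦ right ⟧ ρ          ∎))
    where
    left  = combine rhs (suc d ⊛ lhs goal) is
    right = combine lhs (suc d ⊛ rhs goal) is

-- The Taylor polynomial that replaces the exponential function.

module _ where
  open import Data.Nat using (_+_; _*_; _≤_)

  -- 24 y⁴ times the Taylor polynomial of degree 4 of exp at x / y.
  exp₄ : ℕ → ℕ → ℕ
  exp₄ x y = 24 * (y * y * y * y) + 24 * (x * y * y * y)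
    + 12 * (x * x * y * y) + 4 * (x * x * x * y) + x * x * x * x

  -- Brings two ratios to a common denominator without division.
  exp₄-homogeneous : ∀ z x y → (z * z * z * z) * exp₄ x y ≡ exp₄ (z * x) (z * y)
  exp₄-homogeneous = lemma
    where
    lemma : ∀ z x y → (z * z * z * z) * (24 * (y * y * y * y) + 24 * (x * y * y * y)
        + 12 * (x * x * y * y) + 4 * (x * x * x * y) + x * x * x * x) ≡
        24 * (z * y * (z * y) * (z * y) * (z * y)) + 24 * (z * x * (z * y) * (z * y) * (z * y))
        + 12 * (z * x * (z * x) * (z * y) * (z * y)) + 4 * (z * x * (z * x) * (z * x) * (z * y))
        + z * x * (z * x) * (z * x) * (z * x)
    lemma = solve-∀

  exp₄-mono : ∀ {x x′} y → x ≤ x′ → exp₄ x y ≤ exp₄ x′ y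
  exp₄-mono {x} {x′} y h =
    +m (+m (+m (+m (ℕₚ.≤-refl {24 * (y * y * y * y)})
      (24 *m (((h *m′ y) *m′ y) *m′ y)))
      (12 *m ((ℕₚ.*-mono-≤ h h *m′ y) *m′ y)))
      (4 *m (ℕₚ.*-mono-≤ (ℕₚ.*-mono-≤ h h) h *m′ y)))
      (ℕₚ.*-mono-≤ (ℕₚ.*-mono-≤ (ℕₚ.*-mono-≤ h h) h) h)
    where
    +m = ℕₚ.+-mono-≤
    _*m_ : ∀ c {u v} → u ≤ v → c * u ≤ c * v
    c *m p = ℕₚ.*-monoʳ-≤ c p
    _*m′_ : ∀ {u v} → u ≤ v → ∀ c → u * c ≤ v * c
    p *m′ c = ℕₚ.*-monoˡ-≤ c p

  -- (1 - 1/τ) E(u + 1/τ) ≤ E(u) for the Taylor polynomial E, with τ = t + 1 and u = j / τ.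
  exp₄-step : ∀ t j → t * exp₄ (suc j) (suc t) ≤ suc t * exp₄ j (suc t)
  exp₄-step t j = ≡.subst (t * exp₄ (suc j) (suc t) ≤_) (≡.sym (lemma t j)) (ℕₚ.m≤m+n _ _)
    where
    -- The last summand is the slack. It is positive since E(u + h) - E(u) ≤ h E'(u + h) ≤ h E(u +
    -- h): the derivative of E is increasing and at most E. Here all its coefficients are even
    -- natural numbers.
    lemma : ∀ t j → suc t * (24 * (suc t * suc t * suc t * suc t) + 24 * (j * suc t * suc t * suc t)
        + 12 * (j * j * suc t * suc t) + 4 * (j * j * j * suc t) + j * j * j * j)
      ≡ t * (24 * (suc t * suc t * suc t * suc t) + 24 * (suc j * suc t * suc t * suc t)
        + 12 * (suc j * suc j * suc t * suc t) + 4 * (suc j * suc j * suc j * suc t) + suc j * suc j * suc j * suc j)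
      + (24 + 55 * t + 44 * (t * t) + 12 * (t * t * t) + 24 * j + 32 * (j * t) + 12 * (j * t * t)
        + 12 * (j * j) + 6 * (j * j * t) + 4 * (j * j * j) + j * j * j * j)
    lemma = solve-∀

-- Geometric decay of the gap to a target.

module Decay {c ℓ₁ ℓ₂} (ℝ : RealField c ℓ₁ ℓ₂) where
  open RealField ℝ
  open OrderedField ℝ
  open PosetReasoning poset

  module _ (v : ℕ → Carrier) (D : Carrier) (t : ℕ) where

    private
      τ = suc t
      Δ : ℕ → Carrier
      Δ i = D - v i

    -- One greedy step closes a 1/τ fraction of the gap to D.
    Progress : ℕ → Set ℓ₂
    Progress j = ∀ i → i ℕ.< j → D + t · v i ≤ suc t · v (suc i)

    module _ (mono : ∀ i → v i ≤ v (suc i)) where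

      below : ∀ j → v 0 ≤ v j
      below zero    = ≤-refl
      below (suc j) = ≤-trans (below j) (mono j)

      gap-step : ∀ i → D + t · v i ≤ τ · v (suc i) → τ · Δ (suc i) ≤ t · Δ i
      gap-step i h = +-cancelʳ-≤ (τ · v (suc i)) (+-cancelʳ-≤ (t · v i) (begin
        τ · Δ (suc i) + τ · v (suc i) + t · v i   ≈⟨ +-congʳ (·-distrib-+ τ _ _) ⟨
        τ · (Δ (suc i) + v (suc i)) + t · v i     ≈⟨ +-congʳ (·-congʳ τ (x-y+y D _)) ⟩
        τ · D + t · v i                           ≈⟨ +-congʳ (·-suc t D) ⟩
        D + t · D + t · v i                       ≈⟨ +-assoc _ _ _ ⟩
        D + (t · D + t · v i)                     ≈⟨ +-congˡ (+-comm _ _) ⟩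
        D + (t · v i + t · D)                     ≈⟨ +-assoc _ _ _ ⟨
        D + t · v i + t · D                       ≤⟨ +-monoˡ-≤ _ h ⟩
        τ · v (suc i) + t · D                     ≈⟨ +-congˡ (·-congʳ t (x-y+y D (v i))) ⟨
        τ · v (suc i) + t · (Δ i + v i)           ≈⟨ +-congˡ (·-distrib-+ t _ _) ⟩
        τ · v (suc i) + (t · Δ i + t · v i)       ≈⟨ +-assoc _ _ _ ⟨
        τ · v (suc i) + t · Δ i + t · v i         ≈⟨ +-congʳ (+-comm _ _) ⟩
        t · Δ i + τ · v (suc i) + t · v i         ∎))

      -- The product `exp₄ i τ · Δ i` never increases: a step shrinks the gap by the factor `t / τ`,
      -- while `exp₄-step` lets the polynomial grow by at most `τ / t`. Comparing the `τ`-fold sides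
      -- also covers `t = 0`. The hypothesis `v j ≤ D` keeps all gaps up to `j` non-negative, as
      -- enlarging a coefficient requires.
      gap-decay : ∀ j → Progress j → v j ≤ D → exp₄ j τ · Δ j ≤ exp₄ 0 τ · Δ 0
      gap-decay zero    _ _ = ≤-refl
      gap-decay (suc j) h v≤D = ·-cancel-≤ t (begin
        τ · exp₄ (suc j) τ · Δ (suc j)   ≈⟨ ·-comm τ (exp₄ (suc j) τ) _ ⟩
        exp₄ (suc j) τ · τ · Δ (suc j)   ≤⟨ ·-monoʳ-≤ (exp₄ (suc j) τ) (gap-step j (h j ℕₚ.≤-refl)) ⟩
        exp₄ (suc j) τ · t · Δ j         ≈⟨ ·-comm (exp₄ (suc j) τ) t _ ⟩
        t · exp₄ (suc j) τ · Δ j         ≈⟨ ·-* t (exp₄ (suc j) τ) _ ⟨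
        (t ℕ.* exp₄ (suc j) τ) · Δ j     ≤⟨ ·-monoˡ-≤ (≤⇒0≤- v≤D′) (exp₄-step t j) ⟩
        (τ ℕ.* exp₄ j τ) · Δ j           ≈⟨ ·-* τ (exp₄ j τ) _ ⟩
        τ · exp₄ j τ · Δ j               ≤⟨ ·-monoʳ-≤ τ (gap-decay j (λ i i<j → h i (ℕₚ.m<n⇒m<1+n i<j)) v≤D′) ⟩
        τ · exp₄ 0 τ · Δ 0               ∎)
        where
        v≤D′ = ≤-trans (mono j) v≤D

      -- This is `v j ≥ (1 - x) D + x v 0` with `x = exp₄ 0 q / exp₄ N q`, close to exp(-N/q), freed
      -- of subtraction and division. The true ratio `j / τ` is replaced by a lower bound `N / q`,
      -- so that literals can serve as coefficients later. If `v j` has already passed `D`,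
      -- monotonicity alone suffices.
      greedy-decay : ∀ j N q → N ℕ.* τ ℕ.≤ q ℕ.* j → Progress j →
                     exp₄ N q · D + exp₄ 0 q · v 0 ≤ exp₄ 0 q · D + exp₄ N q · v j
      greedy-decay j N q ratio h with total (v j) D
      ... | inj₂ D≤v = begin
        e · D + e₀ · v 0                    ≡⟨ ≡.cong (λ x → x · D + e₀ · v 0) (≡.sym e≡) ⟩
        (e₀ ℕ.+ r) · D + e₀ · v 0           ≈⟨ +-congʳ (·-+ e₀ r D) ⟩
        e₀ · D + r · D + e₀ · v 0           ≈⟨ +-assoc _ _ _ ⟩
        e₀ · D + (r · D + e₀ · v 0)         ≤⟨ +-monoʳ-≤ _ (+-mono-≤ (·-monoʳ-≤ r D≤v) (·-monoʳ-≤ e₀ (below j))) ⟩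
        e₀ · D + (r · v j + e₀ · v j)       ≈⟨ +-congˡ (+-comm _ _) ⟩
        e₀ · D + (e₀ · v j + r · v j)       ≈⟨ +-congˡ (·-+ e₀ r (v j)) ⟨
        e₀ · D + (e₀ ℕ.+ r) · v j           ≡⟨ ≡.cong (λ x → e₀ · D + x · v j) e≡ ⟩
        e₀ · D + e · v j                    ∎
        where
        e = exp₄ N q
        e₀ = exp₄ 0 q
        r = e ℕ.∸ e₀
        e≡ : e₀ ℕ.+ r ≡ e
        e≡ = ℕₚ.m+[n∸m]≡n (exp₄-mono {0} {N} q z≤n)
      ... | inj₁ v≤D = begin
        e · D + e₀ · v 0                         ≈⟨ +-congʳ (·-congʳ e (x-y+y D (v j))) ⟨
        e · (Δ j + v j) + e₀ · v 0               ≈⟨ +-congʳ (·-distrib-+ e _ _) ⟩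
        e · Δ j + e · v j + e₀ · v 0             ≈⟨ +-assoc _ _ _ ⟩
        e · Δ j + (e · v j + e₀ · v 0)           ≤⟨ +-monoˡ-≤ _ scaled ⟩
        e₀ · Δ 0 + (e · v j + e₀ · v 0)          ≈⟨ +-congˡ (+-comm _ _) ⟩
        e₀ · Δ 0 + (e₀ · v 0 + e · v j)          ≈⟨ +-assoc _ _ _ ⟨
        e₀ · Δ 0 + e₀ · v 0 + e · v j            ≈⟨ +-congʳ (·-distrib-+ e₀ _ _) ⟨
        e₀ · (Δ 0 + v 0) + e · v j               ≈⟨ +-congʳ (·-congʳ e₀ (x-y+y D (v 0))) ⟩
        e₀ · D + e · v j                         ∎
        where
        e = exp₄ N q
        e₀ = exp₄ 0 q
        q⁴ = q ℕ.* q ℕ.* q ℕ.* q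
        τ⁴ = τ ℕ.* τ ℕ.* τ ℕ.* τ
        coefficient : τ⁴ ℕ.* e ℕ.≤ q⁴ ℕ.* exp₄ j τ
        coefficient = ≡.subst₂ ℕ._≤_ (≡.sym (exp₄-homogeneous τ N q))
          (≡.trans (≡.cong (exp₄ (q ℕ.* j)) (ℕₚ.*-comm τ q)) (≡.sym (exp₄-homogeneous q j τ)))
          (exp₄-mono (τ ℕ.* q) (ℕₚ.≤-trans (ℕₚ.≤-reflexive (ℕₚ.*-comm τ N)) ratio))
        base : q⁴ ℕ.* exp₄ 0 τ ≡ τ⁴ ℕ.* e₀
        base = ≡.trans (exp₄-homogeneous q 0 τ) (≡.trans
          (≡.cong₂ exp₄ (≡.trans (ℕₚ.*-zeroʳ q) (≡.sym (ℕₚ.*-zeroʳ τ))) (ℕₚ.*-comm q τ))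
          (≡.sym (exp₄-homogeneous τ 0 q)))
        scaled : e · Δ j ≤ e₀ · Δ 0
        scaled = ·-cancel-pos τ⁴ (s≤s z≤n) (begin
          τ⁴ · e · Δ j                ≈⟨ ·-* τ⁴ e _ ⟨
          (τ⁴ ℕ.* e) · Δ j            ≤⟨ ·-monoˡ-≤ (≤⇒0≤- v≤D) coefficient ⟩
          (q⁴ ℕ.* exp₄ j τ) · Δ j     ≈⟨ ·-* q⁴ (exp₄ j τ) _ ⟩
          q⁴ · exp₄ j τ · Δ j         ≤⟨ ·-monoʳ-≤ q⁴ (gap-decay j h v≤D) ⟩
          q⁴ · exp₄ 0 τ · Δ 0         ≈⟨ ·-* q⁴ (exp₄ 0 τ) _ ⟨
          (q⁴ ℕ.* exp₄ 0 τ) · Δ 0     ≡⟨ ≡.cong (_· Δ 0) base ⟩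
          (τ⁴ ℕ.* e₀) · Δ 0           ≈⟨ ·-* τ⁴ e₀ _ ⟩
          τ⁴ · e₀ · Δ 0               ∎)

-- Inserting into finite subsets and counting their elements.

≡ᵇ-refl : ∀ n → (n ≡ᵇ n) ≡ true
≡ᵇ-refl n = Equivalence.to T-≡ (ℕₚ.≡⇒≡ᵇ n n refl)

-- The element is a natural number; inserting one that is not below n has no effect.
insert : ∀ {n} → ℕ → Subset n → Subset n
insert c X = tabulate λ i → (c ≡ᵇ toℕ i) ∨ lookup X i

module _ {n : ℕ} where

  lookup-insert : ∀ c (X : Subset n) x → lookup (insert c X) x ≡ (c ≡ᵇ toℕ x) ∨ lookup X x
  lookup-insert c X x = lookup∘tabulate _ x

  ∈-insertˡ : ∀ x (X : Subset n) → x ∈ insert (toℕ x) X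
  ∈-insertˡ x X = lookup⇒[]= x _ (≡.trans (lookup-insert (toℕ x) X x) (≡.cong (_∨ lookup X x) (≡ᵇ-refl (toℕ x))))

  ⊆-insert : ∀ c (X : Subset n) → X ⊆ insert c X
  ⊆-insert c X {x} x∈X = lookup⇒[]= x _ (≡.trans (lookup-insert c X x)
    (≡.trans (≡.cong ((c ≡ᵇ toℕ x) ∨_) ([]=⇒lookup x∈X)) (∨-true (c ≡ᵇ toℕ x))))
    where
    ∨-true : ∀ b → b ∨ true ≡ true
    ∨-true true  = refl
    ∨-true false = refl

  ∈-insert⁻ : ∀ c (X : Subset n) {x} → x ∈ insert c X → c ≡ toℕ x ⊎ x ∈ X
  ∈-insert⁻ c X {x} x∈ with c ≡ᵇ toℕ x in eq | ≡.trans (≡.sym (lookup-insert c X x)) ([]=⇒lookup x∈)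
  ... | true  | _ = inj₁ (ℕₚ.≡ᵇ⇒≡ c (toℕ x) (Equivalence.from T-≡ eq))
  ... | false | h = inj₂ (lookup⇒[]= x X h)

  insert-mono : ∀ c {X Y : Subset n} → X ⊆ Y → insert c X ⊆ insert c Y
  insert-mono c {X} {Y} X⊆Y {x} x∈ with ∈-insert⁻ c X x∈
  ... | inj₁ refl = ∈-insertˡ x Y
  ... | inj₂ x∈X  = ⊆-insert c Y (X⊆Y x∈X)

  insert-⊆ : ∀ c {X Y : Subset n} → (∀ x → toℕ x ≡ c → x ∈ Y) → X ⊆ Y → insert c X ⊆ Y
  insert-⊆ c {X} c∈Y X⊆Y {x} x∈ with ∈-insert⁻ c X x∈
  ... | inj₁ eq  = c∈Y x (≡.sym eq)
  ... | inj₂ x∈X = X⊆Y x∈X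

∣insert∣≤ : ∀ {n} c (X : Subset n) → ∣ insert c X ∣ ℕ.≤ suc ∣ X ∣
∣insert∣≤ {zero}  c [] = z≤n
∣insert∣≤ {suc n} c (b ∷ X) = helper c b
  where
  unchanged : ∣ tabulate (lookup X) ∣ ℕ.≤ ∣ X ∣
  unchanged = ℕₚ.≤-reflexive (≡.cong ∣_∣ (tabulate∘lookup X))
  helper : ∀ c b → ∣ insert c (b ∷ X) ∣ ℕ.≤ suc ∣ b ∷ X ∣
  helper zero    true  = s≤s (ℕₚ.m≤n⇒m≤1+n unchanged)
  helper zero    false = s≤s unchanged
  helper (suc c) true  = s≤s (∣insert∣≤ c X)
  helper (suc c) false = ∣insert∣≤ c X

∣∪∣≤ : ∀ {n} (p q : Subset n) → ∣ p ∪ q ∣ ℕ.≤ ∣ p ∣ ℕ.+ ∣ q ∣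
∣∪∣≤ []          []          = z≤n
∣∪∣≤ (true ∷ p)  (true ∷ q)  = s≤s (ℕₚ.≤-trans (∣∪∣≤ p q) (ℕₚ.+-monoʳ-≤ ∣ p ∣ (ℕₚ.n≤1+n _)))
∣∪∣≤ (true ∷ p)  (false ∷ q) = s≤s (∣∪∣≤ p q)
∣∪∣≤ (false ∷ p) (true ∷ q)  = ℕₚ.≤-trans (s≤s (∣∪∣≤ p q)) (ℕₚ.≤-reflexive (≡.sym (ℕₚ.+-suc ∣ p ∣ ∣ q ∣)))
∣∪∣≤ (false ∷ p) (false ∷ q) = ∣∪∣≤ p q

∣∩∣+∣─∣ : ∀ {n} (p q : Subset n) → ∣ p ∩ q ∣ ℕ.+ ∣ p ─ q ∣ ≡ ∣ p ∣
∣∩∣+∣─∣ []          []          = refl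
∣∩∣+∣─∣ (true ∷ p)  (true ∷ q)  = ≡.cong suc (∣∩∣+∣─∣ p q)
∣∩∣+∣─∣ (true ∷ p)  (false ∷ q) = ≡.trans (ℕₚ.+-suc _ _) (≡.cong suc (∣∩∣+∣─∣ p q))
∣∩∣+∣─∣ (false ∷ p) (true ∷ q)  = ∣∩∣+∣─∣ p q
∣∩∣+∣─∣ (false ∷ p) (false ∷ q) = ∣∩∣+∣─∣ p q

∈-─ : ∀ {n} (p q : Subset n) {x} → x ∈ p ─ q → x ∈ p × x ∉ q
∈-─ p q {x} x∈ = p─q⊆p p q x∈ , disjoint p q x∈
  where
  disjoint : ∀ {n} (p q : Subset n) {x} → x ∈ p ─ q → x ∉ q
  disjoint (true ∷ p) (true ∷ q) () here
  disjoint (_ ∷ p) (_ ∷ q) (there x∈) (there x∈q) = disjoint p q x∈ x∈q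

∪-lub : ∀ {n} {p q r : Subset n} → p ⊆ r → q ⊆ r → p ∪ q ⊆ r
∪-lub {p = p} {q} p⊆r q⊆r x∈ = [ p⊆r , q⊆r ]′ (x∈p∪q⁻ p q x∈)

∪-monotone : ∀ {n} {p p′ q q′ : Subset n} → p ⊆ p′ → q ⊆ q′ → p ∪ q ⊆ p′ ∪ q′
∪-monotone {p′ = p′} {q′ = q′} p⊆ q⊆ = ∪-lub (p⊆p∪q q′ ∘ p⊆) (q⊆p∪q p′ q′ ∘ q⊆)

-- Monotone submodular functions along greedy sequences.

module Submodular {c ℓ₁ ℓ₂} (ℝ : RealField c ℓ₁ ℓ₂) where
  open RealField ℝ
  open OrderedField ℝ
  open Decay ℝ
  open PosetReasoning poset

  module SetFunction {n : ℕ} (f : Subset n → Carrier)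
    (monotone : ∀ {S T} → S ⊆ T → f S ≤ f T)
    (submodular : ∀ S T → f (S ∪ T) + f (S ∩ T) ≤ f S + f T) where

    -- Monotonicity relaxes the exact union and intersection to inclusions, which spares set
    -- identities in every later use.
    submodular′ : ∀ S T {U I} → U ⊆ S ∪ T → I ⊆ S → I ⊆ T → f U + f I ≤ f S + f T
    submodular′ S T U⊆ I⊆S I⊆T =
      ≤-trans (+-mono-≤ (monotone U⊆) (monotone λ x∈ → x∈p∩q⁺ (I⊆S x∈ , I⊆T x∈))) (submodular S T)

    diminishing : ∀ A {G H} → G ⊆ H → f (H ∪ A) + f G ≤ f (G ∪ A) + f H
    diminishing A {G} {H} G⊆H = submodular′ (G ∪ A) H
      (∪-lub (q⊆p∪q (G ∪ A) H) (p⊆p∪q H ∘ q⊆p∪q G A)) (p⊆p∪q A) G⊆H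

    -- Peeling off one element of `S` at a time, each costs at most `w - f X` by submodularity. The
    -- hypothesis `f X ≤ w` makes this cost non-negative, which pads the count from `∣ S ∣` to `τ`.
    marginal-sum : ∀ τ X S w → ∣ S ∣ ℕ.≤ τ → f X ≤ w → (∀ {x} → x ∈ S → f (insert (toℕ x) X) ≤ w) →
                   f (X ∪ S) + τ · f X ≤ f X + τ · w
    marginal-sum τ X S w ∣S∣≤τ fX≤w best with nonempty? S
    ... | no empty = +-mono-≤ (monotone (∪-lub {q = S} (λ x∈ → x∈) λ x∈ → ⊥-elim (empty (_ , x∈)))) (·-monoʳ-≤ τ fX≤w)
    marginal-sum zero    X S w ∣S∣≤τ fX≤w best | yes (x , x∈S) =
      ⊥-elim (ℕₚ.<⇒≱ (x∈p⇒∣p-x∣<∣p∣ x∈S) (ℕₚ.≤-trans ∣S∣≤τ z≤n))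
    marginal-sum (suc τ) X S w ∣S∣≤τ fX≤w best | yes (x , x∈S) = begin
      f (X ∪ S) + suc τ · f X            ≈⟨ +-congˡ (·-suc τ _) ⟩
      f (X ∪ S) + (f X + τ · f X)        ≈⟨ +-assoc _ _ _ ⟨
      f (X ∪ S) + f X + τ · f X          ≤⟨ +-monoˡ-≤ _ (submodular′ (X ∪ S′) (insert (toℕ x) X) cover (p⊆p∪q S′) (⊆-insert (toℕ x) X)) ⟩
      f (X ∪ S′) + f (insert (toℕ x) X) + τ · f X ≤⟨ +-monoˡ-≤ _ (+-monoʳ-≤ _ (best x∈S)) ⟩
      f (X ∪ S′) + w + τ · f X           ≈⟨ +-assoc _ _ _ ⟩
      f (X ∪ S′) + (w + τ · f X)         ≈⟨ +-congˡ (+-comm _ _) ⟩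
      f (X ∪ S′) + (τ · f X + w)         ≈⟨ +-assoc _ _ _ ⟨
      f (X ∪ S′) + τ · f X + w           ≤⟨ +-monoˡ-≤ w (marginal-sum τ X S′ w size fX≤w (best ∘ p─q⊆p S ⁅ x ⁆)) ⟩
      f X + τ · w + w                    ≈⟨ +-assoc _ _ _ ⟩
      f X + (τ · w + w)                  ≈⟨ +-congˡ (+-comm _ _) ⟩
      f X + (w + τ · w)                  ≈⟨ +-congˡ (·-suc τ w) ⟨
      f X + suc τ · w                    ∎
      where
      S′ = S without x
      size : ∣ S′ ∣ ℕ.≤ τ
      size = ℕₚ.≤-pred (ℕₚ.≤-trans (x∈p⇒∣p-x∣<∣p∣ x∈S) ∣S∣≤τ)
      cover : X ∪ S ⊆ (X ∪ S′) ∪ insert (toℕ x) X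
      cover {y} y∈ with x∈p∪q⁻ X S y∈ | y Fin.≟ x
      ... | inj₁ y∈X | _        = p⊆p∪q _ (p⊆p∪q S′ y∈X)
      ... | inj₂ y∈S | yes refl = q⊆p∪q (X ∪ S′) _ (∈-insertˡ x X)
      ... | inj₂ y∈S | no y≢x   = p⊆p∪q _ (q⊆p∪q X S′ (x∈p∧x≢y⇒x∈p-y y∈S y≢x))

    -- Only the values of the steps matter; the element actually added may lie outside `C`. Hence
    -- one run can be measured against any target inside `C`, even one with more elements than the
    -- run has steps.
    Greedy : (Fin n → Set) → (ℕ → Subset n) → ℕ → Set ℓ₂
    Greedy C Y m = ∀ i → i ℕ.< m → ∀ x → C x → f (insert (toℕ x) (Y i)) ≤ f (Y (suc i))

    Increasing : (ℕ → Subset n) → Set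
    Increasing Y = ∀ i → Y i ⊆ Y (suc i)

    increasing : ∀ {Y} → Increasing Y → ∀ {i j} → i ℕ.≤ j → Y i ⊆ Y j
    increasing inc {i} i≤j = go (ℕₚ.≤⇒≤′ i≤j)
      where
      go : ∀ {j} → i ℕ.≤′ j → _ ⊆ _
      go (ℕ.≤′-reflexive refl) = λ x∈ → x∈
      go (ℕ.≤′-step i≤j) = inc _ ∘ go i≤j

    progress : ∀ {C Y m} → Increasing Y → Greedy C Y m → ∀ t S → (∀ {x} → x ∈ S → C x) → ∣ S ∣ ℕ.≤ suc t →
               ∀ {D} → D ≤ f (Y 0 ∪ S) → Progress (f ∘ Y) D t m
    progress {C} {Y} inc greedy t S S⊆C size {D} D≤ i i<m = +-cancelʳ-≤ (f (Y i)) (begin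
      D + t · f (Y i) + f (Y i)         ≈⟨ +-assoc _ _ _ ⟩
      D + (t · f (Y i) + f (Y i))       ≈⟨ +-congˡ (+-comm _ _) ⟩
      D + (f (Y i) + t · f (Y i))       ≈⟨ +-congˡ (·-suc t _) ⟨
      D + suc t · f (Y i)               ≤⟨ +-monoˡ-≤ _ (≤-trans D≤ (monotone (∪-monotone {q = S} (increasing {Y} inc z≤n) (λ x∈ → x∈)))) ⟩
      f (Y i ∪ S) + suc t · f (Y i)     ≤⟨ marginal-sum (suc t) (Y i) S _ size (monotone (inc i)) (λ {x} x∈ → greedy i i<m x (S⊆C x∈)) ⟩
      f (Y i) + suc t · f (Y (suc i))   ≈⟨ +-comm _ _ ⟩
      suc t · f (Y (suc i)) + f (Y i)   ∎)

    greedy-bound : ∀ {C Y m} → Increasing Y → Greedy C Y m → ∀ {τ} S → (∀ {x} → x ∈ S → C x) → 1 ℕ.≤ τ → ∣ S ∣ ℕ.≤ τ →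
                   ∀ {D} → D ≤ f (Y 0 ∪ S) → ∀ N q → N ℕ.* τ ℕ.≤ q ℕ.* m →
                   exp₄ N q · D + exp₄ 0 q · f (Y 0) ≤ exp₄ 0 q · D + exp₄ N q · f (Y m)
    greedy-bound {C} {Y} {m} inc greedy {suc t} S S⊆C _ size {D} D≤ N q ratio =
      greedy-decay (f ∘ Y) D t (monotone ∘ inc) m N q ratio (progress {C} {Y} {m} inc greedy t S S⊆C size D≤)

-- The approximation factor, for abstract runs of the two players.

module _ where
  open import Data.Nat using (_+_; _*_; _≤_)

  -- The second phase from G_h is long enough relative to its target B ∪ G_{2κ}.
  phase-ratio : ∀ N e r b h κ w m → w + h ≡ κ + κ → m + (h + r * b) ≡ κ → h + h ≤ κ →
    (2 * N + 2 * r * (N + e)) * b + 3 * N * κ ≤ (N + e) * κ →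
    N * (b + w) ≤ (N + e) * m
  phase-ratio N e r b h κ w m w≡ m≡ 2h≤κ H =
    ℕₚ.*-cancelˡ-≤ 2 (ℕₚ.+-cancelʳ-≤ X _ _ (begin
      2 * (N * (b + w)) + X                      ≡⟨ left N e r b h w ⟩
      (2 * N + 2 * r * q) * b + 2 * N * (w + h) + e * (h + h) + 2 * N * h
        ≡⟨ ≡.cong (λ z → (2 * N + 2 * r * q) * b + 2 * N * z + e * (h + h) + 2 * N * h) w≡ ⟩
      (2 * N + 2 * r * q) * b + 2 * N * (κ + κ) + e * (h + h) + 2 * N * h
        ≡⟨ middle ((2 * N + 2 * r * q) * b) N e h κ ⟩
      ((2 * N + 2 * r * q) * b + 3 * N * κ) + (N * κ + e * (h + h)) + 2 * N * h
        -- The ratio of steps to target elements is least for the largest `h`; hypothesis `H` is the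
        -- claim at `h = κ / 2`.
        ≤⟨ ℕₚ.+-monoˡ-≤ (2 * N * h) (ℕₚ.+-mono-≤ H (ℕₚ.+-monoʳ-≤ (N * κ) (ℕₚ.*-monoʳ-≤ e 2h≤κ))) ⟩
      q * κ + (N * κ + e * κ) + 2 * N * h   ≡⟨ ≡.cong (λ z → q * z + (N * z + e * z) + 2 * N * h) m≡ ⟨
      q * K + (N * K + e * K) + 2 * N * h   ≡⟨ right N e r b h m ⟩
      2 * (q * m) + X                               ∎))
    where
    open ℕₚ.≤-Reasoning
    q = N + e
    K = m + (h + r * b)
    X = 2 * N * h + 2 * q * h + 2 * q * (r * b)
    left : ∀ N e r b h w → 2 * (N * (b + w)) + (2 * N * h + 2 * (N + e) * h + 2 * (N + e) * (r * b))
      ≡ (2 * N + 2 * r * (N + e)) * b + 2 * N * (w + h) + e * (h + h) + 2 * N * h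
    left = solve-∀
    middle : ∀ z N e h κ → z + 2 * N * (κ + κ) + e * (h + h) + 2 * N * h
      ≡ (z + 3 * N * κ) + (N * κ + e * (h + h)) + 2 * N * h
    middle = solve-∀
    right : ∀ N e r b h m → (N + e) * (m + (h + r * b)) + (N * (m + (h + r * b)) + e * (m + (h + r * b))) + 2 * N * h
      ≡ 2 * ((N + e) * m) + (2 * N * h + 2 * (N + e) * h + 2 * (N + e) * (r * b))
    right = solve-∀

module Analysis {c ℓ₁ ℓ₂} (ℝ : RealField c ℓ₁ ℓ₂) where
  open RealField ℝ
  open OrderedField ℝ
  open Submodular ℝ
  open PosetReasoning poset

  module _ {n : ℕ} (f : Subset n → Carrier) (nonNeg : ∀ S → 0# ≤ f S)
    (monotone : ∀ {S T} → S ⊆ T → f S ≤ f T)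
    (submodular : ∀ S T → f (S ∪ T) + f (S ∩ T) ≤ f S + f T) where
    open SetFunction f monotone submodular

    greedy-514 : ∀ {C Y τ} → Increasing Y → Greedy C Y τ → ∀ S → (∀ {x} → x ∈ S → C x) → 1 ℕ.≤ τ → ∣ S ∣ ℕ.≤ τ →
                 ∀ {O V} → O ⊆ Y 0 ∪ S → f (Y τ) ≤ V → 514 · f O ≤ 1000 · V
    greedy-514 {C} {Y} {τ} inc greedy S S⊆C 1≤τ size {O} {V} O⊆ Y≤V =
      farkas (f O ∷ f (Y 0 ∪ S) ∷ f (Y 0) ∷ f (Y τ) ∷ V ∷ [])
        (nonNeg _ , nonNeg _ , nonNeg _ , nonNeg _ , ≤-trans (nonNeg _) Y≤V , ≤-refl)
        ( (1230 , var o ≼ var d) ∷ (30 , 65 ⊛ var d ⊕ 24 ⊛ var y₀ ≼ 24 ⊛ var d ⊕ 65 ⊛ var y) ∷ (1950 , var y ≼ var v) ∷ [])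
        1 (514 ⊛ var o ≼ 1000 ⊛ var v)
        (monotone O⊆ ∷ greedy-bound {C} {Y} {τ} inc greedy {τ} S S⊆C 1≤τ size ≤-refl 1 1 ℕₚ.≤-refl ∷ Y≤V ∷ [])
      where
      o d y₀ y v : Fin 5
      o = # 0
      d = # 1
      y₀ = # 2
      y = # 3
      v = # 4

    module _ (κ : ℕ) (m : ℕ → ℕ) (G : ℕ → Subset n) (G-suc : ∀ j → G (suc j) ≡ insert (m j) (G j))
      (VA VB : Subset n) (G-greedy : Greedy (_∈ VA) G (κ ℕ.+ κ))
      (Y : ℕ → ℕ → Subset n) (Y-zero : ∀ s → Y s 0 ≡ G s) (Y-increasing : ∀ s → Increasing (Y s))
      (Y-greedy : ∀ s j → Greedy (λ x → x ∈ VB ⊎ x ∈ G (κ ℕ.+ κ)) (Y s) j)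
      (V : Carrier) (V-best : ∀ s → s ℕ.≤ κ → f (Y s (κ ∸ s)) ≤ V)
      (O : Subset n) (O⊆ : O ⊆ VA ∪ VB) (∣O∣≤κ : ∣ O ∣ ℕ.≤ κ) where

      private
        A = O ∩ VA
        B = O ─ VA
        a = ∣ A ∣
        b = κ ∸ a

        F : ℕ → Carrier
        F = f ∘ G

        α : ℕ → Carrier
        α j = f (G j ∪ A) - F j

      a+∣B∣≤κ : a ℕ.+ ∣ B ∣ ℕ.≤ κ
      a+∣B∣≤κ = ℕₚ.≤-trans (ℕₚ.≤-reflexive (∣∩∣+∣─∣ O VA)) ∣O∣≤κ

      a≤κ : a ℕ.≤ κ
      a≤κ = ℕₚ.m+n≤o⇒m≤o a a+∣B∣≤κ

      ∣B∣≤b : ∣ B ∣ ℕ.≤ b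
      ∣B∣≤b = ℕₚ.m+n≤o⇒m≤o∸n ∣ B ∣ (ℕₚ.≤-trans (ℕₚ.≤-reflexive (ℕₚ.+-comm ∣ B ∣ a)) a+∣B∣≤κ)

      b+a≡κ : b ℕ.+ a ≡ κ
      b+a≡κ = ℕₚ.m∸n+n≡m a≤κ

      B⊆VB : B ⊆ VB
      B⊆VB x∈B with ∈-─ O VA x∈B
      ... | x∈O , x∉VA = [ ⊥-elim ∘ x∉VA , (λ x∈VB → x∈VB) ]′ (x∈p∪q⁻ VA VB (O⊆ x∈O))

      O⊆A∪B : O ⊆ A ∪ B
      O⊆A∪B {x} x∈O with x ∈? VA
      ... | yes x∈VA = p⊆p∪q B (x∈p∩q⁺ (x∈O , x∈VA))
      ... | no  x∉VA = q⊆p∪q A B (x∈p∧x∉q⇒x∈p─q x∈O x∉VA)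

      G-increasing : Increasing G
      G-increasing j rewrite G-suc j = ⊆-insert (m j) (G j)

      F-mono : ∀ {i j} → i ℕ.≤ j → F i ≤ F j
      F-mono i≤j = monotone (increasing {G} G-increasing i≤j)

      0≤α : ∀ j → 0# ≤ α j
      0≤α j = ≤⇒0≤- (monotone (p⊆p∪q A))

      α-antitone : ∀ {i j} → i ℕ.≤ j → α j ≤ α i
      α-antitone {i} {j} i≤j = +-cancelʳ-≤ (F j + F i) (begin
        α j + (F j + F i)           ≈⟨ +-assoc _ _ _ ⟨
        α j + F j + F i             ≈⟨ +-congʳ (x-y+y _ _) ⟩
        f (G j ∪ A) + F i           ≤⟨ diminishing A (increasing {G} G-increasing i≤j) ⟩
        f (G i ∪ A) + F j           ≈⟨ +-congʳ (x-y+y _ _) ⟨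
        α i + F i + F j             ≈⟨ +-assoc _ _ _ ⟩
        α i + (F i + F j)           ≈⟨ +-congˡ (+-comm _ _) ⟩
        α i + (F j + F i)           ∎)

      α-step : ∀ j → j ℕ.< κ ℕ.+ κ → α j + a · F j ≤ a · F (suc j)
      α-step j j< = +-cancelʳ-≤ (F j) (begin
        α j + a · F j + F j         ≈⟨ +-assoc _ _ _ ⟩
        α j + (a · F j + F j)       ≈⟨ +-congˡ (+-comm _ _) ⟩
        α j + (F j + a · F j)       ≈⟨ +-assoc _ _ _ ⟨
        α j + F j + a · F j         ≈⟨ +-congʳ (x-y+y _ _) ⟩
        f (G j ∪ A) + a · F j       ≤⟨ marginal-sum a (G j) A _ ℕₚ.≤-refl (F-mono (ℕₚ.n≤1+n j))
                                        (λ {x} x∈A → G-greedy j j< x (p∩q⊆q O VA x∈A)) ⟩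
        F j + a · F (suc j)         ≈⟨ +-comm _ _ ⟩
        a · F (suc j) + F j         ∎)

      slope : ∀ d p → d ℕ.+ p ℕ.≤ κ ℕ.+ κ → d · α (d ℕ.+ p) + a · F p ≤ a · F (d ℕ.+ p)
      slope zero    p _ = ≤-reflexive (≈-trans (+-congʳ (·-zero _)) (+-identityˡ _))
      slope (suc d) p h = begin
        suc d · α (suc j) + a · F p          ≈⟨ +-congʳ (·-suc d _) ⟩
        α (suc j) + d · α (suc j) + a · F p  ≤⟨ +-monoˡ-≤ _ (+-mono-≤ anti (·-monoʳ-≤ d anti)) ⟩
        α j + d · α j + a · F p              ≈⟨ +-assoc _ _ _ ⟩
        α j + (d · α j + a · F p)            ≤⟨ +-monoʳ-≤ _ (slope d p (ℕₚ.<⇒≤ h)) ⟩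
        α j + a · F j                        ≤⟨ α-step j h ⟩
        a · F (suc j)                        ∎
        where
        j = d ℕ.+ p
        anti = α-antitone (ℕₚ.n≤1+n j)

      -- The certificates have literal coefficients, so the ratio `a / d` may enter them only
      -- through a rational bound `M / L`.
      slope-ratio : ∀ d p L M → d ℕ.+ p ℕ.≤ κ ℕ.+ κ → 1 ℕ.≤ d → L ℕ.* a ℕ.≤ M ℕ.* d →
                    L · α (d ℕ.+ p) + M · F p ≤ M · F (d ℕ.+ p)
      slope-ratio d p L M d+p≤ 1≤d La≤Md = begin
        L · α j + M · F p          ≤⟨ +-monoˡ-≤ _ scaled ⟩
        M · δ + M · F p            ≈⟨ ·-distrib-+ M _ _ ⟨
        M · (δ + F p)              ≈⟨ ·-congʳ M (x-y+y _ _) ⟩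
        M · F j                    ∎
        where
        j = d ℕ.+ p
        δ = F j - F p
        unscaled : d · α j ≤ a · δ
        unscaled = +-cancelʳ-≤ (a · F p) (begin
          d · α j + a · F p        ≤⟨ slope d p d+p≤ ⟩
          a · F j                  ≈⟨ ·-congʳ a (x-y+y _ _) ⟨
          a · (δ + F p)            ≈⟨ ·-distrib-+ a _ _ ⟩
          a · δ + a · F p          ∎)
        scaled : L · α j ≤ M · δ
        scaled = ·-cancel-pos d 1≤d (begin
          d · L · α j              ≈⟨ ·-comm d L _ ⟩
          L · d · α j              ≤⟨ ·-monoʳ-≤ L unscaled ⟩
          L · a · δ                ≈⟨ ·-* L a δ ⟨
          (L ℕ.* a) · δ            ≤⟨ ·-monoˡ-≤ (≤⇒0≤- (F-mono (ℕₚ.m≤n+m p d))) La≤Md ⟩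
          (M ℕ.* d) · δ            ≈⟨ ·-* M d δ ⟩
          M · d · δ                ≈⟨ ·-comm M d δ ⟩
          d · M · δ                ∎)

      cover : ∀ j → f O ≤ f (G j ∪ B) + α j
      cover j = +-cancelʳ-≤ (F j) (begin
        f O + F j                      ≤⟨ submodular′ (G j ∪ B) (G j ∪ A) O⊆′ (p⊆p∪q B) (p⊆p∪q A) ⟩
        f (G j ∪ B) + f (G j ∪ A)      ≈⟨ +-congˡ (x-y+y _ _) ⟨
        f (G j ∪ B) + (α j + F j)      ≈⟨ +-assoc _ _ _ ⟨
        f (G j ∪ B) + α j + F j        ∎)
        where
        O⊆′ : O ⊆ (G j ∪ B) ∪ (G j ∪ A)
        O⊆′ = ∪-lub (q⊆p∪q (G j ∪ B) _ ∘ q⊆p∪q (G j) A) (p⊆p∪q _ ∘ q⊆p∪q (G j) B) ∘ O⊆A∪B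

      -- The elements sent from position `p` on. A run that already contains `G p` needs only these
      -- `d` elements to reach `G (d + p)`, so they, together with `B`, are what is counted as its
      -- target.
      segment : ℕ → ℕ → Subset n
      segment p zero    = ∅
      segment p (suc d) = insert (m (d ℕ.+ p)) (segment p d)

      ∣segment∣≤ : ∀ p d → ∣ segment p d ∣ ℕ.≤ d
      ∣segment∣≤ p zero    = ℕₚ.≤-reflexive (∣⊥∣≡0 n)
      ∣segment∣≤ p (suc d) = ℕₚ.≤-trans (∣insert∣≤ (m (d ℕ.+ p)) (segment p d)) (s≤s (∣segment∣≤ p d))

      segment⊆G : ∀ p d → segment p d ⊆ G (d ℕ.+ p)
      segment⊆G p zero    = ⊥⊆
      segment⊆G p (suc d) rewrite G-suc (d ℕ.+ p) = insert-mono (m (d ℕ.+ p)) (segment⊆G p d)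

      G⊆segment : ∀ p d → G (d ℕ.+ p) ⊆ G p ∪ segment p d
      G⊆segment p zero    = p⊆p∪q _
      G⊆segment p (suc d) rewrite G-suc (d ℕ.+ p) = insert-⊆ (m (d ℕ.+ p))
        (λ x eq → q⊆p∪q (G p) _ (≡.subst (λ e → x ∈ insert e (segment p d)) eq (∈-insertˡ x (segment p d))))
        (∪-monotone {p = G p} (λ x∈ → x∈) (⊆-insert (m (d ℕ.+ p)) (segment p d)) ∘ G⊆segment p d)

      -- j greedy steps of Bob from his i-th set, measured against G_{d+s} ∪ B.
      bob-bound : ∀ s i j d τ N q → d ℕ.+ s ℕ.≤ κ ℕ.+ κ → 1 ℕ.≤ τ → b ℕ.+ d ℕ.≤ τ → N ℕ.* τ ℕ.≤ q ℕ.* j →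
                  exp₄ N q · f (G (d ℕ.+ s) ∪ B) + exp₄ 0 q · f (Y s i) ≤
                  exp₄ 0 q · f (G (d ℕ.+ s) ∪ B) + exp₄ N q · f (Y s (j ℕ.+ i))
      bob-bound s i j d τ N q d+s≤ 1≤τ b+d≤τ ratio =
        greedy-bound {C} {λ j → Y s (j ℕ.+ i)} {j} (λ j → Y-increasing s (j ℕ.+ i))
          (λ j′ j′< x → Y-greedy s (j ℕ.+ i) (j′ ℕ.+ i) (ℕₚ.+-monoˡ-< i j′<) x) {τ} S S⊆C 1≤τ ∣S∣≤τ
          (monotone (∪-lub (∪-monotone {q = segment s d} G⊆Y (q⊆p∪q B _) ∘ G⊆segment s d) (q⊆p∪q _ S ∘ p⊆p∪q _)))
          N q ratio
        where
        C : Fin n → Set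
        C x = x ∈ VB ⊎ x ∈ G (κ ℕ.+ κ)
        S = B ∪ segment s d
        S⊆C : ∀ {x} → x ∈ S → C x
        S⊆C x∈ = [ (λ x∈B → inj₁ (B⊆VB x∈B)) , (λ x∈S → inj₂ (increasing {G} G-increasing d+s≤ (segment⊆G s d x∈S))) ]′ (x∈p∪q⁻ B _ x∈)
        ∣S∣≤τ : ∣ S ∣ ℕ.≤ τ
        ∣S∣≤τ = ℕₚ.≤-trans (∣∪∣≤ B _) (ℕₚ.≤-trans (ℕₚ.+-mono-≤ ∣B∣≤b (∣segment∣≤ s d)) b+d≤τ)
        G⊆Y : G s ⊆ Y s i
        G⊆Y = increasing {Y s} (Y-increasing s) {0} {i} z≤n ∘ ≡.subst (G s ⊆_) (≡.sym (Y-zero s)) (λ x∈ → x∈)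

      bob-final : ∀ s i j d τ N q → s ℕ.≤ κ → j ℕ.+ i ≡ κ ∸ s → d ℕ.+ s ℕ.≤ κ ℕ.+ κ → 1 ℕ.≤ τ → b ℕ.+ d ℕ.≤ τ →
                  N ℕ.* τ ℕ.≤ q ℕ.* j →
                  exp₄ N q · f (G (d ℕ.+ s) ∪ B) + exp₄ 0 q · f (Y s i) ≤ exp₄ 0 q · f (G (d ℕ.+ s) ∪ B) + exp₄ N q · V
      bob-final s i j d τ N q s≤κ j+i d+s≤ 1≤τ b+d≤τ ratio = ≤-trans (bob-bound s i j d τ N q d+s≤ 1≤τ b+d≤τ ratio)
        (+-monoʳ-≤ _ (·-monoʳ-≤ (exp₄ N q) (≡.subst (λ z → f (Y s z) ≤ V) (≡.sym j+i) (V-best s s≤κ))))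

      private
        κ≤2κ : κ ℕ.≤ κ ℕ.+ κ
        κ≤2κ = ℕₚ.m≤m+n κ κ

        0≤V : 0# ≤ V
        0≤V = ≤-trans (nonNeg _) (V-best κ ℕₚ.≤-refl)

      Fκ≤V : F κ ≤ V
      Fκ≤V = ≡.subst (λ S → f S ≤ V) (≡.trans (≡.cong (Y κ) (ℕₚ.n∸n≡0 κ)) (Y-zero κ)) (V-best κ ℕₚ.≤-refl)

      module _ (1≤κ : 1 ℕ.≤ κ) (1≤a : 1 ℕ.≤ a) (1≤b : 1 ℕ.≤ b) where

        -- `65 / 24` is the Taylor polynomial at 1: `b` steps for the at most `b` elements of `B`.
        bound-a : 65 · f (G a ∪ B) + 24 · F a ≤ 24 · f (G a ∪ B) + 65 · V
        bound-a = ≡.subst (λ S → 65 · f (G a ∪ B) + 24 · f S ≤ 24 · f (G a ∪ B) + 65 · V) (Y-zero a)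
          (bob-final a 0 b 0 b 1 1 a≤κ (ℕₚ.+-identityʳ b) (ℕₚ.≤-trans a≤κ κ≤2κ) 1≤b (ℕₚ.≤-reflexive (ℕₚ.+-identityʳ b)) ℕₚ.≤-refl)

        -- From `G a` the target `G κ ∪ B` requires `κ - a = b` elements besides those of `B`, so
        -- `b` steps face at most `2b` elements; `633 / 384` is the Taylor polynomial at 1/2.
        bound-κ : 633 · f (G κ ∪ B) + 384 · F a ≤ 384 · f (G κ ∪ B) + 633 · V
        bound-κ = ≡.subst₂ (λ z S → 633 · f (G z ∪ B) + 384 · f S ≤ 384 · f (G z ∪ B) + 633 · V) b+a≡κ (Y-zero a)
          (bob-final a 0 b b (2 ℕ.* b) 1 2 a≤κ (ℕₚ.+-identityʳ b) (ℕₚ.≤-trans (ℕₚ.≤-reflexive b+a≡κ) κ≤2κ)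
            (ℕₚ.≤-trans 1≤b (ℕₚ.m≤m+n b _)) (ℕₚ.≤-reflexive (≡.cong (b ℕ.+_) (≡.sym (ℕₚ.+-identityʳ b)))) (ℕₚ.≤-reflexive (ℕₚ.*-identityˡ (2 ℕ.* b))))

        ακ-bound : ∀ L M → L ℕ.* a ℕ.≤ M ℕ.* b → L · α κ + M · F a ≤ M · F κ
        ακ-bound L M La≤Mb = ≡.subst (λ z → L · α z + M · F a ≤ M · F z) b+a≡κ
          (slope-ratio b a L M (ℕₚ.≤-trans (ℕₚ.≤-reflexive b+a≡κ) κ≤2κ) 1≤b La≤Mb)

        α2κ-bound : 1 · α (κ ℕ.+ κ) + 1 · F κ ≤ 1 · F (κ ℕ.+ κ)
        α2κ-bound = slope-ratio κ κ 1 1 ℕₚ.≤-refl 1≤κ (ℕₚ.*-monoʳ-≤ 1 a≤κ)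

        αa-bound : 1 · α a + 1 · F 0 ≤ 1 · F a
        αa-bound = ≡.subst (λ z → 1 · α z + 1 · F 0 ≤ 1 · F z) (ℕₚ.+-identityʳ a)
          (slope-ratio a 0 1 1 (ℕₚ.≤-trans (ℕₚ.≤-reflexive (ℕₚ.+-identityʳ a)) (ℕₚ.≤-trans a≤κ κ≤2κ)) 1≤a ℕₚ.≤-refl)

        private
          h = ⌈ a /2⌉
          l = ⌊ a /2⌋

          h+l≡a : h ℕ.+ l ≡ a
          h+l≡a = ≡.trans (ℕₚ.+-comm h l) (ℕₚ.⌊n/2⌋+⌈n/2⌉≡n a)

          l≤h : l ℕ.≤ h
          l≤h = ℕₚ.⌊n/2⌋≤⌈n/2⌉ a

          h≤a : h ℕ.≤ a
          h≤a = ℕₚ.⌈n/2⌉≤n a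

          h≤κ : h ℕ.≤ κ
          h≤κ = ℕₚ.≤-trans h≤a a≤κ

          -- Rounding `a / 2` up costs at most one element, and `1 ≤ b` pays for it:
          -- `2h ≤ a + 1 ≤ a + b`.
          2h≤κ : h ℕ.+ h ℕ.≤ κ
          2h≤κ = ℕₚ.≤-trans (ℕₚ.+-monoʳ-≤ h (ℕₚ.⌊n/2⌋≤⌈n/2⌉ (suc a)))
            (ℕₚ.≤-trans (ℕₚ.≤-reflexive (ℕₚ.⌊n/2⌋+⌈n/2⌉≡n (suc a)))
              (ℕₚ.≤-trans (ℕₚ.+-monoˡ-≤ a 1≤b) (ℕₚ.≤-reflexive b+a≡κ)))

          weigh : ∀ x → h · x + l · x ≈ a · x
          weigh x = ≡.subst (λ z → h · x + l · x ≈ z · x) h+l≡a (≈-sym (·-+ h l x))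

        -- `F h + F l` plays the role of twice `F` at `a / 2`. Averaging the slope bounds of `h` and
        -- `l` with these weights, whose sum is `a`, makes the parity of `a` harmless without any
        -- rounding loss.
        αh-half : α h ≤ F h + F l
        αh-half = ·-cancel-pos a 1≤a (begin
          a · α h                     ≈⟨ weigh (α h) ⟨
          h · α h + l · α h           ≤⟨ +-monoʳ-≤ _ (·-monoʳ-≤ l (α-antitone l≤h)) ⟩
          h · α h + l · α l           ≤⟨ +-mono-≤ (from-0 h h≤a) (from-0 l (ℕₚ.≤-trans l≤h h≤a)) ⟩
          a · F h + a · F l           ≈⟨ ·-distrib-+ a _ _ ⟨
          a · (F h + F l)             ∎)
          where
          from-0 : ∀ d → d ℕ.≤ a → d · α d ≤ a · F d
          from-0 d d≤a = ≤-trans (x≤x+y (·-nonNeg a (nonNeg _)))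
            (≡.subst (λ z → d · α z + a · F 0 ≤ a · F z) (ℕₚ.+-identityʳ d)
              (slope d 0 (ℕₚ.≤-trans (ℕₚ.≤-reflexive (ℕₚ.+-identityʳ d)) (ℕₚ.≤-trans d≤a (ℕₚ.≤-trans a≤κ κ≤2κ)))))

        -- The slope bounds on the segments from `l` to `a` and from `h` to `a`, of lengths `h` and
        -- `l`, are added.
        αa-half : α a + (F h + F l) ≤ 2 · F a
        αa-half = ·-cancel-pos a 1≤a (begin
          a · (α a + (F h + F l))                         ≈⟨ ·-distrib-+ a _ _ ⟩
          a · α a + a · (F h + F l)                       ≈⟨ +-cong (≈-sym (weigh (α a))) (·-distrib-+ a _ _) ⟩
          h · α a + l · α a + (a · F h + a · F l)         ≈⟨ +-congˡ (+-comm _ _) ⟩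
          h · α a + l · α a + (a · F l + a · F h)         ≈⟨ interchange _ _ _ _ ⟩
          (h · α a + a · F l) + (l · α a + a · F h)       ≤⟨ +-mono-≤ (to-a h l h+l≡a) (to-a l h (ℕₚ.⌊n/2⌋+⌈n/2⌉≡n a)) ⟩
          a · F a + a · F a                               ≈⟨ ·-distrib-+ a _ _ ⟨
          a · (F a + F a)                                 ≈⟨ ·-congʳ a (+-congˡ (+-identityʳ _)) ⟨
          a · (F a + (F a + 0#))                          ≈⟨ ·-congʳ a (≈-trans (·-suc 1 _) (+-congˡ (≈-trans (·-suc 0 _) (+-congˡ (·-zero _))))) ⟨
          a · 2 · F a                                     ∎)
          where
          to-a : ∀ d p → d ℕ.+ p ≡ a → d · α a + a · F p ≤ a · F a
          to-a d p eq = ≡.subst (λ z → d · α z + a · F p ≤ a · F z) eq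
            (slope d p (ℕₚ.≤-trans (ℕₚ.≤-reflexive eq) (ℕₚ.≤-trans a≤κ κ≤2κ)))

        -- With `a / b ≤ 5` the bound `α κ ≤ 5 (F κ - F a)` is strong enough: the starts `κ` and `a`
        -- suffice, and no element beyond `G κ` is needed.
        many-B : a ℕ.≤ 5 ℕ.* b → 514 · f O ≤ 1000 · V
        many-B a≤5b =
          farkas (f O ∷ F 0 ∷ F a ∷ F κ ∷ V ∷ f (G a ∪ B) ∷ f (G κ ∪ B) ∷ α a ∷ α κ ∷ [])
            (nonNeg _ , nonNeg _ , nonNeg _ , nonNeg _ , 0≤V , nonNeg _ , nonNeg _ , 0≤α a , 0≤α κ , ≤-refl)
            ( (21165 , var y ≼ var v)
            ∷ (66789 , var o ≼ var dₐ ⊕ var αₐ)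
            ∷ (66789 , 1 ⊛ var αₐ ⊕ 1 ⊛ var x₀ ≼ 1 ⊛ var x)
            ∷ (1629 , 65 ⊛ var dₐ ⊕ 24 ⊛ var x ≼ 24 ⊛ var dₐ ⊕ 65 ⊛ var v)
            ∷ (4233 , var o ≼ var d ⊕ var α′)
            ∷ (4233 , 1 ⊛ var α′ ⊕ 5 ⊛ var x ≼ 5 ⊛ var y)
            ∷ (17 , 633 ⊛ var d ⊕ 384 ⊛ var x ≼ 384 ⊛ var d ⊕ 633 ⊛ var v)
            ∷ []) 137 (514 ⊛ var o ≼ 1000 ⊛ var v)
            (Fκ≤V ∷ cover a ∷ αa-bound ∷ bound-a ∷ cover κ
             ∷ ακ-bound 1 5 (ℕₚ.≤-trans (ℕₚ.≤-reflexive (ℕₚ.*-identityˡ a)) a≤5b) ∷ bound-κ ∷ [])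
          where
          o x₀ x y v dₐ d αₐ α′ : Fin 9
          o = # 0
          x₀ = # 1
          x = # 2
          y = # 3
          v = # 4
          dₐ = # 5
          d = # 6
          αₐ = # 7
          α′ = # 8

        private
          -- A shared multiplier marks a chain that eliminates unknowns: `αₐ` for `μ₁`, `αₕ` for
          -- `μ₆`, and `α″` and `z` for `μ₉`, which leaves `o + y ≤ 2w`. The multipliers supplied
          -- below satisfy `μ₃ = L μ₄`, which removes `α′`, and `μ₁ = 41 μ₂` and `μ₃ = 249 μ₅`,
          -- which remove `dₐ` and `d`.
          inequalities : (r N q L M : ℕ) → Vec ℕ 12 → List (ℕ × Inequality 16)
          inequalities r N q L M (μ₀ ∷ μ₁ ∷ μ₂ ∷ μ₃ ∷ μ₄ ∷ μ₅ ∷ μ₆ ∷ μ₇ ∷ μ₈ ∷ μ₉ ∷ μ₁₀ ∷ μ₁₁ ∷ []) =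
              (μ₀ , var y ≼ var v)
            ∷ (μ₁ , var o ≼ var dₐ ⊕ var αₐ)
            ∷ (μ₁ , var αₐ ⊕ (var p ⊕ var p′) ≼ 2 ⊛ var x)
            ∷ (μ₂ , 65 ⊛ var dₐ ⊕ 24 ⊛ var x ≼ 24 ⊛ var dₐ ⊕ 65 ⊛ var v)
            ∷ (μ₃ , var o ≼ var d ⊕ var α′)
            ∷ (μ₄ , L ⊛ var α′ ⊕ M ⊛ var x ≼ M ⊛ var y)
            ∷ (μ₅ , 633 ⊛ var d ⊕ 384 ⊛ var x ≼ 384 ⊛ var d ⊕ 633 ⊛ var v)
            ∷ (μ₆ , var o ≼ var dₕ ⊕ var αₕ)
            ∷ (μ₆ , var αₕ ≼ var p ⊕ var p′)
            ∷ (μ₇ , exp₄ r 1 ⊛ var dₕ ⊕ 24 ⊛ var p ≼ 24 ⊛ var dₕ ⊕ exp₄ r 1 ⊛ var u)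
            ∷ (μ₈ , exp₄ N q ⊛ var w ⊕ exp₄ 0 q ⊛ var u ≼ exp₄ 0 q ⊛ var w ⊕ exp₄ N q ⊛ var v)
            ∷ (μ₉ , var o ≼ var w ⊕ var α″)
            ∷ (μ₉ , 1 ⊛ var α″ ⊕ 1 ⊛ var y ≼ 1 ⊛ var z)
            ∷ (μ₉ , var z ≼ var w)
            -- The surplus `μ₆ - μ₁` leaves copies of `F l`; they are traded for `F h`, the value
            -- from which the first phase starts.
            ∷ (μ₁₀ , var p′ ≼ var p)
            ∷ (μ₁₁ , var x ≼ var y)
            ∷ []
            where
            o p p′ x y z v dₐ d dₕ u w αₐ α′ αₕ α″ : Fin 16
            o = # 0
            p = # 1
            p′ = # 2
            x = # 3
            y = # 4
            z = # 5
            v = # 6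
            dₐ = # 7
            d = # 8
            dₕ = # 9
            u = # 10
            w = # 11
            αₐ = # 12
            α′ = # 13
            αₕ = # 14
            α″ = # 15

          goal : Inequality 16
          goal = 514 ⊛ var (# 0) ≼ 1000 ⊛ var (# 6)

        -- Bob spends r · b steps from G_h on B alone; L and M bound a / b by M / L, and N / (N + e)
        -- bounds the length of the remaining run relative to its target from below.
        few-B : ∀ r N e L M → 1 ℕ.≤ N ℕ.+ e → L ℕ.* a ℕ.≤ M ℕ.* b →
                (2 ℕ.* N ℕ.+ 2 ℕ.* r ℕ.* (N ℕ.+ e)) ℕ.* b ℕ.+ 3 ℕ.* N ℕ.* κ ℕ.≤ (N ℕ.+ e) ℕ.* κ →
                (μ : Vec ℕ 12) (d : ℕ) →
                {IsTrue (coeffs (combine Inequality.rhs (suc d ⊛ Inequality.lhs goal) (inequalities r N (N ℕ.+ e) L M μ)) ≤ᵛ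
                    coeffs (combine Inequality.lhs (suc d ⊛ Inequality.rhs goal) (inequalities r N (N ℕ.+ e) L M μ)))} →
                514 · f O ≤ 1000 · V
        few-B r N e L M 1≤q La≤Mb H μ@(_ ∷ _ ∷ _ ∷ _ ∷ _ ∷ _ ∷ _ ∷ _ ∷ _ ∷ _ ∷ _ ∷ _ ∷ []) d {ok} =
          farkas (f O ∷ F h ∷ F l ∷ F a ∷ F κ ∷ F (κ ℕ.+ κ) ∷ V ∷ f (G a ∪ B) ∷ f (G κ ∪ B) ∷ f (G h ∪ B)
              ∷ f (Y h i) ∷ f (G (κ ℕ.+ κ) ∪ B) ∷ α a ∷ α κ ∷ α h ∷ α (κ ℕ.+ κ) ∷ [])
            (nonNeg _ , nonNeg _ , nonNeg _ , nonNeg _ , nonNeg _ , nonNeg _ , 0≤V , nonNeg _ , nonNeg _ , nonNeg _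
              , nonNeg _ , nonNeg _ , 0≤α _ , 0≤α _ , 0≤α _ , 0≤α _ , ≤-refl)
            (inequalities r N q L M μ) d goal {ok}
            (Fκ≤V ∷ cover a ∷ αa-half ∷ bound-a ∷ cover κ ∷ ακ-bound L M La≤Mb ∷ bound-κ ∷ cover h ∷ αh-half
             ∷ phase₁ ∷ phase₂ ∷ cover (κ ℕ.+ κ) ∷ α2κ-bound ∷ monotone (p⊆p∪q B) ∷ F-mono l≤h ∷ F-mono a≤κ ∷ [])
          where
          q = N ℕ.+ e
          i = r ℕ.* b ℕ.+ 0
          w = κ ℕ.+ κ ∸ h
          rest = κ ∸ (h ℕ.+ r ℕ.* b)

          w+h : w ℕ.+ h ≡ κ ℕ.+ κ
          w+h = ℕₚ.m∸n+n≡m (ℕₚ.≤-trans h≤κ κ≤2κ)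

          2rb≤κ : 2 ℕ.* (r ℕ.* b) ℕ.≤ κ
          2rb≤κ = ℕₚ.*-cancelˡ-≤ q {{ℕ.>-nonZero 1≤q}} (ℕₚ.≤-trans (ℕₚ.≤-reflexive (lemma q r b))
            (ℕₚ.≤-trans (ℕₚ.*-monoˡ-≤ b (ℕₚ.m≤n+m (2 ℕ.* r ℕ.* q) (2 ℕ.* N))) (ℕₚ.m+n≤o⇒m≤o _ H)))
            where
            lemma : ∀ q r b → q ℕ.* (2 ℕ.* (r ℕ.* b)) ≡ 2 ℕ.* r ℕ.* q ℕ.* b
            lemma = solve-∀

          h+rb≤κ : h ℕ.+ r ℕ.* b ℕ.≤ κ
          h+rb≤κ = ℕₚ.*-cancelˡ-≤ 2 (ℕₚ.≤-trans (ℕₚ.≤-reflexive (lemma h (r ℕ.* b)))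
            (ℕₚ.≤-trans (ℕₚ.+-mono-≤ 2h≤κ 2rb≤κ) (ℕₚ.≤-reflexive (≡.cong (κ ℕ.+_) (≡.sym (ℕₚ.+-identityʳ κ))))))
            where
            lemma : ∀ h x → 2 ℕ.* (h ℕ.+ x) ≡ h ℕ.+ h ℕ.+ 2 ℕ.* x
            lemma = solve-∀

          rest+ : rest ℕ.+ (h ℕ.+ r ℕ.* b) ≡ κ
          rest+ = ℕₚ.m∸n+n≡m h+rb≤κ

          phase₁ : exp₄ r 1 · f (G h ∪ B) + 24 · F h ≤ 24 · f (G h ∪ B) + exp₄ r 1 · f (Y h i)
          phase₁ = ≡.subst (λ S → exp₄ r 1 · f (G h ∪ B) + 24 · f S ≤ 24 · f (G h ∪ B) + exp₄ r 1 · f (Y h i)) (Y-zero h)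
            (bob-bound h 0 (r ℕ.* b) 0 b r 1 (ℕₚ.≤-trans h≤κ κ≤2κ) 1≤b (ℕₚ.≤-reflexive (ℕₚ.+-identityʳ b))
              (ℕₚ.≤-reflexive (≡.sym (ℕₚ.*-identityˡ (r ℕ.* b)))))

          steps : rest ℕ.+ i ≡ κ ∸ h
          steps = ≡.sym (≡.trans (≡.cong (_∸ h) (≡.sym rest+)) (≡.trans (≡.cong (_∸ h) (lemma rest h (r ℕ.* b))) (ℕₚ.m+n∸n≡m _ h)))
            where
            lemma : ∀ m h x → m ℕ.+ (h ℕ.+ x) ≡ m ℕ.+ (x ℕ.+ 0) ℕ.+ h
            lemma = solve-∀

          phase₂ : exp₄ N q · f (G (κ ℕ.+ κ) ∪ B) + exp₄ 0 q · f (Y h i) ≤ exp₄ 0 q · f (G (κ ℕ.+ κ) ∪ B) + exp₄ N q · V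
          phase₂ = ≡.subst (λ z → exp₄ N q · f (G z ∪ B) + exp₄ 0 q · f (Y h i) ≤ exp₄ 0 q · f (G z ∪ B) + exp₄ N q · V) w+h
            (bob-final h i rest w (b ℕ.+ w) N q h≤κ steps (ℕₚ.≤-reflexive w+h) (ℕₚ.≤-trans 1≤b (ℕₚ.m≤m+n b w)) ℕₚ.≤-refl
              (phase-ratio N e r b h κ w rest w+h rest+ 2h≤κ H))

        private
          cancel-b : ∀ M c → M ℕ.* κ ℕ.≤ (c ℕ.+ M) ℕ.* b → M ℕ.* a ℕ.≤ c ℕ.* b
          cancel-b M c h = ℕₚ.+-cancelʳ-≤ (M ℕ.* b) _ _ (ℕₚ.≤-trans
            (ℕₚ.≤-reflexive (≡.trans (ℕₚ.+-comm (M ℕ.* a) (M ℕ.* b)) (≡.trans (≡.sym (ℕₚ.*-distribˡ-+ M b a)) (≡.cong (M ℕ.*_) b+a≡κ))))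
            (ℕₚ.≤-trans h (ℕₚ.≤-reflexive (ℕₚ.*-distribʳ-+ b c M))))

          add-κ : ∀ u v w → u ℕ.* b ℕ.≤ w ℕ.* κ → u ℕ.* b ℕ.+ v ℕ.* κ ℕ.≤ (w ℕ.+ v) ℕ.* κ
          add-κ u v w h = ℕₚ.≤-trans (ℕₚ.+-monoˡ-≤ (v ℕ.* κ) h) (ℕₚ.≤-reflexive (≡.sym (ℕₚ.*-distribʳ-+ κ w v)))

        -- The multipliers are rounded optimal dual solutions of the linear program that minimises V.
        mixed-514 : 514 · f O ≤ 1000 · V
        -- In the worst case `h = κ / 2` the second phase has `κ/2 - r b` steps for `b + 3κ/2`
        -- elements. This ratio is 1/10 at `b / κ = 1/6` with `r = 2`, and 1/12, 1/6, 1/4 at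
        -- `b / κ = 9/74, 3/38, 1/26` with `r = 3`. Thus the upper end of a range of `b / κ` fixes
        -- `N / (N + e)` and its lower end bounds `a / b`.
        mixed-514 with κ ℕ.≤? 6 ℕ.* b
        ... | yes κ≤6b = many-B (≡.subst (ℕ._≤ 5 ℕ.* b) (ℕₚ.*-identityˡ a)
                (cancel-b 1 5 (≡.subst (ℕ._≤ 6 ℕ.* b) (≡.sym (ℕₚ.*-identityˡ κ)) κ≤6b)))
        ... | no κ≰6b with 9 ℕ.* κ ℕ.≤? 74 ℕ.* b
        ... | yes 9κ≤74b = few-B 2 1 9 9 65 (s≤s z≤n) (cancel-b 9 65 9κ≤74b) (add-κ 42 3 7 42b≤7κ)
                (207984 ∷ 188518 ∷ 4598 ∷ 29880 ∷ 3320 ∷ 120 ∷ 205632 ∷ 1428 ∷ 1 ∷ 12620 ∷ 17114 ∷ 4804 ∷ []) 848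
          where
          42b≤7κ : 42 ℕ.* b ℕ.≤ 7 ℕ.* κ
          42b≤7κ = ≡.subst (ℕ._≤ 7 ℕ.* κ) (≡.sym (ℕₚ.*-assoc 7 6 b)) (ℕₚ.*-monoʳ-≤ 7 (ℕₚ.<⇒≤ (ℕₚ.≰⇒> κ≰6b)))
        ... | no 9κ≰74b with 3 ℕ.* κ ℕ.≤? 38 ℕ.* b
        ... | yes 3κ≤38b = few-B 3 1 11 3 35 (s≤s z≤n) (cancel-b 3 35 3κ≤38b) (add-κ 74 3 9 (ℕₚ.<⇒≤ (ℕₚ.≰⇒> 9κ≰74b)))
                (543272 ∷ 451984 ∷ 11024 ∷ 48306 ∷ 16102 ∷ 194 ∷ 467154 ∷ 1266 ∷ 1 ∷ 21624 ∷ 15170 ∷ 1326 ∷ []) 1923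
        ... | no 3κ≰38b with κ ℕ.≤? 26 ℕ.* b
        ... | yes κ≤26b = few-B 3 1 5 1 25 (s≤s z≤n) (cancel-b 1 25 (≡.subst (ℕ._≤ 26 ℕ.* b) (≡.sym (ℕₚ.*-identityˡ κ)) κ≤26b))
                (add-κ 38 3 3 (ℕₚ.<⇒≤ (ℕₚ.≰⇒> 3κ≰38b)))
                (1463139 ∷ 1186704 ∷ 28944 ∷ 62997 ∷ 62997 ∷ 253 ∷ 1226556 ∷ 3324 ∷ 42 ∷ 118461 ∷ 39852 ∷ 6675 ∷ []) 5047
        -- Here `a / b` is unbounded; `L = M = 0` turns the inequality for `α κ` into a triviality.
        ... | no κ≰26b = few-B 3 1 3 0 0 (s≤s z≤n) ℕₚ.≤-refl
                (add-κ 26 3 1 (≡.subst (26 ℕ.* b ℕ.≤_) (≡.sym (ℕₚ.*-identityˡ κ)) (ℕₚ.<⇒≤ (ℕₚ.≰⇒> κ≰26b))))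
                (105117 ∷ 83558 ∷ 2038 ∷ 0 ∷ 0 ∷ 0 ∷ 86346 ∷ 234 ∷ 15 ∷ 13087 ∷ 2788 ∷ 118204 ∷ []) 355

      protocol-514 : 1 ℕ.≤ κ → 1 ℕ.≤ a → 514 · f O ≤ 1000 · V
      protocol-514 1≤κ 1≤a with 1 ℕ.≤? b
      ... | yes 1≤b = mixed-514 1≤κ 1≤a 1≤b
      -- Then `B` is empty, and Alice's first `κ` elements are a complete greedy run for `A`.
      ... | no  1≰b = greedy-514 {_∈ VA} {G} {κ} G-increasing
              (λ j j<κ → G-greedy j (ℕₚ.<-≤-trans j<κ κ≤2κ)) A (p∩q⊆q O VA) 1≤κ a≤κ O⊆′ Fκ≤V
        where
        B-empty : ∀ {x} → x ∈ B → x ∈ G 0 ∪ A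
        B-empty x∈B = ⊥-elim (1≰b (ℕₚ.≤-trans (ℕₚ.≤-trans (s≤s z≤n) (x∈p⇒∣p-x∣<∣p∣ x∈B)) ∣B∣≤b))
        O⊆′ : O ⊆ G 0 ∪ A
        O⊆′ = ∪-lub (q⊆p∪q (G 0) A) B-empty ∘ O⊆A∪B

-- The programs of Alice and Bob.

private variable
  ℓ : Level
  A : Set ℓ

-- The loop counter runs downwards, from N - 1 to 0.
countdown : ℕ → (ℕ → A → A) → A → A
countdown zero    g x = x
countdown (suc j) g x = countdown j g (g j x)

ifz : ℕ → A → A → A
ifz zero    x y = x
ifz (suc _) x y = y

block : Instr → List Instr → Program
block i []       = instr i
block i (j ∷ is) = instr i ⨾ block j is

copy : (x y : ℕ) → Program
copy x y = block (const x 0) (add x x y ∷ [])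

skip : Program
skip = instr (const 10 0)

for : ℕ → Program → Program
for x p = while x (instr (sub x x 0) ⨾ p)

-- Registers: 0 holds 1, 1 holds n, 2 holds κ = min (k, n + 1), 3 holds the length of the
-- message, 4 and 5 hold the positions of V and of the message in the input; 6 and 12 are loop
-- counters, 7 an element, 8 an address, 9 and 10 temporary, 11 the best candidate so far (n if
-- there is none), 14 the number of message elements Bob starts from, 15 the best such number.
-- The current set is the array at 20.  Real registers: 0 holds 0, 1 is the value of the best
-- candidate, 2 the last answer of the oracle, 3 the best value found by Bob.

setup : Program
setup = block (const 0 1) (const 8 0 ∷ read 1 8 ∷ read 2 0 ∷ add 8 1 0 ∷ sub 9 2 8 ∷ sub 2 2 9
  ∷ const 4 2 ∷ add 4 4 1 ∷ add 5 4 1 ∷ read 3 5 ∷ add 5 5 0 ∷ [])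

-- The old entry of the array is saved and restored: the candidate may already belong to the current
-- set and must then survive the trial.
try : Program
try = block (const 8 20) (add 8 8 7 ∷ load 9 8 ∷ store 8 0 ∷ const 10 20 ∷ [])
  ⨾ instr (query 2 10)
  ⨾ block (store 8 9) (leq 10 1 2 ∷ [])
  ⨾ ifnz 10 (block (const 10 2) (rload 1 10 ∷ const 11 0 ∷ add 11 11 7 ∷ [])) skip

scan : Program
scan = block (const 11 0) (add 11 11 1 ∷ const 8 0 ∷ rload 1 8 ∷ const 6 0 ∷ add 6 6 1 ∷ [])
  ⨾ for 6 (block (add 8 4 6) (read 10 8 ∷ []) ⨾ ifnz 10 (copy 7 6 ⨾ try) skip)
  ⨾ copy 6 3
  ⨾ for 6 (block (add 8 5 6) (read 7 8 ∷ []) ⨾ try)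

-- Without a candidate register 11 holds n, and the mark falls just behind the array, where it
-- leaves the set unchanged.
growth : Program
growth = scan ⨾ block (const 8 20) (add 8 8 11 ∷ store 8 0 ∷ [])

alice : Program
alice = setup
  ⨾ instr (add 12 2 2)
  ⨾ for 12 (growth ⨾ instr (sub 10 1 11) ⨾ ifnz 10 (instr (emit 11)) skip)

rebuild : Program
rebuild = copy 6 1
  ⨾ for 6 (block (const 8 20) (add 8 8 6 ∷ const 9 0 ∷ store 8 9 ∷ []))
  ⨾ copy 6 14
  ⨾ for 6 (block (add 8 5 6) (read 7 8 ∷ const 8 20 ∷ add 8 8 7 ∷ store 8 0 ∷ []))
  ⨾ instr (sub 12 2 14)
  ⨾ for 12 growth

bob : Program
bob = setup
  -- Two truncated subtractions give the minimum of κ and the message length; one is added because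
  -- the loop body sees the decremented counter, down to 0.
  ⨾ block (sub 14 2 3) (sub 14 2 14 ∷ add 14 14 0 ∷ [])
  ⨾ for 14 (rebuild
      ⨾ instr (const 10 20)
      ⨾ instr (query 2 10)
      ⨾ instr (leq 10 3 2)
      ⨾ ifnz 10 (block (const 10 2) (rload 3 10 ∷ const 15 0 ∷ add 15 15 14 ∷ [])) skip)
  -- Only the best start was stored; its set is computed once more.
  ⨾ copy 14 15
  ⨾ rebuild
  ⨾ copy 6 1
  ⨾ for 6 (block (const 8 20) (add 8 8 6 ∷ load 10 8 ∷ []) ⨾ ifnz 10 (instr (emit 6)) skip)

remove : ∀ {n} → ℕ → Subset n → Subset n
remove c X = tabulate λ i → if c ≡ᵇ toℕ i then false else lookup X i

-- Functional specification of the programs, and total correctness with time bounds.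

module Verification {c ℓ₁ ℓ₂} (ℝ : RealField c ℓ₁ ℓ₂) where
  open RealField ℝ
  open Semantics ℝ
  open State

  module Pure {n : ℕ} (f : Subset n → Carrier) (k : ℕ) (input : List ℕ) where

    -- Truncated subtraction yields min (k, n + 1). As `k` is written in binary, `k` rounds could be
    -- exponentially many. No subset has more than `n` elements, and the `+ 1` keeps `κ` positive on
    -- an empty ground set.
    κ len : ℕ
    κ = k ∸ (k ∸ (n ℕ.+ 1))
    -- Alice's input ends before this position, so the default 0 gives her an empty message and both
    -- players can share `scan`.
    len = input ‼ (2 ℕ.+ n ℕ.+ n)

    member message : ℕ → ℕ
    member i = input ‼ (2 ℕ.+ n ℕ.+ i)
    message j = input ‼ (2 ℕ.+ n ℕ.+ n ℕ.+ 1 ℕ.+ j)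

    better : Subset n → ℕ → ℕ × Carrier → ℕ × Carrier
    better X e (d , v) = if does (v ≤? f (insert e X)) then (e , f (insert e X)) else (d , v)

    tryMember : Subset n → ℕ → ℕ × Carrier → ℕ × Carrier
    tryMember X i acc = ifz (member i) acc (better X i acc)

    best : Subset n → ℕ × Carrier
    best X = countdown len (λ j → better X (message j)) (countdown n (tryMember X) (n , 0#))

    pick : Subset n → ℕ
    pick X = proj₁ (best X)

    grow : Subset n → Subset n
    grow X = insert (pick X) X

    prefix : ℕ → Subset n
    prefix s = countdown s (λ j → insert (message j)) ∅

    attempt : ℕ → Subset n
    attempt s = countdown (κ ∸ s) (λ _ → grow) (prefix s)

    improve : ℕ → ℕ × Carrier → ℕ × Carrier
    improve s (s′ , v) = if does (v ≤? f (attempt s)) then (s , f (attempt s)) else (s′ , v)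

    chosen : ℕ
    chosen = proj₁ (countdown (κ ∸ (κ ∸ len) ℕ.+ 1) improve (0 , 0#))

    toElement : ℕ → List (Fin n)
    toElement d with d <? n
    ... | yes d<n = [ fromℕ< d<n ]
    ... | no  _   = []

    send : ℕ → Subset n × List (Fin n) → Subset n × List (Fin n)
    send _ (X , out) = grow X , out ++ toElement (pick X)

    sent : List (Fin n)
    sent = proj₂ (countdown (κ ℕ.+ κ) send (∅ , []))

  module _ {n : ℕ} (f : Subset n → Carrier) (D : Subset n) (input : List ℕ) where

    -- A Hoare triple for total correctness, with `T` as a bound on the running time.
    Triple : ∀ {p q} → (State n → Set p) → Program → ℕ → (State n → Set q) → Set (c ⊔ p ⊔ q)
    Triple P prog T Q = ∀ s → P s → ∃ λ t → Σ (State n) λ s′ → Run f D input prog s t s′ × t ℕ.≤ T × Q s′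

    private variable
      p q r : Level
      P : State n → Set p
      Q : State n → Set q
      S : State n → Set r
      a b : Program
      T U : ℕ

    infixr 5 _then_

    _then_ : Triple P a T Q → Triple Q b U S → Triple P (a ⨾ b) (T ℕ.+ U) S
    (h then h′) s ps =
      let t , s₁ , run₁ , t≤ , qs = h s ps
          u , s₂ , run₂ , u≤ , ss = h′ s₁ qs
      in t ℕ.+ u , s₂ , seq run₁ run₂ , ℕₚ.+-mono-≤ t≤ u≤ , ss

    weaken : T ℕ.≤ U → Triple P a T Q → Triple P a U Q
    weaken T≤U h s ps = let t , s′ , run , t≤ , qs = h s ps in t , s′ , run , ℕₚ.≤-trans t≤ T≤U , qs

    post : ∀ {Q : State n → Set q} {Q′ : State n → Set r} → (∀ {s} → Q s → Q′ s) → Triple P a T Q → Triple P a T Q′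
    post Q⇒Q′ h s ps = let t , s′ , run , t≤ , qs = h s ps in t , s′ , run , t≤ , Q⇒Q′ qs

    execute : Instr → List Instr → State n → Maybe (State n)
    execute i []       s = step f D input i s
    execute i (j ∷ is) s = step f D input i s >>= execute j is

    run-block : ∀ i is {s s′} → execute i is s ≡ just s′ → Run f D input (block i is) s (suc (length is)) s′
    run-block i []       eq = instr eq
    run-block i (j ∷ is) {s} eq with step f D input i s in eq₁
    ... | just s₁ = seq (instr eq₁) (run-block j is eq)

    outcome : Instr → List Instr → State n → State n
    outcome i is s = fromMaybe s (execute i is s)

    -- Instructions that can neither fail nor query reduce on an arbitrary state, so the first
    -- hypothesis is discharged by `refl`.
    straight : ∀ {P : State n → Set p} {Q : State n → Set q} i is →
               (∀ s → execute i is s ≡ just (outcome i is s)) →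
               (∀ s → P s → Q (outcome i is s)) → Triple P (block i is) (suc (length is)) Q
    straight i is eq h s ps = _ , outcome i is s , run-block i is (eq s) , ℕₚ.≤-refl , h s ps

    -- The invariant carries a pure accumulator, so the loop is tied directly to the `countdown` of
    -- the specification.
    for-loop : ∀ {a} {A : Set a} x {body T} (P : ℕ → A → State n → Set p) (g : ℕ → A → A) N →
      (∀ {j y s} → P j y s → M s x ≡ j) →
      (∀ j y → j ℕ.< N → Triple (P (suc j) y) (instr (sub x x 0) ⨾ body) T (P j (g j y))) →
      ∀ y → Triple (P N y) (for x body) (N ℕ.* suc T ℕ.+ 1) (P 0 (countdown N g y))
    for-loop x P g zero    counter h y s ps = 1 , s , stop (counter ps) , ℕₚ.≤-refl , ps
    for-loop x P g (suc N) counter h y s ps =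
      let t , s₁ , run₁ , t≤ , qs = h N y ℕₚ.≤-refl s ps
          u , s₂ , run₂ , u≤ , rs = for-loop x P g N counter (λ j y j<N → h j y (ℕₚ.m<n⇒m<1+n j<N)) (g N y) s₁ qs
      in suc (t ℕ.+ u) , s₂ , loop (λ x≡0 → ℕₚ.1+n≢0 (trans (sym (counter ps)) x≡0)) run₁ run₂
         , ℕₚ.≤-trans (s≤s (ℕₚ.+-mono-≤ t≤ u≤)) (ℕₚ.≤-reflexive (sym (ℕₚ.+-assoc (suc _) (N ℕ.* suc _) 1))) , rs

    branch : ∀ x {P : State n → Set p} → Triple (λ s → P s × M s x ≢ 0) a T Q → Triple (λ s → P s × M s x ≡ 0) b T Q →
             Triple P (ifnz x a b) (suc T) Q
    branch x h h′ s ps with M s x ℕ.≟ 0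
    ... | yes x≡0 = let t , s′ , run , t≤ , qs = h′ s (ps , x≡0) in suc t , s′ , if-else x≡0 run , s≤s t≤ , qs
    ... | no  x≢0 = let t , s′ , run , t≤ , qs = h s (ps , x≢0) in suc t , s′ , if-then x≢0 run , s≤s t≤ , qs

    asked : ℕ → ℕ → State n → State n
    asked x y ⟨ M , R , cs , o ⟩ = ⟨ M , R [ x ≔ f (querySet M (M y)) ] , cs , o ⟩

    query-ok : ∀ x y {P : State n → Set p} {Q : State n → Set q} →
      (∀ s → P s → querySet (M s) (M s y) ⊆ D) → (∀ s → P s → Q (asked x y s)) → Triple P (instr (query x y)) 1 Q
    query-ok x y allowed h s ps = 1 , asked x y s , instr (run s (allowed s ps)) , ℕₚ.≤-refl , h s ps
      where
      run : ∀ s → querySet (M s) (M s y) ⊆ D → step f D input (query x y) s ≡ just (asked x y s)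
      run ⟨ M , R , cs , o ⟩ ok with querySet M (M y) ⊆? D
      ... | yes _ = refl
      ... | no ¬ok = ⊥-elim (¬ok ok)

    emit-ok : ∀ x {P : State n → Set p} {Q : State n → Set q} (e : State n → Fin n) →
      (∀ s → P s → M s x ≡ toℕ (e s)) → (∀ s → P s → Q ⟨ M s , R s , coins s , output s ++ [ e s ] ⟩) →
      Triple P (instr (emit x)) 1 Q
    emit-ok x e elem h s ps = 1 , _ , instr (run s (e s) (elem s ps)) , ℕₚ.≤-refl , h s ps
      where
      run : ∀ s e → M s x ≡ toℕ e → step f D input (emit x) s ≡ just ⟨ M s , R s , coins s , output s ++ [ e ] ⟩
      run ⟨ M , R , cs , o ⟩ e eq with M x <? n
      ... | yes x<n = cong (λ z → just ⟨ M , R , cs , o ++ [ z ] ⟩) (toℕ-injective (trans (toℕ-fromℕ< x<n) eq))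
      ... | no  x≮n = ⊥-elim (x≮n (subst (ℕ._< n) (sym eq) (toℕ<n e)))

    lookup-querySet : ∀ (M : ℕ → ℕ) {X : Subset n} → querySet M 20 ≡ X → ∀ i → not (M (20 ℕ.+ toℕ i) ≡ᵇ 0) ≡ lookup X i
    lookup-querySet M refl i = sym (lookup∘tabulate _ i)

    write-one : ∀ (M M′ : ℕ → ℕ) {X : Subset n} {v} d {e} → d ≡ e → v ≡ 1 →
                (∀ (i : Fin n) → M′ (20 ℕ.+ toℕ i) ≡ (if d ≡ᵇ toℕ i then v else M (20 ℕ.+ toℕ i))) →
                querySet M 20 ≡ X → querySet M′ 20 ≡ insert e X
    write-one M M′ {X} d refl refl h eq = tabulate-cong λ i →
      trans (cong (λ z → not (z ≡ᵇ 0)) (h i)) (helper i (d ≡ᵇ toℕ i))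
      where
      helper : ∀ i b → not ((if b then 1 else M (20 ℕ.+ toℕ i)) ≡ᵇ 0) ≡ b ∨ lookup X i
      helper i true  = refl
      helper i false = lookup-querySet M eq i

    write-zero : ∀ (M M′ : ℕ → ℕ) {X : Subset n} d {e} → d ≡ e →
                 (∀ (i : Fin n) → M′ (20 ℕ.+ toℕ i) ≡ (if d ≡ᵇ toℕ i then 0 else M (20 ℕ.+ toℕ i))) →
                 querySet M 20 ≡ X → querySet M′ 20 ≡ remove e X
    write-zero M M′ {X} d refl h eq = tabulate-cong λ i →
      trans (cong (λ z → not (z ≡ᵇ 0)) (h i)) (helper i (d ≡ᵇ toℕ i))
      where
      helper : ∀ i b → not ((if b then 0 else M (20 ℕ.+ toℕ i)) ≡ᵇ 0) ≡ (if b then false else lookup X i)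
      helper i true  = refl
      helper i false = lookup-querySet M eq i

    write-back : ∀ (M M′ : ℕ → ℕ) {X : Subset n} {v} d →
                 (∀ (i : Fin n) → M′ (20 ℕ.+ toℕ i) ≡
                   (if d ≡ᵇ toℕ i then M (20 ℕ.+ d) else if d ≡ᵇ toℕ i then v else M (20 ℕ.+ toℕ i))) →
                 querySet M 20 ≡ X → querySet M′ 20 ≡ X
    write-back M M′ {v = v} d h eq = trans (tabulate-cong λ i → cong (λ z → not (z ≡ᵇ 0)) (trans (h i) (helper i))) eq
      where
      helper : ∀ i → (if d ≡ᵇ toℕ i then M (20 ℕ.+ d) else if d ≡ᵇ toℕ i then v else M (20 ℕ.+ toℕ i)) ≡ M (20 ℕ.+ toℕ i)
      helper i with d ≡ᵇ toℕ i in eq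
      ... | true  = cong (λ z → M (20 ℕ.+ z)) (ℕₚ.≡ᵇ⇒≡ d (toℕ i) (subst IsTrue (sym eq) _))
      ... | false = refl

    module _ (k : ℕ) where
      open Pure f k input

      Outer : Set c
      Outer = ℕ × ℕ × ℕ × ℕ × Carrier × List (Fin n)

      -- Registers are grouped in tuples so that instructions not touching them preserve the
      -- equations definitionally. The array begins at the literal address 20, beyond all registers:
      -- a write to a register is seen by computation to leave `set` intact.
      record At (X : Subset n) (o : Outer) (s : State n) : Set c where
        constructor at
        field
          consts : (M s 0 , M s 1 , M s 2 , M s 3 , M s 4 , M s 5 , R s 0) ≡
                   (1 , n , κ , len , 2 ℕ.+ n , 2 ℕ.+ n ℕ.+ n ℕ.+ 1 , 0#)
          outer  : (M s 6 , M s 12 , M s 14 , M s 15 , R s 3 , output s) ≡ o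
          set    : querySet (M s) 20 ≡ X
      open At

      Acc : ℕ × Carrier → State n → Set c
      Acc acc s = (M s 11 , R s 1) ≡ acc

      M0≡1 : ∀ {X o s} → At X o s → M s 0 ≡ 1
      M0≡1 h = cong proj₁ (consts h)

      M1≡n : ∀ {X o s} → At X o s → M s 1 ≡ n
      M1≡n h = cong (λ t → proj₁ (proj₂ t)) (consts h)

      M2≡κ : ∀ {X o s} → At X o s → M s 2 ≡ κ
      M2≡κ h = cong (λ t → proj₁ (proj₂ (proj₂ t))) (consts h)

      M3≡len : ∀ {X o s} → At X o s → M s 3 ≡ len
      M3≡len h = cong (λ t → proj₁ (proj₂ (proj₂ (proj₂ t)))) (consts h)

      M4≡ : ∀ {X o s} → At X o s → M s 4 ≡ 2 ℕ.+ n
      M4≡ h = cong (λ t → proj₁ (proj₂ (proj₂ (proj₂ (proj₂ t))))) (consts h)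

      M5≡ : ∀ {X o s} → At X o s → M s 5 ≡ 2 ℕ.+ n ℕ.+ n ℕ.+ 1
      M5≡ h = cong (λ t → proj₁ (proj₂ (proj₂ (proj₂ (proj₂ (proj₂ t)))))) (consts h)

      R0≡0 : ∀ {X o s} → At X o s → R s 0 ≡ 0#
      R0≡0 h = cong (λ t → proj₂ (proj₂ (proj₂ (proj₂ (proj₂ (proj₂ t)))))) (consts h)

      bit-true : ∀ b → bit b ≢ 0 → b ≡ true
      bit-true true  _ = refl
      bit-true false h = ⊥-elim (h refl)

      bit-false : ∀ b → bit b ≡ 0 → b ≡ false
      bit-false false _ = refl

      try-ok : ∀ X o acc e → X ⊆ D → (∀ x → toℕ x ≡ e → x ∈ D) →
        Triple (λ s → At X o s × Acc acc s × M s 7 ≡ e) try 13 (λ s → At X o s × Acc (better X e acc) s)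
      try-ok X o (d , v) e X⊆D e∈D =
        straight {Q = Marked (λ s → s)} (const 8 20) mark (λ _ → refl) (λ s ps → s , ps , refl) then
        query-ok 2 10 {Q = Marked (asked 2 10)}
          (λ { _ (s , (h , _ , e≡) , refl) → subst (_⊆ D) (sym (marked s h e≡)) (insert-⊆ e e∈D X⊆D) })
          (λ { _ (s , ps , refl) → s , ps , refl }) then
        straight (store 8 9) (leq 10 1 2 ∷ []) (λ _ → refl)
          (λ { _ (s , (h , acc≡ , e≡) , refl) →
              at (consts h) (outer h) (write-back (M s) (M (outcome (const 8 20) mark s) [ 20 ℕ.+ M s 7 ≔ M s (20 ℕ.+ M s 7) ]) (M s 7) (λ _ → refl) (set h))
              , acc≡ , e≡ , cong f (marked s h e≡)
              , cong₂ (λ x Y → bit (does (x ≤? f Y))) (cong proj₂ acc≡) (marked s h e≡) }) then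
        branch 10 {P = Compared}
          (straight (const 10 2) (rload 1 10 ∷ const 11 0 ∷ add 11 11 7 ∷ []) (λ _ → refl)
            (λ { s ((h , acc≡ , e≡ , v≡ , flag) , nz) → at (consts h) (outer h) (set h)
              , trans (cong₂ _,_ e≡ v≡) (cong (if_then (e , f (insert e X)) else (d , v)) (sym (bit-true _ (λ z → nz (trans flag z))))) }))
          (weaken (s≤s z≤n) (straight (const 10 0) [] (λ _ → refl)
            (λ { s ((h , acc≡ , e≡ , v≡ , flag) , z) → at (consts h) (outer h) (set h)
              , trans acc≡ (cong (if_then (e , f (insert e X)) else (d , v)) (sym (bit-false _ (trans (sym flag) z)))) })))
        where
        mark : List Instr
        mark = add 8 8 7 ∷ load 9 8 ∷ store 8 0 ∷ const 10 20 ∷ []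
        -- Remembers the state before the mark, whose entry the final store must restore.
        Marked : (State n → State n) → State n → Set c
        Marked next s′ = ∃ λ s → (At X o s × Acc (d , v) s × M s 7 ≡ e) × s′ ≡ next (outcome (const 8 20) mark s)
        Compared : State n → Set c
        Compared s = At X o s × Acc (d , v) s × M s 7 ≡ e × R s 2 ≡ f (insert e X) × M s 10 ≡ bit (does (v ≤? f (insert e X)))
        marked : ∀ s → At X o s → M s 7 ≡ e → querySet (M (outcome (const 8 20) mark s)) 20 ≡ insert e X
        marked s h e≡ = write-one (M s) (M (outcome (const 8 20) mark s)) (M s 7) e≡ (M0≡1 h) (λ _ → refl) (set h)

      Candidates⊆D : Set
      Candidates⊆D = (∀ i → i ℕ.< n → member i ≢ 0 → ∀ x → toℕ x ≡ i → x ∈ D) ×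
                     (∀ j → j ℕ.< len → ∀ x → toℕ x ≡ message j → x ∈ D)

      scan-time growth-time : ℕ
      scan-time = 6 ℕ.+ ((n ℕ.* 20 ℕ.+ 1) ℕ.+ (2 ℕ.+ (len ℕ.* 17 ℕ.+ 1)))
      growth-time = scan-time ℕ.+ 3

      count-6 : ∀ {X j o s} → At X (suc j , o) s → At X (j , o) (outcome (sub 6 6 0) [] s)
      count-6 h = at (consts h) (cong₂ (λ u t → (proj₁ t ∸ u) , proj₂ t) (M0≡1 h) (outer h)) (set h)

      count-12 : ∀ {X i j o s} → At X (i , suc j , o) s → At X (i , j , o) (outcome (sub 12 12 0) [] s)
      count-12 h = at (consts h) (cong₂ (λ u t → proj₁ t , (proj₁ (proj₂ t) ∸ u) , proj₂ (proj₂ t)) (M0≡1 h) (outer h)) (set h)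

      count-14 : ∀ {X i g j o s} → At X (i , g , suc j , o) s → At X (i , g , j , o) (outcome (sub 14 14 0) [] s)
      count-14 h = at (consts h)
        (cong₂ (λ u t → proj₁ t , proj₁ (proj₂ t) , (proj₁ (proj₂ (proj₂ t)) ∸ u) , proj₂ (proj₂ (proj₂ t))) (M0≡1 h) (outer h)) (set h)

      M6≡ : ∀ {X i o s} → At X (i , o) s → M s 6 ≡ i
      M6≡ h = cong proj₁ (outer h)

      M14≡ : ∀ {X i g s′ o s} → At X (i , g , s′ , o) s → M s 14 ≡ s′
      M14≡ h = cong (λ t → proj₁ (proj₂ (proj₂ t))) (outer h)

      set-6 : ∀ {X i o s} {N v : ℕ} → At X (i , o) s → v ≡ N → (v , M s 12 , M s 14 , M s 15 , R s 3 , output s) ≡ (N , o)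
      set-6 {N = N} h refl = cong (λ t → N , proj₂ t) (outer h)

      scan-ok : ∀ X i o → X ⊆ D → Candidates⊆D →
        Triple (At X (i , o)) scan scan-time (λ s → At X (0 , o) s × Acc (best X) s)
      scan-ok X i o X⊆D (members , messages) =
        straight {Q = Inv n (n , 0#)} (const 11 0) (add 11 11 1 ∷ const 8 0 ∷ rload 1 8 ∷ const 6 0 ∷ add 6 6 1 ∷ []) (λ _ → refl)
          (λ s h → at (consts h) (set-6 h (M1≡n h)) (set h) , cong₂ _,_ (M1≡n h) (R0≡0 h)) then
        for-loop 6 Inv (tryMember X) n (λ ps → M6≡ (proj₁ ps)) tryMember-ok (n , 0#) then
        straight {Q = Inv len _} (const 6 0) (add 6 6 3 ∷ []) (λ _ → refl)
          (λ { s (h , acc) → at (consts h) (set-6 h (M3≡len h)) (set h) , acc }) then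
        for-loop 6 Inv (λ j → better X (message j)) len (λ ps → M6≡ (proj₁ ps)) tryMessage-ok _
        where
        Inv : ℕ → ℕ × Carrier → State n → Set c
        Inv j acc s = At X (j , o) s × Acc acc s

        tryMember-ok : ∀ j acc → j ℕ.< n → Triple (Inv (suc j) acc)
          (instr (sub 6 6 0) ⨾ block (add 8 4 6) (read 10 8 ∷ []) ⨾ ifnz 10 (copy 7 6 ⨾ try) skip) 19 (Inv j (tryMember X j acc))
        tryMember-ok j acc j<n =
          straight {Q = Inv j acc} (sub 6 6 0) [] (λ _ → refl) (λ { s (h , acc) → count-6 h , acc }) then
          straight {Q = λ s → Inv j acc s × M s 10 ≡ member j} (add 8 4 6) (read 10 8 ∷ []) (λ _ → refl)
            (λ { s (h , acc) → (at (consts h) (outer h) (set h) , acc)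
                             , cong₂ (λ u v → input ‼ (u ℕ.+ v)) (M4≡ h) (M6≡ h) }) then
          branch-member (member j) refl
          where
          branch-member : ∀ m → m ≡ member j → Triple (λ s → Inv j acc s × M s 10 ≡ member j) (ifnz 10 (copy 7 6 ⨾ try) skip) 16
                            (Inv j (ifz (member j) acc (better X j acc)))
          branch-member zero    eq rewrite sym eq = branch 10
            (λ { s ((_ , z) , nz) → ⊥-elim (nz z) })
            (weaken (s≤s z≤n) (straight (const 10 0) [] (λ _ → refl)
              (λ { s (((h , acc) , _) , _) → at (consts h) (outer h) (set h) , acc })))
          branch-member (suc m) eq rewrite sym eq = branch 10
            (straight {Q = λ s → At X (j , o) s × Acc acc s × M s 7 ≡ j} (const 7 0) (add 7 7 6 ∷ []) (λ _ → refl)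
              (λ { s (((h , acc) , _) , _) → at (consts h) (outer h) (set h) , acc , M6≡ h }) then
             try-ok X (j , o) acc j X⊆D (members j j<n (λ z → ℕₚ.1+n≢0 (trans eq z))))
            (λ { s ((_ , nz) , z) → ⊥-elim (ℕₚ.1+n≢0 (trans (sym nz) z)) })

        tryMessage-ok : ∀ j acc → j ℕ.< len → Triple (Inv (suc j) acc)
          (instr (sub 6 6 0) ⨾ block (add 8 5 6) (read 7 8 ∷ []) ⨾ try) 16 (Inv j (better X (message j) acc))
        tryMessage-ok j acc j<len =
          straight {Q = Inv j acc} (sub 6 6 0) [] (λ _ → refl) (λ { s (h , acc) → count-6 h , acc }) then
          straight {Q = λ s → At X (j , o) s × Acc acc s × M s 7 ≡ message j} (add 8 5 6) (read 7 8 ∷ []) (λ _ → refl)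
            (λ { s (h , acc) → at (consts h) (outer h) (set h) , acc
                             , cong₂ (λ u v → input ‼ (u ℕ.+ v)) (M5≡ h) (M6≡ h) }) then
          try-ok X (j , o) acc (message j) X⊆D (messages j j<len)

      growth-ok : ∀ X i o → X ⊆ D → Candidates⊆D →
        Triple (At X (i , o)) growth growth-time (λ s → At (grow X) (0 , o) s × Acc (best X) s)
      growth-ok X i o X⊆D ok =
        scan-ok X i o X⊆D ok then
        straight (const 8 20) (add 8 8 11 ∷ store 8 0 ∷ []) (λ _ → refl)
          (λ { s (h , acc) → at (consts h) (outer h)
            (write-one (M s) (M (outcome (const 8 20) (add 8 8 11 ∷ store 8 0 ∷ []) s)) (M s 11) (cong proj₁ acc) (M0≡1 h) (λ _ → refl) (set h))
            , acc })

      append : List (Fin n) → Outer → Outer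
      append es (i , g , s , s′ , v , out) = i , g , s , s′ , v , out ++ es

      emit-at : ∀ {X o s} e → At X o s → At X (append [ e ] o) ⟨ M s , R s , coins s , output s ++ [ e ] ⟩
      emit-at e h = at (consts h) (cong (append [ e ]) (outer h)) (set h)

      set-out : ∀ {X o s es} → es ≡ [] → At X o s → At X (append es o) s
      set-out {o = i , g , s , s′ , v , out} refl h =
        at (consts h) (trans (outer h) (cong (λ out → i , g , s , s′ , v , out) (sym (++-identityʳ out)))) (set h)

      send-ok : ∀ X o → Triple (λ s → At (grow X) o s × Acc (best X) s)
        (instr (sub 10 1 11) ⨾ ifnz 10 (instr (emit 11)) skip) 3 (At (grow X) (append (toElement (pick X)) o))
      send-ok X o =
        straight {Q = λ s → (At (grow X) o s × Acc (best X) s) × M s 10 ≡ n ∸ pick X} (sub 10 1 11) [] (λ _ → refl)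
          (λ { s (h , acc) → (at (consts h) (outer h) (set h) , acc) , cong₂ _∸_ (M1≡n h) (cong proj₁ acc) }) then
        branch-sent
        where
        branch-sent : Triple (λ s → (At (grow X) o s × Acc (best X) s) × M s 10 ≡ n ∸ pick X) (ifnz 10 (instr (emit 11)) skip) 2
                        (At (grow X) (append (toElement (pick X)) o))
        branch-sent with pick X <? n
        ... | yes d<n = branch 10
          (emit-ok 11 (λ _ → fromℕ< d<n) (λ { s (((h , acc) , _) , _) → trans (cong proj₁ acc) (sym (toℕ-fromℕ< d<n)) })
            (λ { s (((h , acc) , _) , _) → emit-at (fromℕ< d<n) h }))
          (λ { s ((_ , eq) , z) → ⊥-elim (ℕₚ.<⇒≱ d<n (ℕₚ.m∸n≡0⇒m≤n (trans (sym eq) z))) })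
        ... | no d≮n = branch 10
          (λ { s ((_ , eq) , nz) → ⊥-elim (nz (trans eq (ℕₚ.m≤n⇒m∸n≡0 (ℕₚ.≮⇒≥ d≮n)))) })
          (straight (const 10 0) [] (λ _ → refl)
            (λ { s (((h , acc) , _) , _) → set-out refl (at (consts h) (outer h) (set h)) }))

      Start : Outer
      Start = 0 , 0 , 0 , 0 , 0# , []

      setup-ok : input ‼ 0 ≡ n → input ‼ 1 ≡ k → ∀ cs → Triple (_≡ initial cs) setup 12 (At ∅ Start)
      setup-ok n≡ k≡ cs = straight (const 0 1) (const 8 0 ∷ read 1 8 ∷ read 2 0 ∷ add 8 1 0 ∷ sub 9 2 8 ∷ sub 2 2 9
          ∷ const 4 2 ∷ add 4 4 1 ∷ add 5 4 1 ∷ read 3 5 ∷ add 5 5 0 ∷ []) (λ _ → refl)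
        (λ { s refl → at (cong₂ (λ n k → 1 , n , k ∸ (k ∸ (n ℕ.+ 1)) , input ‼ (2 ℕ.+ n ℕ.+ n) , 2 ℕ.+ n , 2 ℕ.+ n ℕ.+ n ℕ.+ 1 , 0#) n≡ k≡)
                         refl (zeros n) })
        where
        zeros : ∀ n → tabulate {n = n} (λ _ → false) ≡ ∅
        zeros zero    = refl
        zeros (suc n) = cong (false Vec.∷_) (zeros n)

      alice-time : ℕ
      alice-time = 12 ℕ.+ (1 ℕ.+ ((κ ℕ.+ κ) ℕ.* suc (1 ℕ.+ (growth-time ℕ.+ 3)) ℕ.+ 1))

      alice-ok : input ‼ 0 ≡ n → input ‼ 1 ≡ k → Candidates⊆D → (∀ {X} → X ⊆ D → grow X ⊆ D) →
        ∀ cs → Triple (_≡ initial cs) alice alice-time (λ s → output s ≡ sent)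
      alice-ok n≡ k≡ ok grow⊆D cs =
        setup-ok n≡ k≡ cs then
        straight {Q = Inv (κ ℕ.+ κ) (∅ , [])} (add 12 2 2) [] (λ _ → refl)
          (λ s h → at (consts h)
            (cong₂ (λ u t → proj₁ t , u ℕ.+ u , proj₂ (proj₂ t)) (M2≡κ h) (outer h)) (set h) , λ x∈ → ⊥-elim (∉⊥ x∈)) then
        post (λ { (h , _) → cong (λ t → proj₂ (proj₂ (proj₂ (proj₂ (proj₂ t))))) (outer h) })
          (for-loop 12 Inv send (κ ℕ.+ κ) (λ { (h , _) → cong (λ t → proj₁ (proj₂ t)) (outer h) }) round-ok (∅ , []))
        where
        Inv : ℕ → Subset n × List (Fin n) → State n → Set c
        Inv j (X , out) s = At X (0 , j , 0 , 0 , 0# , out) s × X ⊆ D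
        round-ok : ∀ j y → j ℕ.< κ ℕ.+ κ → Triple (Inv (suc j) y)
          (instr (sub 12 12 0) ⨾ growth ⨾ instr (sub 10 1 11) ⨾ ifnz 10 (instr (emit 11)) skip)
          (1 ℕ.+ (growth-time ℕ.+ 3)) (Inv j (send j y))
        round-ok j (X , out) _ s (h , X⊆D) = post {Q′ = Inv j (send j (X , out))} (λ h → h , grow⊆D X⊆D)
          (straight {P = At X (0 , suc j , 0 , 0 , 0# , out)} (sub 12 12 0) [] (λ _ → refl) (λ s h → count-12 h) then
           growth-ok X 0 (j , 0 , 0 , 0# , out) X⊆D ok then
           send-ok X (0 , j , 0 , 0 , 0# , out)) s h

      rebuild-time : ℕ
      rebuild-time = 2 ℕ.+ ((n ℕ.* 6 ℕ.+ 1) ℕ.+ (2 ℕ.+ ((κ ℕ.* 7 ℕ.+ 1) ℕ.+ (1 ℕ.+ (κ ℕ.* suc (1 ℕ.+ growth-time) ℕ.+ 1)))))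

      module _ (everything : ∀ x → x ∈ D) where

        private
          all⊆D : ∀ {X} → X ⊆ D
          all⊆D _ = everything _

          candidates : Candidates⊆D
          candidates = (λ _ _ _ x _ → everything x) , (λ _ _ x _ → everything x)

        rebuild-ok : ∀ X i g s o → s ℕ.≤ κ →
          Triple (At X (i , g , s , o)) rebuild rebuild-time (At (attempt s) (0 , 0 , s , o))
        rebuild-ok X i g s o s≤κ =
          straight {Q = Inv n X} (const 6 0) (add 6 6 1 ∷ []) (λ _ → refl)
            (λ st h → at (consts h) (set-6 h (M1≡n h)) (set h)) then
          for-loop 6 Inv remove n M6≡ clear-ok X then
          straight {Q = Inv s ∅} (const 6 0) (add 6 6 14 ∷ []) (λ _ → refl)
            (λ st h → at (consts h) (set-6 h (M14≡ h)) (trans (set h) (countdown-remove X))) then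
          weaken (ℕₚ.+-monoˡ-≤ 1 (ℕₚ.*-monoˡ-≤ 7 s≤κ)) (for-loop 6 Inv (λ j → insert (message j)) s M6≡ fill-ok ∅) then
          straight {Q = Inv′ (κ ∸ s) (prefix s)} (sub 12 2 14) [] (λ _ → refl)
            (λ st h → at (consts h) (cong₂ (λ u t → proj₁ t , u , proj₂ (proj₂ t)) (cong₂ _∸_ (M2≡κ h) (M14≡ h)) (outer h)) (set h)) then
          weaken (ℕₚ.+-monoˡ-≤ 1 (ℕₚ.*-monoˡ-≤ (suc (1 ℕ.+ growth-time)) (ℕₚ.m∸n≤m κ s)))
            (for-loop 12 Inv′ (λ _ → grow) (κ ∸ s) (λ h → cong (λ t → proj₁ (proj₂ t)) (outer h)) grow-ok (prefix s))
          where
          Inv Inv′ : ℕ → Subset n → State n → Set c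
          Inv j Y = At Y (j , g , s , o)
          Inv′ j Y = At Y (0 , j , s , o)

          countdown-remove : ∀ (X : Subset n) → countdown n remove X ≡ ∅
          countdown-remove X = ⊆-antisym (λ x∈ → ⊥-elim (removed n X (toℕ<n _) x∈)) ⊥⊆
            where
            drop : ∀ c (X : Subset n) {x} → x ∈ remove c X → c ≢ toℕ x × x ∈ X
            drop c X {x} x∈ with c ≡ᵇ toℕ x in eq | trans (sym (lookup∘tabulate (λ i → if c ≡ᵇ toℕ i then false else lookup X i) x)) ([]=⇒lookup x∈)
            ... | true  | ()
            ... | false | h = (λ { refl → case-false (trans (sym (≡ᵇ-refl (toℕ x))) eq) }) , lookup⇒[]= x X h
              where
              case-false : true ≢ false
              case-false ()
            shrink : ∀ j (X : Subset n) {x} → x ∈ countdown j remove X → x ∈ X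
            shrink zero    X x∈ = x∈
            shrink (suc j) X x∈ = proj₂ (drop j X (shrink j (remove j X) x∈))
            removed : ∀ j (X : Subset n) {x} → toℕ x ℕ.< j → x ∉ countdown j remove X
            removed (suc j) X {x} (s≤s x≤j) x∈ with toℕ x ℕ.≟ j
            ... | yes x≡j  = proj₁ (drop j X (shrink j (remove j X) x∈)) (sym x≡j)
            ... | no  x≢j  = removed j (remove j X) (ℕₚ.≤∧≢⇒< x≤j x≢j) x∈

          clear-ok : ∀ j Y → j ℕ.< n → Triple (Inv (suc j) Y)
            (instr (sub 6 6 0) ⨾ block (const 8 20) (add 8 8 6 ∷ const 9 0 ∷ store 8 9 ∷ [])) 5 (Inv j (remove j Y))
          clear-ok j Y _ =
            straight {Q = Inv j Y} (sub 6 6 0) [] (λ _ → refl) (λ st h → count-6 h) then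
            straight (const 8 20) (add 8 8 6 ∷ const 9 0 ∷ store 8 9 ∷ []) (λ _ → refl)
              (λ st h → at (consts h) (outer h)
                (write-zero (M st) (M (outcome (const 8 20) (add 8 8 6 ∷ const 9 0 ∷ store 8 9 ∷ []) st)) (M st 6) (M6≡ h) (λ _ → refl) (set h)))

          fill-ok : ∀ j Y → j ℕ.< s → Triple (Inv (suc j) Y)
            (instr (sub 6 6 0) ⨾ block (add 8 5 6) (read 7 8 ∷ const 8 20 ∷ add 8 8 7 ∷ store 8 0 ∷ [])) 6 (Inv j (insert (message j) Y))
          fill-ok j Y _ =
            straight {Q = Inv j Y} (sub 6 6 0) [] (λ _ → refl) (λ st h → count-6 h) then
            straight (add 8 5 6) (read 7 8 ∷ const 8 20 ∷ add 8 8 7 ∷ store 8 0 ∷ []) (λ _ → refl)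
              (λ st h → at (consts h) (outer h)
                (write-one (M st) (M (outcome (add 8 5 6) (read 7 8 ∷ const 8 20 ∷ add 8 8 7 ∷ store 8 0 ∷ []) st)) (input ‼ (M st 5 ℕ.+ M st 6))
                  (cong₂ (λ u v → input ‼ (u ℕ.+ v)) (M5≡ h) (M6≡ h)) (M0≡1 h) (λ _ → refl) (set h)))

          grow-ok : ∀ j Y → j ℕ.< κ ∸ s → Triple (Inv′ (suc j) Y) (instr (sub 12 12 0) ⨾ growth) (1 ℕ.+ growth-time) (Inv′ j (grow Y))
          grow-ok j Y _ =
            straight {Q = Inv′ j Y} (sub 12 12 0) [] (λ _ → refl) (λ st h → count-12 h) then
            post proj₁ (growth-ok Y 0 (j , s , o) all⊆D candidates)

        search-time : ℕ
        search-time = (κ ∸ (κ ∸ len) ℕ.+ 1) ℕ.* suc (1 ℕ.+ (rebuild-time ℕ.+ (1 ℕ.+ (1 ℕ.+ (1 ℕ.+ 5))))) ℕ.+ 1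

        bob-time : ℕ
        bob-time = 12 ℕ.+ (3 ℕ.+ (search-time ℕ.+ (2 ℕ.+ (rebuild-time ℕ.+ (2 ℕ.+ (n ℕ.* 7 ℕ.+ 1))))))

        Emitted : Subset n → ℕ → List (Fin n) → Set
        Emitted X j out = (∀ x → x ∈ ⋃ (map ⁅_⁆ out) → x ∈ X) × (∀ x → x ∈ X → j ℕ.≤ toℕ x → x ∈ ⋃ (map ⁅_⁆ out))

        ∈⋃-snoc⁺ : ∀ out {e x : Fin n} → x ∈ ⋃ (map ⁅_⁆ out) ⊎ x ≡ e → x ∈ ⋃ (map ⁅_⁆ (out ++ [ e ]))
        ∈⋃-snoc⁺ []        {e} (inj₁ x∈) = ⊥-elim (∉⊥ x∈)
        ∈⋃-snoc⁺ []        {e} (inj₂ refl) = p⊆p∪q ∅ (x∈⁅x⁆ e)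
        ∈⋃-snoc⁺ (d ∷ out) (inj₁ x∈) with x∈p∪q⁻ ⁅ d ⁆ _ x∈
        ... | inj₁ x∈d = p⊆p∪q _ x∈d
        ... | inj₂ x∈o = q⊆p∪q ⁅ d ⁆ _ (∈⋃-snoc⁺ out (inj₁ x∈o))
        ∈⋃-snoc⁺ (d ∷ out) (inj₂ eq) = q⊆p∪q ⁅ d ⁆ _ (∈⋃-snoc⁺ out (inj₂ eq))

        ∈⋃-snoc⁻ : ∀ out {e x : Fin n} → x ∈ ⋃ (map ⁅_⁆ (out ++ [ e ])) → x ∈ ⋃ (map ⁅_⁆ out) ⊎ x ≡ e
        ∈⋃-snoc⁻ []        {e} x∈ with x∈p∪q⁻ ⁅ e ⁆ ∅ x∈
        ... | inj₁ x∈e = inj₂ (x∈⁅y⁆⇒x≡y e x∈e)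
        ... | inj₂ x∈∅ = ⊥-elim (∉⊥ x∈∅)
        ∈⋃-snoc⁻ (d ∷ out) x∈ with x∈p∪q⁻ ⁅ d ⁆ _ x∈
        ... | inj₁ x∈d = inj₁ (p⊆p∪q _ x∈d)
        ... | inj₂ x∈o with ∈⋃-snoc⁻ out x∈o
        ... | inj₁ h = inj₁ (q⊆p∪q ⁅ d ⁆ _ h)
        ... | inj₂ h = inj₂ h

        bob-ok : input ‼ 0 ≡ n → input ‼ 1 ≡ k → ∀ cs →
          Triple (_≡ initial cs) bob bob-time (λ s → attempt chosen ≡ ⋃ (map ⁅_⁆ (output s)))
        bob-ok n≡ k≡ cs =
          setup-ok n≡ k≡ cs then
          straight {Q = Searching (κ ∸ (κ ∸ len) ℕ.+ 1) (0 , 0#)} (sub 14 2 3) (sub 14 2 14 ∷ add 14 14 0 ∷ []) (λ _ → refl)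
            (λ s h → z≤n , ∅ , at (consts h)
              (cong₂ (λ u t → proj₁ t , proj₁ (proj₂ t) , u , proj₂ (proj₂ (proj₂ t)))
                (cong₂ ℕ._+_ (cong₂ (λ u v → u ∸ (u ∸ v)) (M2≡κ h) (M3≡len h)) (M0≡1 h)) (outer h)) (set h)) then
          for-loop 14 Searching improve (κ ∸ (κ ∸ len) ℕ.+ 1) (λ { (_ , _ , h) → M14≡ h }) improve-ok (0 , 0#) then
          finish-ok (countdown (κ ∸ (κ ∸ len) ℕ.+ 1) improve (0 , 0#))
          where
          -- The array may hold any set between two attempts, since `rebuild` clears it.
          Searching : ℕ → ℕ × Carrier → State n → Set c
          Searching j (s′ , v) s = s′ ℕ.≤ κ × ∃ λ X → At X (0 , 0 , j , s′ , v , []) s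

          improve-ok : ∀ j y → j ℕ.< κ ∸ (κ ∸ len) ℕ.+ 1 → Triple (Searching (suc j) y)
            (instr (sub 14 14 0) ⨾ rebuild ⨾ instr (const 10 20) ⨾ instr (query 2 10) ⨾ instr (leq 10 3 2)
              ⨾ ifnz 10 (block (const 10 2) (rload 3 10 ∷ const 15 0 ∷ add 15 15 14 ∷ [])) skip)
            (1 ℕ.+ (rebuild-time ℕ.+ (1 ℕ.+ (1 ℕ.+ (1 ℕ.+ 5))))) (Searching j (improve j y))
          improve-ok j (s′ , v) j< st (s′≤κ , X , h) =
            (straight {P = At X (0 , 0 , suc j , s′ , v , [])} (sub 14 14 0) [] (λ _ → refl) (λ s h → count-14 h) then
             rebuild-ok X 0 0 j (s′ , v , []) j≤κ then
             straight {Q = λ s → Built s × M s 10 ≡ 20} (const 10 20) [] (λ _ → refl)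
               (λ s h → at (consts h) (outer h) (set h) , refl) then
             query-ok 2 10 {Q = λ s → Built s × R s 2 ≡ f (attempt j)} (λ _ _ → all⊆D)
               (λ { s (h , eq) → at (consts h) (outer h) (set h) , cong f (trans (cong (querySet (M s)) eq) (set h)) }) then
             straight {Q = Compared} (leq 10 3 2) [] (λ _ → refl)
               (λ { s (h , eq) → at (consts h) (outer h) (set h) , eq
                  , cong₂ (λ x y → bit (does (x ≤? y))) (cong (λ t → proj₁ (proj₂ (proj₂ (proj₂ (proj₂ t))))) (outer h)) eq }) then
             branch 10
               (straight (const 10 2) (rload 3 10 ∷ const 15 0 ∷ add 15 15 14 ∷ []) (λ _ → refl)
                 (λ { s ((h , eq , flag) , nz) → subst (λ b → Searching j (if b then (j , f (attempt j)) else (s′ , v)) _)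
                        (sym (bit-true _ (λ z → nz (trans flag z))))
                        (j≤κ , attempt j , at (consts h)
                          (cong₂ (λ t r → proj₁ t , proj₁ (proj₂ t) , proj₁ (proj₂ (proj₂ t)) , proj₁ (proj₂ (proj₂ t)) , r , proj₂ (proj₂ (proj₂ (proj₂ (proj₂ t)))))
                            (outer h) eq) (set h)) }))
               (weaken (s≤s z≤n) (straight (const 10 0) [] (λ _ → refl)
                 (λ { s ((h , eq , flag) , z) → subst (λ b → Searching j (if b then (j , f (attempt j)) else (s′ , v)) _)
                        (sym (bit-false _ (trans (sym flag) z)))
                        (s′≤κ , attempt j , at (consts h) (outer h) (set h)) })))) st h
            where
            j≤κ : j ℕ.≤ κ
            j≤κ = ℕₚ.≤-trans (ℕₚ.≤-pred (ℕₚ.≤-trans j< (ℕₚ.≤-reflexive (ℕₚ.+-comm _ 1)))) (ℕₚ.m∸n≤m κ (κ ∸ len))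
            Built Compared : State n → Set c
            Built = At (attempt j) (0 , 0 , j , s′ , v , [])
            Compared s = Built s × R s 2 ≡ f (attempt j) × M s 10 ≡ bit (does (v ≤? f (attempt j)))

          finish-ok : ∀ y → Triple (Searching 0 y)
            (copy 14 15 ⨾ rebuild ⨾ copy 6 1 ⨾ for 6 (block (const 8 20) (add 8 8 6 ∷ load 10 8 ∷ []) ⨾ ifnz 10 (instr (emit 6)) skip))
            (2 ℕ.+ (rebuild-time ℕ.+ (2 ℕ.+ (n ℕ.* 7 ℕ.+ 1)))) (λ s → attempt (proj₁ y) ≡ ⋃ (map ⁅_⁆ (output s)))
          finish-ok (s′ , v) st (s′≤κ , X , h) =
            (straight {P = At X (0 , 0 , 0 , s′ , v , [])} {Q = At X (0 , 0 , s′ , s′ , v , [])} (const 14 0) (add 14 14 15 ∷ []) (λ _ → refl)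
              (λ s h → at (consts h)
                (cong (λ t → proj₁ t , proj₁ (proj₂ t) , proj₁ (proj₂ (proj₂ (proj₂ t))) , proj₂ (proj₂ (proj₂ t))) (outer h)) (set h)) then
             rebuild-ok X 0 0 s′ (s′ , v , []) s′≤κ then
             straight {Q = Inv n tt} (const 6 0) (add 6 6 1 ∷ []) (λ _ → refl)
               (λ s h → [] , at (consts h) (set-6 h (M1≡n h)) (set h) , (λ x x∈ → ⊥-elim (∉⊥ x∈))
                 , (λ x _ n≤x → ⊥-elim (ℕₚ.<⇒≱ (toℕ<n x) n≤x))) then
             post (λ { (out , h , sound , complete) → ⊆-antisym
                        (λ {x} x∈ → subst (λ o → x ∈ ⋃ (map ⁅_⁆ o)) (sym (out≡ h)) (complete x x∈ z≤n))
                        (λ {x} x∈ → sound x (subst (λ o → x ∈ ⋃ (map ⁅_⁆ o)) (out≡ h) x∈)) })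
               (for-loop 6 Inv (λ _ y → y) n (λ { (_ , h , _) → M6≡ h }) emit-element tt)) st h
            where
            Y = attempt s′
            out≡ : ∀ {X i g s s′ v out st} → At X (i , g , s , s′ , v , out) st → output st ≡ out
            out≡ h = cong (λ t → proj₂ (proj₂ (proj₂ (proj₂ (proj₂ t))))) (outer h)
            Inv : ℕ → Unit → State n → Set c
            Inv j _ s = ∃ λ out → At Y (j , 0 , s′ , s′ , v , out) s × Emitted Y j out
            emit-element : ∀ j y → j ℕ.< n → Triple (Inv (suc j) y)
              (instr (sub 6 6 0) ⨾ block (const 8 20) (add 8 8 6 ∷ load 10 8 ∷ []) ⨾ ifnz 10 (instr (emit 6)) skip) 6 (Inv j y)
            emit-element j _ j<n st (out , h , sound , complete) =
              (straight {P = At Y (suc j , o)} {Q = At Y (j , o)} (sub 6 6 0) [] (λ _ → refl) (λ s h → count-6 h) then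
               straight {Q = λ s → At Y (j , o) s × not (M s 10 ≡ᵇ 0) ≡ lookup Y e} (const 8 20) (add 8 8 6 ∷ load 10 8 ∷ []) (λ _ → refl)
                 (λ s h → at (consts h) (outer h) (set h)
                   , trans (cong (λ z → not (M s (20 ℕ.+ z) ≡ᵇ 0)) (trans (M6≡ h) (sym (toℕ-fromℕ< j<n)))) (lookup-querySet (M s) (set h) e)) then
               branch 10
                 (emit-ok 6 (λ _ → e) (λ { s ((h , _) , _) → trans (M6≡ h) (sym (toℕ-fromℕ< j<n)) })
                   (λ { s ((h , eq) , nz) → out ++ [ e ] , emit-at e h
                      , (λ x x∈ → [ sound x , (λ { refl → lookup⇒[]= e Y (trans (sym eq) (nonzero (M s 10) nz)) }) ]′ (∈⋃-snoc⁻ out x∈))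
                      , (λ x x∈ j≤x → ∈⋃-snoc⁺ out (split x x∈ j≤x)) }))
                 (straight (const 10 0) [] (λ _ → refl)
                   (λ { s ((h , eq) , z) → out , at (consts h) (outer h) (set h) , sound
                      , (λ x x∈ j≤x → [ (λ h → h) , (λ { refl → ⊥-elim (absent s eq z x∈) }) ]′ (split x x∈ j≤x)) }))) st h
              where
              o = 0 , s′ , s′ , v , out
              e = fromℕ< j<n
              nonzero : ∀ m → m ≢ 0 → not (m ≡ᵇ 0) ≡ true
              nonzero zero    nz = ⊥-elim (nz refl)
              nonzero (suc m) _  = refl
              split : ∀ x → x ∈ Y → j ℕ.≤ toℕ x → x ∈ ⋃ (map ⁅_⁆ out) ⊎ x ≡ e
              split x x∈ j≤x with j ℕ.≟ toℕ x
              ... | yes refl = inj₂ (toℕ-injective (sym (toℕ-fromℕ< j<n)))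
              ... | no  j≢x  = inj₁ (complete x x∈ (ℕₚ.≤∧≢⇒< j≤x j≢x))
              absent : ∀ s → not (M s 10 ≡ᵇ 0) ≡ lookup Y e → M s 10 ≡ 0 → e ∉ Y
              absent s eq z e∈ with trans (sym (cong (λ m → not (m ≡ᵇ 0)) z)) (trans eq ([]=⇒lookup e∈))
              ... | ()

-- Iteration, commuting insertions and positions in the input.

module _ {a} {A : Set a} where

  repeat : (A → A) → A → ℕ → A
  repeat g x zero    = x
  repeat g x (suc j) = g (repeat g x j)

  -- A countdown performs its highest index first, whereas the recursion for the greedy prefixes
  -- needs it last. Insertions commute, so the order does not matter.
  countdown-commute : ∀ (g : ℕ → A → A) (h : A → A) → (∀ j x → g j (h x) ≡ h (g j x)) →
                      ∀ j x → countdown j g (h x) ≡ h (countdown j g x)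
  countdown-commute g h comm zero    x = refl
  countdown-commute g h comm (suc j) x = trans (cong (countdown j g) (comm j x)) (countdown-commute g h comm j (g j x))

  countdown-repeat : ∀ (g : A → A) x j → countdown j (λ _ → g) x ≡ repeat g x j
  countdown-repeat g x zero    = refl
  countdown-repeat g x (suc j) = trans (countdown-commute (λ _ → g) g (λ _ _ → refl) j x) (cong g (countdown-repeat g x j))

  countdown-invariant : ∀ {p} (P : ℕ → A → Set p) (g : ℕ → A → A) N → (∀ j y → j ℕ.< N → P (suc j) y → P j (g j y)) →
                        ∀ {x} → P N x → P 0 (countdown N g x)
  countdown-invariant P g zero    h px = px
  countdown-invariant P g (suc N) h px =
    countdown-invariant P g N (λ j y j<N → h j y (ℕₚ.m<n⇒m<1+n j<N)) (h N _ ℕₚ.≤-refl px)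

insert-comm : ∀ {n} c d (X : Subset n) → insert c (insert d X) ≡ insert d (insert c X)
insert-comm c d X = ⊆-antisym (half c d) (half d c)
  where
  half : ∀ c d → insert c (insert d X) ⊆ insert d (insert c X)
  half c d = insert-⊆ c (λ x eq → ⊆-insert d _ (subst (λ e → x ∈ insert e X) eq (∈-insertˡ x X))) (insert-mono d (⊆-insert c X))

‼-bits-++ : ∀ {n} (V : Subset n) ys i → (bits V ++ ys) ‼ (n ℕ.+ i) ≡ ys ‼ i
‼-bits-++ Vec.[]      ys i = refl
‼-bits-++ (_ Vec.∷ V) ys i = ‼-bits-++ V ys i

‼-bits : ∀ {n} (V : Subset n) ys x → (bits V ++ ys) ‼ toℕ x ≡ bit (lookup V x)
‼-bits (_ Vec.∷ V) ys zero    = refl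
‼-bits (_ Vec.∷ V) ys (suc x) = ‼-bits V ys x

‼-map-toℕ : ∀ {n p} {P : Fin n → Set p} m → All P m → ∀ j → j ℕ.< length m → ∃ λ x → P x × map toℕ m ‼ j ≡ toℕ x
‼-map-toℕ (x ∷ m) (px ∷ pm) zero    _         = x , px , refl
‼-map-toℕ (x ∷ m) (px ∷ pm) (suc j) (s≤s j<m) = ‼-map-toℕ m pm j j<m

‼-snoc : ∀ {n} (m : List (Fin n)) e i → i ℕ.< length m → map toℕ (m ++ [ e ]) ‼ i ≡ map toℕ m ‼ i
‼-snoc (x ∷ m) e zero    _         = refl
‼-snoc (x ∷ m) e (suc i) (s≤s i<m) = ‼-snoc m e i i<m

‼-last : ∀ {n} (m : List (Fin n)) e → map toℕ (m ++ [ e ]) ‼ length m ≡ toℕ e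
‼-last []      e = refl
‼-last (x ∷ m) e = ‼-last m e

m∸[m∸n]≤n : ∀ m n → m ∸ (m ∸ n) ℕ.≤ n
m∸[m∸n]≤n m n with ℕₚ.≤-total m n
... | inj₁ m≤n = ℕₚ.≤-trans (ℕₚ.m∸n≤m m (m ∸ n)) m≤n
... | inj₂ n≤m = ℕₚ.≤-reflexive (ℕₚ.m∸[m∸n]≡n n≤m)

≤m∸[m∸n] : ∀ {l} m n → l ℕ.≤ m → l ℕ.≤ n → l ℕ.≤ m ∸ (m ∸ n)
≤m∸[m∸n] m n l≤m l≤n with ℕₚ.≤-total m n
... | inj₁ m≤n rewrite ℕₚ.m≤n⇒m∸n≡0 m≤n = l≤m
... | inj₂ n≤m rewrite ℕₚ.m∸[m∸n]≡n n≤m = l≤n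

-- The computed sets are greedy, and the best start is found.

module Correctness {c ℓ₁ ℓ₂} (ℝ : RealField c ℓ₁ ℓ₂) where
  open RealField ℝ
  open OrderedField ℝ
  open Semantics ℝ
  open Verification ℝ

  -- The communication bound concerns every message that some run of Alice can produce; determinism
  -- identifies it with the specified one.
  run-deterministic : ∀ {n} {f : Subset n → Carrier} {D input p s t u s′ s″} →
    Run f D input p s t s′ → Run f D input p s u s″ → s′ ≡ s″
  run-deterministic (instr h)     (instr h′)      = just-injective (trans (sym h) h′)
  run-deterministic (seq a b)     (seq a′ b′)     with run-deterministic a a′
  ... | refl = run-deterministic b b′
  run-deterministic (if-then _ a) (if-then _ a′)  = run-deterministic a a′
  run-deterministic (if-then h _) (if-else h′ _)  = ⊥-elim (h h′)
  run-deterministic (if-else h _) (if-then h′ _)  = ⊥-elim (h′ h)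
  run-deterministic (if-else _ a) (if-else _ a′)  = run-deterministic a a′
  run-deterministic (stop _)      (stop _)        = refl
  run-deterministic (stop h)      (loop h′ _ _)   = ⊥-elim (h′ h)
  run-deterministic (loop h _ _)  (stop h′)       = ⊥-elim (h h′)
  run-deterministic (loop _ a b)  (loop _ a′ b′)  with run-deterministic a a′
  ... | refl = run-deterministic b b′

  module Choice {n : ℕ} (f : Subset n → Carrier) (nonNeg : ∀ S → 0# ≤ f S)
    (monotone : ∀ {S T} → S ⊆ T → f S ≤ f T) (k : ℕ) (input : List ℕ) where
    open Pure f k input

    Candidate : ℕ → Set
    Candidate e = (e ℕ.< n × member e ≢ 0) ⊎ (∃ λ j → j ℕ.< len × e ≡ message j)

    -- `attained` is only an inequality, since the initial value `0#` belongs to no candidate.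
    -- `status` tells whether a candidate has replaced the initial accumulator; `found` guarantees
    -- this as soon as one has been seen.
    record Good (X : Subset n) (Seen : ℕ → Set) (acc : ℕ × Carrier) : Set (c ⊔ ℓ₂) where
      constructor good
      field
        attained : proj₂ acc ≤ f (insert (proj₁ acc) X)
        maximal  : ∀ e → Seen e → f (insert e X) ≤ proj₂ acc
        found    : ∀ e → Seen e → Candidate (proj₁ acc)
        status   : acc ≡ (n , 0#) ⊎ Candidate (proj₁ acc)

    better-good : ∀ X {Seen acc} e → Candidate e → Good X Seen acc → Good X (λ x → Seen x ⊎ x ≡ e) (better X e acc)
    better-good X {Seen} {d , v} e cand (good attained maximal found status) with v ≤? f (insert e X)
    ... | yes v≤ = good ≤-refl
            (λ { x (inj₁ seen) → ≤-trans (maximal x seen) v≤ ; x (inj₂ refl) → ≤-refl }) (λ _ _ → cand) (inj₂ cand)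
    ... | no  v≰ = good attained
            (λ { x (inj₁ seen) → maximal x seen ; x (inj₂ refl) → [ (λ h → h) , (λ v≤ → ⊥-elim (v≰ v≤)) ]′ (total _ _) })
            (λ _ _ → replaced status) (inj₂ (replaced status))
      where
      replaced : (d , v) ≡ (n , 0#) ⊎ Candidate d → Candidate d
      -- Ties replace the accumulator and `f` is non-negative, so the initial pair loses against any
      -- candidate, even one of value 0.
      replaced (inj₁ refl) = ⊥-elim (v≰ (nonNeg _))
      replaced (inj₂ cand) = cand

    weaken-good : ∀ {X Seen Seen′ acc} → (∀ e → Seen′ e → Seen e) → Good X Seen acc → Good X Seen′ acc
    weaken-good h (good a m fd st) = good a (λ e s → m e (h e s)) (λ e s → fd e (h e s)) st

    best-good : ∀ X → Good X Candidate (best X)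
    best-good X = weaken-good final
      (countdown-invariant (λ j → Good X (Seen₂ j)) (λ j → better X (message j)) len
        (λ j acc j<len g → weaken-good (λ e → last₂ j e) (better-good X (message j) (inj₂ (j , j<len , refl)) g))
        (weaken-good none₂
          (countdown-invariant (λ j → Good X (Seen₁ j)) (tryMember X) n step₁
            (good (nonNeg _) (λ { e (n≤e , e<n , _) → ⊥-elim (ℕₚ.<⇒≱ e<n n≤e) })
              (λ { e (n≤e , e<n , _) → ⊥-elim (ℕₚ.<⇒≱ e<n n≤e) }) (inj₁ refl)))))
      where
      Seen₁ Seen₂ : ℕ → ℕ → Set
      Seen₁ j e = j ℕ.≤ e × e ℕ.< n × member e ≢ 0
      Seen₂ j e = Seen₁ 0 e ⊎ (∃ λ i → j ℕ.≤ i × i ℕ.< len × e ≡ message i)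
      final : ∀ e → Candidate e → Seen₂ 0 e
      final e (inj₁ (e<n , nz)) = inj₁ (z≤n , e<n , nz)
      final e (inj₂ (j , j<len , eq)) = inj₂ (j , z≤n , j<len , eq)
      none₂ : ∀ e → Seen₂ len e → Seen₁ 0 e
      none₂ e (inj₁ h) = h
      none₂ e (inj₂ (i , len≤i , i<len , _)) = ⊥-elim (ℕₚ.<⇒≱ i<len len≤i)
      last₂ : ∀ j e → Seen₂ j e → Seen₂ (suc j) e ⊎ e ≡ message j
      last₂ j e (inj₁ h) = inj₁ (inj₁ h)
      last₂ j e (inj₂ (i , j≤i , i<len , eq)) with j ℕ.≟ i
      ... | yes refl = inj₂ eq
      ... | no  j≢i  = inj₁ (inj₂ (i , ℕₚ.≤∧≢⇒< j≤i j≢i , i<len , eq))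
      last₁ : ∀ j e → Seen₁ j e → Seen₁ (suc j) e ⊎ e ≡ j
      last₁ j e (j≤e , e<n , nz) with j ℕ.≟ e
      ... | yes refl = inj₂ refl
      ... | no  j≢e  = inj₁ (ℕₚ.≤∧≢⇒< j≤e j≢e , e<n , nz)
      step₁ : ∀ j acc → j ℕ.< n → Good X (Seen₁ (suc j)) acc → Good X (Seen₁ j) (tryMember X j acc)
      step₁ j acc j<n g with member j in eq
      ... | zero  = weaken-good (λ e h → [ (λ h → h) , (λ { refl → ⊥-elim (proj₂ (proj₂ h) eq) }) ]′ (last₁ j e h)) g
      ... | suc _ = weaken-good (last₁ j) (better-good X j (inj₁ (j<n , λ z → ℕₚ.1+n≢0 (trans (sym eq) z))) g)

    grow-best : ∀ X e → Candidate e → f (insert e X) ≤ f (grow X)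
    grow-best X e cand = ≤-trans (Good.maximal (best-good X) e cand) (Good.attained (best-good X))

    pick-candidate : ∀ X {e} → Candidate e → Candidate (pick X)
    pick-candidate X cand = Good.found (best-good X) _ cand

    pick-status : ∀ X → pick X ≡ n ⊎ Candidate (pick X)
    pick-status X = [ (λ eq → inj₁ (cong proj₁ eq)) , inj₂ ]′ (Good.status (best-good X))

    grow-⊆ : ∀ {X Y : Subset n} → (∀ x → Candidate (toℕ x) → x ∈ Y) → X ⊆ Y → grow X ⊆ Y
    grow-⊆ {X} {Y} cand⊆Y X⊆Y = insert-⊆ (pick X) picked X⊆Y
      where
      picked : ∀ x → toℕ x ≡ pick X → x ∈ Y
      picked x eq with pick-status X
      ... | inj₁ p≡n  = ⊥-elim (ℕₚ.<⇒≢ (toℕ<n x) (trans eq p≡n))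
      ... | inj₂ cand = cand⊆Y x (subst Candidate (sym eq) cand)

    prefix-suc : ∀ j → prefix (suc j) ≡ insert (message j) (prefix j)
    prefix-suc j = countdown-commute (λ j → insert (message j)) (insert (message j))
      (λ i X → insert-comm (message i) (message j) X) j ∅

    ∈-prefix : ∀ s {x} → x ∈ prefix s → ∃ λ j → j ℕ.< s × toℕ x ≡ message j
    ∈-prefix zero    x∈ = ⊥-elim (∉⊥ x∈)
    ∈-prefix (suc s) {x} x∈ with ∈-insert⁻ (message s) (prefix s) (subst (x ∈_) (prefix-suc s) x∈)
    ... | inj₁ eq = s , ℕₚ.≤-refl , sym eq
    ... | inj₂ x∈s = let j , j<s , eq = ∈-prefix s x∈s in j , ℕₚ.m<n⇒m<1+n j<s , eq

    ∣prefix∣≤ : ∀ s → ∣ prefix s ∣ ℕ.≤ s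
    ∣prefix∣≤ zero    = ℕₚ.≤-reflexive (∣⊥∣≡0 n)
    ∣prefix∣≤ (suc s) = subst (λ X → ∣ X ∣ ℕ.≤ suc s) (sym (prefix-suc s))
      (ℕₚ.≤-trans (∣insert∣≤ (message s) (prefix s)) (s≤s (∣prefix∣≤ s)))

    extend : ℕ → ℕ → Subset n
    extend s j = repeat grow (prefix s) j

    extend-increasing : ∀ s j → extend s j ⊆ extend s (suc j)
    extend-increasing s j = ⊆-insert (pick (extend s j)) (extend s j)

    attempt≡extend : ∀ s → attempt s ≡ extend s (κ ∸ s)
    attempt≡extend s = countdown-repeat grow (prefix s) (κ ∸ s)

    extend-⊆ : ∀ {Y : Subset n} s → prefix s ⊆ Y → (∀ x → Candidate (toℕ x) → x ∈ Y) → ∀ j → extend s j ⊆ Y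
    extend-⊆ s prefix⊆Y cand⊆Y zero    = prefix⊆Y
    extend-⊆ s prefix⊆Y cand⊆Y (suc j) = grow-⊆ cand⊆Y (extend-⊆ s prefix⊆Y cand⊆Y j)

    ∣extend∣≤ : ∀ s j → ∣ extend s j ∣ ℕ.≤ j ℕ.+ s
    ∣extend∣≤ s zero    = ∣prefix∣≤ s
    ∣extend∣≤ s (suc j) = ℕₚ.≤-trans (∣insert∣≤ (pick (extend s j)) (extend s j)) (s≤s (∣extend∣≤ s j))

    most : ℕ
    most = κ ∸ (κ ∸ len)

    private
      Best : ℕ → ℕ × Carrier → Set ℓ₂
      Best j (s′ , v) = s′ ℕ.≤ most × v ≤ f (attempt s′) × (∀ s → j ℕ.≤ s → s ℕ.≤ most → f (attempt s) ≤ v)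

      improve-best : ∀ j y → j ℕ.< most ℕ.+ 1 → Best (suc j) y → Best j (improve j y)
      improve-best j (s′ , v) j< (s′≤ , attained , maximal) with v ≤? f (attempt j)
      ... | yes v≤ = ℕₚ.≤-pred (ℕₚ.≤-trans j< (ℕₚ.≤-reflexive (ℕₚ.+-comm most 1))) , ≤-refl , maximal′
        where
        maximal′ : ∀ s → j ℕ.≤ s → s ℕ.≤ most → f (attempt s) ≤ f (attempt j)
        maximal′ s j≤s s≤ with j ℕ.≟ s
        ... | yes refl = ≤-refl
        ... | no  j≢s  = ≤-trans (maximal s (ℕₚ.≤∧≢⇒< j≤s j≢s) s≤) v≤
      ... | no v≰ = s′≤ , attained , maximal′
        where
        maximal′ : ∀ s → j ℕ.≤ s → s ℕ.≤ most → f (attempt s) ≤ v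
        maximal′ s j≤s s≤ with j ℕ.≟ s
        ... | yes refl = [ (λ h → h) , (λ v≤ → ⊥-elim (v≰ v≤)) ]′ (total _ _)
        ... | no  j≢s  = maximal s (ℕₚ.≤∧≢⇒< j≤s j≢s) s≤

      searched : Best 0 (countdown (most ℕ.+ 1) improve (0 , 0#))
      searched = countdown-invariant Best improve (most ℕ.+ 1) improve-best
        (z≤n , nonNeg _ , λ s 1+most≤s s≤most → ⊥-elim (ℕₚ.<⇒≱ (ℕₚ.≤-trans (ℕₚ.≤-reflexive (ℕₚ.+-comm 1 most)) 1+most≤s) s≤most))

    chosen≤most : chosen ℕ.≤ most
    chosen≤most = proj₁ searched

    chosen-best : ∀ s → s ℕ.≤ most → f (attempt s) ≤ f (attempt chosen)
    chosen-best s s≤ = ≤-trans (proj₂ (proj₂ searched) s z≤n s≤) (proj₁ (proj₂ searched))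

    rounds : ℕ → Subset n × List (Fin n)
    rounds = repeat (send 0) (∅ , [])

    sent≡rounds : sent ≡ proj₂ (rounds (κ ℕ.+ κ))
    sent≡rounds = cong proj₂ (countdown-repeat (send 0) (∅ , []) (κ ℕ.+ κ))

    length-toElement : ∀ d → length (toElement d) ℕ.≤ 1
    length-toElement d with d <? n
    ... | yes _ = ℕₚ.≤-refl
    ... | no  _ = z≤n

    length-rounds : ∀ j → length (proj₂ (rounds j)) ℕ.≤ j
    length-rounds zero    = z≤n
    length-rounds (suc j) = ℕₚ.≤-trans (ℕₚ.≤-reflexive (length-++ (proj₂ (rounds j))))
      (ℕₚ.≤-trans (ℕₚ.+-mono-≤ (length-rounds j) (length-toElement (pick (proj₁ (rounds j))))) (ℕₚ.≤-reflexive (ℕₚ.+-comm j 1)))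

    sent-length : length sent ℕ.≤ κ ℕ.+ κ
    sent-length = subst (λ m → length m ℕ.≤ κ ℕ.+ κ) (sym sent≡rounds) (length-rounds (κ ℕ.+ κ))

    rounds-candidates : ∀ j → All (λ x → Candidate (toℕ x)) (proj₂ (rounds j))
    rounds-candidates zero    = []
    rounds-candidates (suc j) = Allₚ.++⁺ (rounds-candidates j) (element (pick X) (pick-status X))
      where
      X = proj₁ (rounds j)
      element : ∀ d → d ≡ n ⊎ Candidate d → All (λ x → Candidate (toℕ x)) (toElement d)
      element d status with d <? n
      ... | no  _   = []
      ... | yes d<n with status
      ... | inj₁ refl = ⊥-elim (ℕₚ.<-irrefl refl d<n)
      ... | inj₂ cand = subst Candidate (sym (toℕ-fromℕ< d<n)) cand ∷ []

    sent-candidates : All (λ x → Candidate (toℕ x)) sent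
    sent-candidates = subst (All _) (sym sent≡rounds) (rounds-candidates (κ ℕ.+ κ))

    module _ (below : ∀ {e} → Candidate e → e ℕ.< n) {e} (cand : Candidate e) where

      private
        toElement-pick : ∀ X → ∃ λ x → toElement (pick X) ≡ [ x ] × toℕ x ≡ pick X
        toElement-pick X with pick X <? n
        ... | yes d<n = fromℕ< d<n , refl , toℕ-fromℕ< d<n
        ... | no  d≮n = ⊥-elim (d≮n (below (pick-candidate X cand)))

      -- One candidate is enough: picks may repeat elements already chosen, so every round sends
      -- exactly one element, even after Alice's set is exhausted, and positions in the message
      -- agree with rounds.
      rounds-trace : ∀ j → length (proj₂ (rounds j)) ≡ j ×
                     (∀ i → i ℕ.< j → map toℕ (proj₂ (rounds j)) ‼ i ≡ pick (proj₁ (rounds i)))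
      rounds-trace zero    = refl , λ _ ()
      rounds-trace (suc j) with rounds-trace j | toElement-pick (proj₁ (rounds j))
      ... | len≡ , trace | x , es≡ , x≡ rewrite es≡ =
        trans (length-++ out) (trans (cong (ℕ._+ 1) len≡) (ℕₚ.+-comm j 1)) , trace′
        where
        out = proj₂ (rounds j)
        trace′ : ∀ i → i ℕ.< suc j → map toℕ (out ++ [ x ]) ‼ i ≡ pick (proj₁ (rounds i))
        trace′ i i<1+j with i ℕ.≟ j
        ... | no  i≢j  = trans (‼-snoc out x i (subst (i ℕ.<_) (sym len≡) i<j)) (trace i i<j)
          where
          i<j : i ℕ.< j
          i<j = ℕₚ.≤∧≢⇒< (ℕₚ.≤-pred i<1+j) i≢j
        ... | yes refl = trans (cong (map toℕ (out ++ [ x ]) ‼_) (sym len≡)) (trans (‼-last out x) x≡)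

-- Polynomial bounds on the running times.

module _ where
  open import Data.Nat using (_+_; _*_; _≤_)

  growth-time-bound : ∀ {n l} y → n ≤ suc y → l ≤ suc y →
    6 + ((n * 20 + 1) + (2 + (l * 17 + 1))) + 3 ≤ 50 * suc y
  growth-time-bound {n} {l} y n≤ l≤ = begin
    6 + ((n * 20 + 1) + (2 + (l * 17 + 1))) + 3
      ≤⟨ ℕₚ.+-monoˡ-≤ 3 (ℕₚ.+-monoʳ-≤ 6 (ℕₚ.+-mono-≤ (ℕₚ.+-monoˡ-≤ 1 (ℕₚ.*-monoˡ-≤ 20 n≤)) (ℕₚ.+-monoʳ-≤ 2 (ℕₚ.+-monoˡ-≤ 1 (ℕₚ.*-monoˡ-≤ 17 l≤))))) ⟩
    6 + ((suc y * 20 + 1) + (2 + (suc y * 17 + 1))) + 3   ≤⟨ ℕₚ.m≤m+n _ (13 * y) ⟩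
    6 + ((suc y * 20 + 1) + (2 + (suc y * 17 + 1))) + 3 + 13 * y ≡⟨ lemma y ⟩
    50 * suc y ∎
    where
    open ℕₚ.≤-Reasoning
    lemma : ∀ y → 6 + ((suc y * 20 + 1) + (2 + (suc y * 17 + 1))) + 3 + 13 * y ≡ 50 * suc y
    lemma = solve-∀

  alice-time-bound : ∀ {κ g} y → κ ≤ suc y → g ≤ 50 * suc y →
    12 + (1 + ((κ + κ) * suc (1 + (g + 3)) + 1)) ≤ 124 * suc y ^ 2
  alice-time-bound {κ} {g} y κ≤ g≤ = begin
    12 + (1 + ((κ + κ) * suc (1 + (g + 3)) + 1))
      ≤⟨ ℕₚ.+-monoʳ-≤ 12 (ℕₚ.+-monoʳ-≤ 1 (ℕₚ.+-monoˡ-≤ 1 (ℕₚ.*-mono-≤ (ℕₚ.+-mono-≤ κ≤ κ≤) (s≤s (ℕₚ.+-monoʳ-≤ 1 (ℕₚ.+-monoˡ-≤ 3 g≤)))))) ⟩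
    12 + (1 + ((suc y + suc y) * suc (1 + (50 * suc y + 3)) + 1))   ≤⟨ ℕₚ.m≤m+n _ (38 * y + 24 * (y * y)) ⟩
    12 + (1 + ((suc y + suc y) * suc (1 + (50 * suc y + 3)) + 1)) + (38 * y + 24 * (y * y)) ≡⟨ lemma y ⟩
    124 * suc y ^ 2 ∎
    where
    open ℕₚ.≤-Reasoning
    lemma : ∀ y → 12 + (1 + ((suc y + suc y) * suc (1 + (50 * suc y + 3)) + 1)) + (38 * y + 24 * (y * y))
      ≡ 124 * (suc y * (suc y * 1))
    lemma = solve-∀

  rebuild-time-bound : ∀ {n κ g} y → n ≤ suc y → κ ≤ suc y → g ≤ 50 * suc y →
    2 + ((n * 6 + 1) + (2 + ((κ * 7 + 1) + (1 + (κ * suc (1 + g) + 1))))) ≤ 73 * suc y ^ 2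
  rebuild-time-bound {n} {κ} {g} y n≤ κ≤ g≤ = begin
    2 + ((n * 6 + 1) + (2 + ((κ * 7 + 1) + (1 + (κ * suc (1 + g) + 1)))))
      ≤⟨ ℕₚ.+-monoʳ-≤ 2 (ℕₚ.+-mono-≤ (ℕₚ.+-monoˡ-≤ 1 (ℕₚ.*-monoˡ-≤ 6 n≤)) (ℕₚ.+-monoʳ-≤ 2 (ℕₚ.+-mono-≤ (ℕₚ.+-monoˡ-≤ 1 (ℕₚ.*-monoˡ-≤ 7 κ≤))
           (ℕₚ.+-monoʳ-≤ 1 (ℕₚ.+-monoˡ-≤ 1 (ℕₚ.*-mono-≤ κ≤ (s≤s (ℕₚ.+-monoʳ-≤ 1 g≤)))))))) ⟩
    2 + ((suc y * 6 + 1) + (2 + ((suc y * 7 + 1) + (1 + (suc y * suc (1 + 50 * suc y) + 1)))))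
      ≤⟨ ℕₚ.m≤m+n _ (31 * y + 23 * (y * y)) ⟩
    2 + ((suc y * 6 + 1) + (2 + ((suc y * 7 + 1) + (1 + (suc y * suc (1 + 50 * suc y) + 1))))) + (31 * y + 23 * (y * y))
      ≡⟨ lemma y ⟩
    73 * suc y ^ 2 ∎
    where
    open ℕₚ.≤-Reasoning
    lemma : ∀ y → 2 + ((suc y * 6 + 1) + (2 + ((suc y * 7 + 1) + (1 + (suc y * suc (1 + 50 * suc y) + 1))))) + (31 * y + 23 * (y * y))
      ≡ 73 * (suc y * (suc y * 1))
    lemma = solve-∀

  bob-time-bound : ∀ {n w r} y → n ≤ suc y → w ≤ suc y → r ≤ 73 * suc y ^ 2 →
    12 + (3 + ((w + 1) * suc (1 + (r + (1 + (1 + (1 + 5))))) + 1 + (2 + (r + (2 + (n * 7 + 1))))))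
      ≤ 267 * suc y ^ 3
  bob-time-bound {n} {w} {r} y n≤ w≤ r≤ = begin
    12 + (3 + ((w + 1) * suc (1 + (r + 8)) + 1 + (2 + (r + (2 + (n * 7 + 1))))))
      ≤⟨ ℕₚ.+-monoʳ-≤ 12 (ℕₚ.+-monoʳ-≤ 3 (ℕₚ.+-mono-≤
           (ℕₚ.+-monoˡ-≤ 1 (ℕₚ.*-mono-≤ (ℕₚ.+-mono-≤ w≤ (s≤s (z≤n {y}))) (s≤s (ℕₚ.+-monoʳ-≤ 1 (ℕₚ.+-monoˡ-≤ 8 r≤)))))
           (ℕₚ.+-monoʳ-≤ 2 (ℕₚ.+-mono-≤ r≤ (ℕₚ.+-monoʳ-≤ 2 (ℕₚ.+-monoˡ-≤ 1 (ℕₚ.*-monoˡ-≤ 7 n≤))))))) ⟩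
    12 + (3 + ((suc y + suc y) * suc (1 + (R + 8)) + 1 + (2 + (R + (2 + (suc y * 7 + 1))))))
      ≤⟨ ℕₚ.m≤m+n _ (190 * y + 290 * (y * y) + 121 * (y * y * y)) ⟩
    12 + (3 + ((suc y + suc y) * suc (1 + (R + 8)) + 1 + (2 + (R + (2 + (suc y * 7 + 1))))))
      + (190 * y + 290 * (y * y) + 121 * (y * y * y)) ≡⟨ lemma y ⟩
    267 * suc y ^ 3 ∎
    where
    open ℕₚ.≤-Reasoning
    R = 73 * suc y ^ 2
    lemma : ∀ y → 12 + (3 + ((suc y + suc y) * suc (1 + (73 * (suc y * (suc y * 1)) + 8)) + 1
        + (2 + (73 * (suc y * (suc y * 1)) + (2 + (suc y * 7 + 1))))))
      + (190 * y + 290 * (y * y) + 121 * (y * y * y)) ≡ 267 * (suc y * (suc y * (suc y * 1)))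
    lemma = solve-∀

-- Reading the sets and the message from the input array.

module Layout {n : ℕ} (k : ℕ) (W V : Subset n) (rest : List ℕ) {input : List ℕ}
  (input≡ : input ≡ n ∷ k ∷ bits W ++ bits V ++ rest) where

  member≡ : ∀ x → input ‼ (2 ℕ.+ n ℕ.+ toℕ x) ≡ bit (lookup V x)
  member≡ x rewrite input≡ = trans (‼-bits-++ W _ (toℕ x)) (‼-bits V rest x)

  private
    tail≡ : ∀ i → input ‼ (2 ℕ.+ n ℕ.+ (n ℕ.+ i)) ≡ rest ‼ i
    tail≡ i rewrite input≡ = trans (‼-bits-++ W _ (n ℕ.+ i)) (‼-bits-++ V rest i)

  len≡ : input ‼ (2 ℕ.+ n ℕ.+ n) ≡ rest ‼ 0
  len≡ = trans (cong (λ i → input ‼ (2 ℕ.+ n ℕ.+ i)) (sym (ℕₚ.+-identityʳ n))) (tail≡ 0)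

  message≡ : ∀ j → input ‼ (2 ℕ.+ n ℕ.+ n ℕ.+ 1 ℕ.+ j) ≡ rest ‼ suc j
  message≡ j = trans (cong (input ‼_) (trans (ℕₚ.+-assoc (2 ℕ.+ n ℕ.+ n) 1 j) (ℕₚ.+-assoc (2 ℕ.+ n) n (suc j)))) (tail≡ (suc j))

  member⇒∈ : ∀ x → input ‼ (2 ℕ.+ n ℕ.+ toℕ x) ≢ 0 → x ∈ V
  member⇒∈ x nz with lookup V x in eq | member≡ x
  ... | true  | _ = lookup⇒[]= x V eq
  ... | false | h = ⊥-elim (nz h)

  ∈⇒member : ∀ {x} → x ∈ V → input ‼ (2 ℕ.+ n ℕ.+ toℕ x) ≢ 0
  ∈⇒member {x} x∈ z with trans (sym z) (trans (member≡ x) (cong bit ([]=⇒lookup x∈)))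
  ... | ()

-- The guarantees of the protocol on every instance.

protocol : Protocol
protocol = record { alice = alice ; bob = bob }

module Guarantees {c ℓ₁ ℓ₂} (ℝ : RealField c ℓ₁ ℓ₂) where
  open RealField ℝ
  open OrderedField ℝ
  open Semantics ℝ
  open State
  open TwoPlayer ℝ
  open Verification ℝ
  open Correctness ℝ
  open Submodular ℝ
  open Analysis ℝ

  module _ (I : Instance) where
    open Instance I

    private
      κ = k ∸ (k ∸ (n ℕ.+ 1))

      aliceLayout : aliceInput ≡ n ∷ k ∷ bits WA ++ bits VA ++ []
      aliceLayout = cong (λ v → n ∷ k ∷ bits WA ++ v) (sym (++-identityʳ (bits VA)))

    module LA = Layout k WA VA [] aliceLayout
    module PA = Pure f k aliceInput
    module CA = Choice f nonNeg monotone k aliceInput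

    1≤κ : 1 ℕ.≤ κ
    1≤κ = ≤m∸[m∸n] k (n ℕ.+ 1) k-positive (ℕₚ.m≤n+m 1 n)

    κ≤k : κ ℕ.≤ k
    κ≤k = ℕₚ.m∸n≤m k (k ∸ (n ℕ.+ 1))

    κ≤1+n : κ ℕ.≤ suc n
    κ≤1+n = ℕₚ.≤-trans (m∸[m∸n]≤n k (n ℕ.+ 1)) (ℕₚ.≤-reflexive (ℕₚ.+-comm n 1))

    alice-candidate : ∀ {e} → CA.Candidate e → e ℕ.< n × PA.member e ≢ 0
    alice-candidate (inj₁ h) = h
    alice-candidate (inj₂ (j , j<len , _)) = ⊥-elim (ℕₚ.<⇒≱ j<len (ℕₚ.≤-trans (ℕₚ.≤-reflexive LA.len≡) z≤n))

    candidate⇒VA : ∀ x → CA.Candidate (toℕ x) → x ∈ VA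
    candidate⇒VA x cand = LA.member⇒∈ x (proj₂ (alice-candidate cand))

    VA⇒candidate : ∀ {x} → x ∈ VA → CA.Candidate (toℕ x)
    VA⇒candidate {x} x∈ = inj₁ (toℕ<n x , LA.∈⇒member x∈)

    alice-run : ∀ cs → ∃ λ t → Σ (State n) λ s →
      Run f WA aliceInput alice (initial cs) t s × t ℕ.≤ alice-time f WA aliceInput k × output s ≡ PA.sent
    alice-run cs = alice-ok f WA aliceInput k refl refl
      ((λ { i i<n nz x refl → VA⊆WA (LA.member⇒∈ x nz) }) , (λ j j<len x eq → VA⊆WA (candidate⇒VA x (inj₂ (j , j<len , eq)))))
      (CA.grow-⊆ (λ x cand → VA⊆WA (candidate⇒VA x cand))) cs (initial cs) refl

    alice-fast : alice-time f WA aliceInput k ℕ.≤ poly 124 2 size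
    alice-fast = alice-time-bound size (ℕₚ.≤-trans κ≤1+n (s≤s n≤size))
      (growth-time-bound size (ℕₚ.m≤n⇒m≤1+n n≤size) (ℕₚ.≤-trans (ℕₚ.≤-reflexive LA.len≡) z≤n))
      where
      n≤size : n ℕ.≤ size
      n≤size = ℕₚ.m≤m+n n _

    sent-only : ∀ {cs t m} → AliceSends protocol I cs t m → PA.sent ≡ m
    sent-only {cs} (s , run , refl) =
      let _ , s′ , run′ , _ , out≡ = alice-run cs in trans (sym out≡) (cong output (run-deterministic run′ run))

    module Bob (m : Message I) where
      module LB = Layout k WA VB (length m ∷ map toℕ m) {bobInput m} refl
      module PB = Pure f k (bobInput m)
      module CB = Choice f nonNeg monotone k (bobInput m)

      bob-run : ∃ λ t → Σ (State n) λ s → Run f ⊤ (bobInput m) bob (initial []) t s ×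
        t ℕ.≤ bob-time f ⊤ (bobInput m) k (λ _ → ∈⊤) × PB.attempt PB.chosen ≡ ⋃ (map ⁅_⁆ (output s))
      bob-run = bob-ok f ⊤ (bobInput m) k (λ _ → ∈⊤) refl refl [] (initial []) refl

      bob-outputs : ∃ λ t → BobOutputs protocol I m t (PB.attempt PB.chosen) × t ℕ.≤ bob-time f ⊤ (bobInput m) k (λ _ → ∈⊤)
      bob-outputs = let t , s , run , t≤ , eq = bob-run in t , (output s , (s , run , refl) , eq) , t≤

      bob-fast : bob-time f ⊤ (bobInput m) k (λ _ → ∈⊤) ℕ.≤ poly 267 3 (size ℕ.+ length m)
      bob-fast = bob-time-bound y n≤y (ℕₚ.≤-trans (ℕₚ.m∸n≤m κ (κ ∸ PB.len)) κ≤y)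
        (rebuild-time-bound y n≤y κ≤y (growth-time-bound y n≤y len≤y))
        where
        y = size ℕ.+ length m
        n≤ : n ℕ.≤ y
        n≤ = ℕₚ.≤-trans (ℕₚ.m≤m+n n _) (ℕₚ.m≤m+n size (length m))
        n≤y : n ℕ.≤ suc y
        n≤y = ℕₚ.m≤n⇒m≤1+n n≤
        κ≤y : κ ℕ.≤ suc y
        κ≤y = ℕₚ.≤-trans κ≤1+n (s≤s n≤)
        len≤y : PB.len ℕ.≤ suc y
        len≤y = ℕₚ.≤-trans (ℕₚ.≤-reflexive LB.len≡) (ℕₚ.m≤n⇒m≤1+n (ℕₚ.m≤n+m (length m) size))

    open Bob PA.sent

    private
      result : Subset n
      result = PB.attempt PB.chosen

    sent⊆VA : ∀ j → j ℕ.< PB.len → ∀ x → toℕ x ≡ PB.message j → x ∈ VA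
    sent⊆VA j j<len x eq =
      let y , cand , y≡ = ‼-map-toℕ PA.sent CA.sent-candidates j (ℕₚ.≤-trans j<len (ℕₚ.≤-reflexive LB.len≡))
      in candidate⇒VA x (subst CA.Candidate (trans (sym y≡) (trans (sym (LB.message≡ j)) (sym eq))) cand)

    bob-candidate : ∀ x → CB.Candidate (toℕ x) → x ∈ VA ∪ VB
    bob-candidate x (inj₁ (_ , nz)) = q⊆p∪q VA VB (LB.member⇒∈ x nz)
    bob-candidate x (inj₂ (j , j<len , eq)) = p⊆p∪q VB (sent⊆VA j j<len x eq)

    VB⇒candidate : ∀ {x} → x ∈ VB → CB.Candidate (toℕ x)
    VB⇒candidate {x} x∈ = inj₁ (toℕ<n x , LB.∈⇒member x∈)

    result-feasible : Feasible result
    result-feasible = subst (λ S → S ⊆ VA ∪ VB × ∣ S ∣ ℕ.≤ k) (sym (CB.attempt≡extend PB.chosen))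
      ( CB.extend-⊆ PB.chosen prefix⊆ bob-candidate (κ ∸ PB.chosen)
      , ℕₚ.≤-trans (CB.∣extend∣≤ PB.chosen (κ ∸ PB.chosen)) (ℕₚ.≤-trans (ℕₚ.≤-reflexive (ℕₚ.m∸n+n≡m chosen≤κ)) κ≤k))
      where
      chosen≤κ : PB.chosen ℕ.≤ κ
      chosen≤κ = ℕₚ.≤-trans CB.chosen≤most (ℕₚ.m∸n≤m κ (κ ∸ PB.len))
      prefix⊆ : PB.prefix PB.chosen ⊆ VA ∪ VB
      prefix⊆ {x} x∈ =
        let j , j<s , eq = CB.∈-prefix PB.chosen x∈
        in p⊆p∪q VB (sent⊆VA j (ℕₚ.≤-trans j<s (ℕₚ.≤-trans CB.chosen≤most (m∸[m∸n]≤n κ PB.len))) x eq)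

    module _ {x₀} (x₀∈VA : x₀ ∈ VA) where

      private
        below : ∀ {e} → CA.Candidate e → e ℕ.< n
        below = proj₁ ∘ alice-candidate

        trace : length PA.sent ≡ κ ℕ.+ κ × (∀ i → i ℕ.< κ ℕ.+ κ → map toℕ PA.sent ‼ i ≡ PA.pick (proj₁ (CA.rounds i)))
        trace = subst (λ m → length m ≡ κ ℕ.+ κ × (∀ i → i ℕ.< κ ℕ.+ κ → map toℕ m ‼ i ≡ PA.pick (proj₁ (CA.rounds i))))
          (sym CA.sent≡rounds) (CA.rounds-trace below (VA⇒candidate x₀∈VA) (κ ℕ.+ κ))

      len≡2κ : PB.len ≡ κ ℕ.+ κ
      len≡2κ = trans LB.len≡ (proj₁ trace)

      prefix≡rounds : ∀ j → j ℕ.≤ κ ℕ.+ κ → PB.prefix j ≡ proj₁ (CA.rounds j)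
      prefix≡rounds zero    _ = refl
      prefix≡rounds (suc j) j< = trans (CB.prefix-suc j)
        (cong₂ insert (trans (LB.message≡ j) (proj₂ trace j j<)) (prefix≡rounds j (ℕₚ.<⇒≤ j<)))

      prefix-greedy : ∀ j → j ℕ.< κ ℕ.+ κ → ∀ x → x ∈ VA → f (insert (toℕ x) (PB.prefix j)) ≤ f (PB.prefix (suc j))
      prefix-greedy j j< x x∈ rewrite prefix≡rounds (suc j) j< | prefix≡rounds j (ℕₚ.<⇒≤ j<) =
        CA.grow-best (proj₁ (CA.rounds j)) (toℕ x) (VA⇒candidate x∈)

      prefix⇒candidate : ∀ {x} → x ∈ PB.prefix (κ ℕ.+ κ) → CB.Candidate (toℕ x)
      prefix⇒candidate x∈ =
        let j , j< , eq = CB.∈-prefix (κ ℕ.+ κ) x∈ in inj₂ (j , ℕₚ.≤-trans j< (ℕₚ.≤-reflexive (sym len≡2κ)) , eq)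

      attempt-≤ : ∀ s → s ℕ.≤ κ → f (CB.extend s (κ ∸ s)) ≤ f result
      attempt-≤ s s≤κ = subst (λ S → f S ≤ f result) (CB.attempt≡extend s) (CB.chosen-best s
        (≤m∸[m∸n] κ PB.len s≤κ (ℕₚ.≤-trans s≤κ (ℕₚ.≤-trans (ℕₚ.m≤m+n κ κ) (ℕₚ.≤-reflexive (sym len≡2κ))))))

    -- An element of `O ∩ VA` gives `1 ≤ a` and a message of full length `2κ`, so every start up to
    -- `κ` is tried. Otherwise the message may be empty, but then `O ⊆ VB` and Bob's run from the
    -- empty set is a complete greedy run.
    result-514 : ∀ O → Feasible O → 514 · f O ≤ 1000 · f result
    result-514 O (O⊆ , ∣O∣≤k) with nonempty? (O ∩ VA)
    ... | yes (x₀ , x₀∈A) = protocol-514 f nonNeg monotone submodular κ PB.message PB.prefix CB.prefix-suc VA VB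
            (prefix-greedy x₀∈VA) CB.extend (λ _ → refl) (λ s i → CB.extend-increasing s i)
            (λ s j i _ x cand → CB.grow-best (CB.extend s i) (toℕ x) ([ VB⇒candidate , prefix⇒candidate x₀∈VA ]′ cand))
            (f result) (attempt-≤ x₀∈VA) O O⊆ ∣O∣≤κ 1≤κ (ℕₚ.≤-trans (s≤s z≤n) (x∈p⇒∣p-x∣<∣p∣ x₀∈A))
      where
      x₀∈VA = p∩q⊆q O VA x₀∈A
      ∣O∣≤κ = ≤m∸[m∸n] k (n ℕ.+ 1) ∣O∣≤k (ℕₚ.≤-trans (∣p∣≤n O) (ℕₚ.m≤m+n n 1))
    ... | no empty = greedy-514 f nonNeg monotone submodular {_∈ VB} {CB.extend 0} {κ}
            (λ i → CB.extend-increasing 0 i) (λ i _ x x∈ → CB.grow-best (CB.extend 0 i) (toℕ x) (VB⇒candidate x∈))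
            O O⊆VB 1≤κ ∣O∣≤κ (q⊆p∪q (CB.extend 0 0) O)
            (subst (λ S → f S ≤ f result) (CB.attempt≡extend 0) (CB.chosen-best 0 z≤n))
      where
      ∣O∣≤κ = ≤m∸[m∸n] k (n ℕ.+ 1) ∣O∣≤k (ℕₚ.≤-trans (∣p∣≤n O) (ℕₚ.m≤m+n n 1))
      O⊆VB : ∀ {x} → x ∈ O → x ∈ VB
      O⊆VB x∈ = [ (λ x∈VA → ⊥-elim (empty (_ , x∈p∩q⁺ (x∈ , x∈VA)))) , id ]′ (x∈p∪q⁻ VA VB (O⊆ x∈))

    OPT-514 : 514 · OPT ≤ 1000 · f result
    OPT-514 = Extrema.argmax-all totalOrder id {P = λ x → 514 · x ≤ 1000 · f result}
      -- The maximum starts from `0#`, which is at most the value of the feasible set `∅`.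
      (≤-trans (·-monoʳ-≤ 514 (nonNeg ∅)) (result-514 ∅ (⊥⊆ , ℕₚ.≤-trans (ℕₚ.≤-reflexive (∣⊥∣≡0 n)) z≤n)))
      (Allₚ.map⁺ (All.map (λ {O} → result-514 O) (Allₚ.all-filter feasible? (bitVectors n))))

  fromℕ-inverse : ∀ q → fromℕ (suc q) * fromℕ (suc q) ⁻¹ ≈ 1#
  fromℕ-inverse q = *-inverseʳ (fromℕ (suc q)) λ q≈0 →
    -- If `suc q` copies of 1 made 0, they would equal `suc q` copies of 0, and cancelling the
    -- multiple would give 1 = 0.
    let 1≈0 = ≈-trans (≈-sym (fromℕ-* (suc q) 1#)) (≈-trans (*-identityʳ _) q≈0)
        0≈·0 = ≈-trans (≈-sym (CommutativeRing.zeroʳ commutativeRing _)) (fromℕ-* (suc q) 0#)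
        eq = ≈-trans 1≈0 0≈·0
    in 0≉1 (≤-antisym (·-cancel-≤ q (≤-reflexive (≈-sym eq))) (·-cancel-≤ q (≤-reflexive eq)))

  fraction-≤ : ∀ p q {x y} → p · x ≤ suc q · y → fromℕ p * fromℕ (suc q) ⁻¹ * x ≤ y
  fraction-≤ p q {x} {y} h = ·-cancel-≤ q (begin
    suc q · (fromℕ p * r * x)               ≈⟨ fromℕ-* (suc q) _ ⟨
    fromℕ (suc q) * (fromℕ p * r * x)       ≈⟨ *-congˡ (≈-trans (*-congʳ (*-comm _ _)) (*-assoc _ _ _)) ⟩
    fromℕ (suc q) * (r * (fromℕ p * x))     ≈⟨ *-assoc _ _ _ ⟨
    fromℕ (suc q) * r * (fromℕ p * x)       ≈⟨ *-congʳ (fromℕ-inverse q) ⟩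
    1# * (fromℕ p * x)                      ≈⟨ *-identityˡ _ ⟩
    fromℕ p * x                             ≈⟨ fromℕ-* p x ⟩
    p · x                                   ≤⟨ h ⟩
    suc q · y                               ∎)
    where
    open PosetReasoning poset
    r = fromℕ (suc q) ⁻¹

  𝔼-constant : ∀ (X : Vec Bool 0 → Carrier) → X Vec.[] ≤ 𝔼 0 X
  𝔼-constant X = ≤-reflexive (≈-sym (≈-trans (*-congˡ (+-identityʳ (X Vec.[])))
    (≈-trans (*-congʳ (≈-trans (≈-sym (*-identityˡ _)) (≈-trans (*-congʳ (≈-sym (+-identityʳ 1#))) (fromℕ-inverse 0)))) (*-identityˡ _))))

  approximation : ApproximationGuarantee (fromℕ 514 * fromℕ 1000 ⁻¹) protocol
  approximation I = 0 , (λ _ → S) ,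
    (λ r → (PA.sent I , alice-sends r , (let t , outputs , _ = Bob.bob-outputs I (PA.sent I) in t , outputs)) , result-feasible I) ,
    ≤-trans (fraction-≤ 514 999 (OPT-514 I)) (𝔼-constant (λ _ → Instance.f I S))
    where
    S = Bob.PB.attempt I (PA.sent I) (Bob.PB.chosen I (PA.sent I))
    alice-sends : ∀ r → ∃ λ t → AliceSends protocol I (toList r) t (PA.sent I)
    alice-sends r = let t , s , run , _ , eq = alice-run I (toList r) in t , s , run , eq

  communication : LinearCommunication protocol
  communication = 2 , λ I cs t m sends → subst (λ m → length m ℕ.≤ 2 ℕ.* Instance.k I) (sent-only I sends)
    (ℕₚ.≤-trans (CA.sent-length I) (ℕₚ.+-mono-≤ (κ≤k I) (ℕₚ.≤-trans (κ≤k I) (ℕₚ.≤-reflexive (sym (ℕₚ.+-identityʳ _))))))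

  alice-polynomial : AlicePolynomialTime protocol
  alice-polynomial = 124 , 2 , λ I r →
    let t , s , run , t≤ , eq = alice-run I (toList r) in t , PA.sent I , (s , run , eq) , ℕₚ.≤-trans t≤ (alice-fast I)

  bob-polynomial : BobPolynomialTime protocol
  bob-polynomial = 267 , 3 , λ I m →
    let t , outputs , t≤ = Bob.bob-outputs I m in t , _ , outputs , ℕₚ.≤-trans t≤ (Bob.bob-fast I m)

theorem7 : ∀ {c ℓ₁ ℓ₂} (ℝ : RealField c ℓ₁ ℓ₂) → let open RealField ℝ in let open TwoPlayer ℝ in
    ∃ λ (P : Protocol) →
    ApproximationGuarantee (fromℕ 514 * fromℕ 1000 ⁻¹) P ×
    LinearCommunication P ×
    AlicePolynomialTime P ×
    BobPolynomialTime P
theorem7 ℝ = protocol , approximation , communication , alice-polynomial , bob-polynomial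
  where
  open Guarantees ℝ
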